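{- Let $\Lambda=(\Lambda_1,\ldots,\Lambda_m;\Lambda_{m+1},\ldots,\Lambda_\ell)$ be a superpartition of $(n|m)$ (with $\ell=\ell(\Lambda)$) and let $\Lambda'$ be its conjugate. Then, in the ring of symmetric superfunctions in infinitely many variables, $$\tilde e_{\Lambda_m}\cdots\tilde e_{\Lambda_1}\,e_{\Lambda_{m+1}}\cdots e_{\Lambda_\ell}\;=\;m_{\Lambda'}+\sum_{\Omega\in \mathrm{SPar}(n|m),\ \Omega<\Lambda'}N^{\Omega}_{\Lambda}\,m_\Omega ,$$ where each $N^{\Omega}_{\Lambda}$ is an integer and $<$ is the (strict) Bruhat order on superpartitions. Consequently $\{e_\Lambda:\Lambda\in\mathrm{SPar}(n|m)\}$ is a basis of the $\mathbb{Z}$-module $\mathscr{P}^{S_\infty}_{(n|m)}(\mathbb{Z})$.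
   Context: Variables: $x_1,x_2,\ldots$ commute; $\theta_1,\theta_2,\ldots$ anticommute ($\theta_i\theta_j=-\theta_j\theta_i$, so $\theta_i^2=0$) and commute with the $x$'s. A superpartition of $(n|m)$ is $\Lambda=(\Lambda_1,\ldots,\Lambda_m;\Lambda_{m+1},\Lambda_{m+2},\ldots)$ with $\Lambda_1>\cdots>\Lambda_m\ge0$, $\Lambda_{m+1}\ge\Lambda_{m+2}\ge\cdots\ge0$ (finitely many nonzero), $\sum_i\Lambda_i=n$; $\Lambda^a=(\Lambda_1,\ldots,\Lambda_m)$, $\Lambda^s=(\Lambda_{m+1},\ldots)$. $\mathrm{SPar}(n|m)$ is the set of these. $\ell(\Lambda)=m+\#\{\text{nonzero entries of }\Lambda^s\}$. $\Lambda^*$ is the partition obtained by reordering all entries of $\Lambda$ in nonincreasing order. $C[\Lambda]$ is $\Lambda^*$ with the entries coming from $\Lambda^a$ circled (if a value $b$ of $\Lambda^a$ also occurs in $\Lambda^s$, the leftmost $b$ is circled). $D[\Lambda]$ is the Ferrers diagram of $C[\Lambda]$ (row $j$ has $C[\Lambda]_j$ boxes, rows left justified, possibly empty rows for a circled $0$) with a circle appended at the end of each row $j$ whose entry is circled. The conjugate $\Lambda'$ is the superpartition whose diagram is the transpose of $D[\Lambda]$ (circles included); it lies in $\mathrm{SPar}(n|m)$. Bruhat order: for a composition $\lambda$ (finite sequence of nonnegative integers) let $\lambda^+$ be its nonincreasing rearrangement and $w_\lambda$ the permutation of minimal length with $\lambda=w_\lambda\lambda^+$. For compositions $\lambda,\mu$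 of $n$ with the same number of entries, $\lambda\ge\mu$ iff either $\lambda^+>\mu^+$ in dominance order, or $\lambda^+=\mu^+$ and $w_\lambda\le w_\mu$ in the Bruhat order of the symmetric group. For superpartitions $\Lambda,\Omega$ of $(n|m)$, let $\Lambda^c$ be the composition obtained by replacing the semicolon by a comma (padding symmetric parts with zeros to equal lengths); $\Omega\le\Lambda$ iff $\Omega^c\le\Lambda^c$. Monomials: in $N$ variables, for $\Lambda\in\mathrm{SPar}(n|m)$ with $\ell(\Lambda)\le N$ written with $N$ entries, $m_\Lambda=\frac{1}{n_\Lambda!}\sum_{\sigma\in S_N}\mathcal K_\sigma(\theta_1\cdots\theta_m x_1^{\Lambda_1}\cdots x_N^{\Lambda_N})$, where $\mathcal K_\sigma$ permutes the $x$'s and the $\theta$'s simultaneously ($x_i\mapsto x_{\sigma(i)},\theta_i\mapsto\theta_{\sigma(i)}$) and $n_\Lambda!=\prod_{i\ge0}n_{\Lambda^s}(i)!$ with $n_{\Lambda^s}(i)$ the number of entries of $(\Lambda_{m+1},\ldots,\Lambda_N)$ equal to $i$; in infinitely many variables $m_\Lambda$ is the corresponding stable formal sum. $\mathscr{P}^{S_\infty}_{(n|m)}(\mathbb Z)$ is the $\mathbb Z$-span of $\{m_\Lambda:\Lambda\in\mathrm{SPar}(n|m)\}$ (symmetric superfunctions of degree $n$ in $x$ and $m$ in $\theta$). Elementary functions: $e_0=1$, $e_n=\sum_{j_1<\cdots<j_n}x_{j_1}\cdots x_{j_n}$, $\tilde e_n=\sum_i\theta_i\sum_{j_1<\cdots<j_n,\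 i\notin\{j_k\}}x_{j_1}\cdots x_{j_n}$ ($n\ge0$; $\tilde e_0=\sum_i\theta_i$). For a superpartition $\Lambda$ of fermionic degree $m$: $e_\Lambda=\tilde e_{\Lambda_1}\cdots\tilde e_{\Lambda_m}e_{\Lambda_{m+1}}\cdots e_{\Lambda_{\ell(\Lambda)}}$ (product taken left to right). -}

module Defs where

open import Data.Bool using (Bool; true; false; if_then_else_; _∧_; _∨_)
open import Data.Nat using (ℕ; zero; suc; _+_; _*_; _∸_; _⊔_; _<_; _≤_; _>_; _≥_; _<ᵇ_; _≤ᵇ_; _≡ᵇ_; _!)
import Data.Nat as ℕ
open import Data.Integer using (ℤ; +_; -_; _/ℕ_) renaming (_+_ to _+ℤ_; _*_ to _*ℤ_)
open import Data.List using (List; []; _∷_; _++_; map; concatMap; length; replicate; upTo; reverse; foldr; take; drop; allFin)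
open import Data.Nat.ListAction using (sum; product)
open import Data.Bool.ListAction using (all)
open import Data.List.Relation.Unary.All using (All)
open import Data.List.Relation.Unary.Linked using (Linked)
import Data.List.Properties as LP
import Data.Product.Properties as PP
import Data.Sum.Properties as SumP
open import Data.Vec using (Vec; lookup; tabulate; toList)
open import Data.Fin using (Fin; toℕ) renaming (_≟_ to _≟F_)
open import Data.Maybe using (Maybe; just; nothing)
open import Data.Product using (Σ; ∃; ∃₂; _×_; _,_; proj₁; proj₂)
open import Data.Sum using (_⊎_; inj₁; inj₂)
open import Relation.Nullary using (¬_; does)
open import Relation.Binary.PropositionalEquality using (_≡_; _≢_)
open import Relation.Binary.Construct.Closure.ReflexiveTransitive using (Star)
open import Function.Bundles using (_⇔_)

-- Superpolynomials / symmetric superfunctions in infinitely many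
-- variables x_1,x_2,... and θ_1,θ_2,... , as (possibly infinite)
-- formal ℤ-linear combinations of normalised monomials.

-- A normalised monomial θ_{i_1}⋯θ_{i_k} x^α (i_1<⋯<i_k, α finitely
-- supported) is stored sparsely as the list of variables that occur,
-- from left to right: (g , e) means "skip g variables, then the next
-- variable x_j occurs with": e = inj₁ a : x_j^(a+1) and no θ_j;
-- e = inj₂ a : θ_j x_j^a.  Every monomial has exactly one code.
Entry : Set
Entry = ℕ ⊎ ℕ

Mono : Set
Mono = List (ℕ × Entry)

_≟M_ : (μ ν : Mono) → Relation.Nullary.Dec (μ ≡ ν)
_≟M_ = LP.≡-dec (PP.≡-dec ℕ._≟_ (SumP.≡-dec ℕ._≟_ ℕ._≟_))

-- a superfunction = its coefficient function
SF : Set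
SF = Mono → ℤ

infix 4 _≈_
_≈_ : SF → SF → Set
f ≈ g = ∀ μ → f μ ≡ g μ

sumℤ : List ℤ → ℤ
sumℤ = foldr _+ℤ_ (+ 0)

zeroSF : SF
zeroSF _ = + 0

oneSF : SF
oneSF [] = + 1
oneSF (_ ∷ _) = + 0

_⊕_ : SF → SF → SF
(f ⊕ g) μ = f μ +ℤ g μ

-- dense form: for variables 1,2,...,L the pair (exponent of x_j , θ_j occurs?)
Dense : Set
Dense = List (ℕ × Bool)

entry : Entry → ℕ × Bool
entry (inj₁ a) = suc a , false
entry (inj₂ a) = a , true

toDense : Mono → Dense
toDense [] = []
toDense ((g , e) ∷ r) = replicate g (0 , false) ++ (entry e ∷ toDense r)

toMonoG : ℕ → Dense → Mono
toMonoG g [] = []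
toMonoG g ((zero , false) ∷ r) = toMonoG (suc g) r
toMonoG g ((suc a , false) ∷ r) = (g , inj₁ a) ∷ toMonoG 0 r
toMonoG g ((a , true) ∷ r) = (g , inj₂ a) ∷ toMonoG 0 r

toMono : Dense → Mono
toMono = toMonoG 0

sgn : ℕ → ℤ
sgn zero = + 1
sgn (suc k) = - sgn k

b2n : Bool → ℕ
b2n true = 1
b2n false = 0

-- all ways to write a dense monomial as (θ_J x^β)(θ_K x^γ) (θ_j^2 = 0)
thetaChoices : Bool → List (Bool × Bool)
thetaChoices true = (true , false) ∷ (false , true) ∷ []
thetaChoices false = (false , false) ∷ []

splits : Dense → List (Dense × Dense)
splits [] = ([] , []) ∷ []
splits ((a , t) ∷ r) =
  concatMap (λ b → concatMap (λ tt → map (λ LR → ((b , proj₁ tt) ∷ proj₁ LR) , ((a ∸ b , proj₂ tt) ∷ proj₂ LR))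
                                           (splits r))
                             (thetaChoices t))
            (upTo (suc a))

-- number of pairs (j ∈ J , k ∈ K) with k < j : the sign of
-- θ_J θ_K = ± θ_{J ∪ K} is (-1)^cross
cross : ℕ → Dense → Dense → ℕ
cross c ((_ , tl) ∷ l) ((_ , tr) ∷ r) = (if tl then c else 0) + cross (c + b2n tr) l r
cross c _ _ = 0

_⊗_ : SF → SF → SF
(f ⊗ g) μ = sumℤ (map (λ LR → sgn (cross 0 (proj₁ LR) (proj₂ LR)) *ℤ (f (toMono (proj₁ LR)) *ℤ g (toMono (proj₂ LR))))
                      (splits (toDense μ)))

prodSF : List SF → SF
prodSF = foldr _⊗_ oneSF

countB : {A : Set} → (A → Bool) → List A → ℕ
countB p [] = 0
countB p (x ∷ xs) = b2n (p x) + countB p xs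

isX1 : ℕ × Entry → Bool
isX1 (_ , inj₁ zero) = true
isX1 _ = false

isθ0 : ℕ × Entry → Bool
isθ0 (_ , inj₂ zero) = true
isθ0 _ = false

-- e_n = Σ_{j_1<⋯<j_n} x_{j_1}⋯x_{j_n}
eSF : ℕ → SF
eSF n μ = if all isX1 μ ∧ (length μ ≡ᵇ n) then + 1 else + 0

-- ẽ_n = Σ_i θ_i Σ_{j_1<⋯<j_n, i ∉ {j_k}} x_{j_1}⋯x_{j_n}
etSF : ℕ → SF
etSF n μ = if all (λ v → isX1 v ∨ isθ0 v) μ ∧ (countB isθ0 μ ≡ᵇ 1) ∧ (length μ ≡ᵇ suc n) then + 1 else + 0

-- superpartitions: (Λ^a , Λ^s), Λ^s listed without its zero entries

SP : Set
SP = List ℕ × List ℕ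

record IsSPar (n m : ℕ) (Λ : SP) : Set where
  field
    antiLength : length (proj₁ Λ) ≡ m
    antiStrict : Linked _>_ (proj₁ Λ)
    symWeak    : Linked _≥_ (proj₂ Λ)
    symPos     : All (λ k → 0 < k) (proj₂ Λ)
    total      : sum (proj₁ Λ) + sum (proj₂ Λ) ≡ n

ell : SP → ℕ
ell (a , s) = length a + length s

nthD : List ℕ → ℕ → ℕ
nthD [] _ = 0
nthD (x ∷ xs) zero = x
nthD (x ∷ xs) (suc i) = nthD xs i

indexOf : ℕ → List ℕ → ℕ
indexOf p [] = 0
indexOf p (x ∷ xs) = if x ≡ᵇ p then 0 else suc (indexOf p xs)

insertAll : ℕ → List ℕ → List (List ℕ)
insertAll x [] = (x ∷ []) ∷ []
insertAll x (y ∷ ys) = (x ∷ y ∷ ys) ∷ map (y ∷_) (insertAll x ys)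

-- all permutations of a list (S_N = perms (upTo N), one-line notation)
perms : List ℕ → List (List ℕ)
perms [] = [] ∷ []
perms (x ∷ xs) = concatMap (insertAll x) (perms xs)

invs : List ℕ → ℕ
invs [] = 0
invs (x ∷ xs) = countB (λ y → y <ᵇ x) xs + invs xs

divZ : ℤ → ℕ → ℤ
divZ z zero = + 0
divZ z (suc k) = z /ℕ suc k

fullN : ℕ → SP → List ℕ
fullN N (a , s) = a ++ s ++ replicate (N ∸ (length a + length s)) 0

nfact : ℕ → SP → ℕ
nfact N (a , s) = let sp = drop (length a) (fullN N (a , s)) in
  product (map (λ v → (countB (λ y → y ≡ᵇ v) sp) !) (upTo (suc (sum sp))))

-- coefficient of μ in K_σ(θ_1⋯θ_m x_1^{Λ_1}⋯x_N^{Λ_N})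
--   = θ_{σ(1)}⋯θ_{σ(m)} x_{σ(1)}^{Λ_1}⋯x_{σ(N)}^{Λ_N}
termCoeff : ℕ → SP → List ℕ → Mono → ℤ
termCoeff N (a , s) σ μ =
  let m = length a
      full = fullN N (a , s)
      dense = map (λ p → nthD full (indexOf p σ) , (indexOf p σ <ᵇ m)) (upTo N)
  in if does (toMono dense ≟M μ) then sgn (invs (take m σ)) else + 0

monoN : ℕ → SP → SF
monoN N Λ μ = divZ (sumℤ (map (λ σ → termCoeff N Λ σ μ) (perms (upTo N)))) (nfact N Λ)

-- m_Λ in infinitely many variables: the stable coefficient (N large
-- enough to contain all variables of μ and ℓ(Λ) ≤ N)
monoSF : SP → SF
monoSF Λ μ = monoN (length (toDense μ) ⊔ ell Λ) Λ μ

eLam : SP → SF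
eLam (a , s) = prodSF (map etSF a ++ map eSF s)

eLamRev : SP → SF
eLamRev (a , s) = prodSF (map etSF (reverse a) ++ map eSF s)

LC : Set
LC = List (ℤ × SP)

lin : (SP → SF) → LC → SF
lin b L μ = sumℤ (map (λ p → proj₁ p *ℤ b (proj₂ p) μ) L)

_≟SP_ : (Λ Ω : SP) → Relation.Nullary.Dec (Λ ≡ Ω)
_≟SP_ = PP.≡-dec (LP.≡-dec ℕ._≟_) (LP.≡-dec ℕ._≟_)

coeffOf : LC → SP → ℤ
coeffOf L Λ = sumℤ (map (λ p → if does (proj₂ p ≟SP Λ) then proj₁ p else + 0) L)

-- C[Λ]: rows of Λ* with circled flag (circled first among equal values)
rowsC : List ℕ → List ℕ → List (ℕ × Bool)
rowsC [] s = map (λ x → x , false) s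
rowsC (a ∷ as) [] = map (λ x → x , true) (a ∷ as)
rowsC (a ∷ as) (s ∷ ss) = if s ≤ᵇ a then (a , true) ∷ rowsC as (s ∷ ss) else (s , false) ∷ rowsC (a ∷ as) ss

nthM : {A : Set} → List A → ℕ → Maybe A
nthM [] _ = nothing
nthM (x ∷ xs) zero = just x
nthM (x ∷ xs) (suc i) = nthM xs i

rows : SP → List (ℕ × Bool)
rows (a , s) = rowsC a s

-- cells of D[Λ]: box in row i, column j (0-based)
Box : SP → ℕ → ℕ → Set
Box Λ i j = ∃ λ r → nthM (rows Λ) i ≡ just r × j < proj₁ r

-- circle appended at the end of row i (in column j = row length)
Circle : SP → ℕ → ℕ → Set
Circle Λ i j = nthM (rows Λ) i ≡ just (j , true)

IsConj : SP → SP → Set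
IsConj Λ Λ' = ∀ i j → (Box Λ' i j ⇔ Box Λ j i) × (Circle Λ' i j ⇔ Circle Λ j i)

IsPerm : {N : ℕ} → Vec (Fin N) N → Set
IsPerm {N} w = ∀ i j → lookup w i ≡ lookup w j → i ≡ j

-- lam = w μ, i.e. (w μ)_{w(j)} = μ_j
Acts : {N : ℕ} → Vec (Fin N) N → Vec ℕ N → Vec ℕ N → Set
Acts w μ lam = ∀ j → lookup lam (lookup w j) ≡ lookup μ j

NonIncr : {N : ℕ} → Vec ℕ N → Set
NonIncr v = ∀ i j → toℕ i ≤ toℕ j → lookup v j ≤ lookup v i

IsPlus : {N : ℕ} → Vec ℕ N → Vec ℕ N → Set
IsPlus lam lam⁺ = NonIncr lam⁺ × ∃ λ w → IsPerm w × Acts w lam⁺ lam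

-- Coxeter length = number of inversions
lenP : {N : ℕ} → Vec (Fin N) N → ℕ
lenP {N} w = sum (map (λ i → countB (λ j → (toℕ i <ᵇ toℕ j) ∧ (toℕ (lookup w j) <ᵇ toℕ (lookup w i))) (allFin N)) (allFin N))

IsMinPerm : {N : ℕ} → Vec ℕ N → Vec ℕ N → Vec (Fin N) N → Set
IsMinPerm lam⁺ lam w = IsPerm w × Acts w lam⁺ lam × (∀ v → IsPerm v → Acts v lam⁺ lam → lenP w ≤ lenP v)

swapPos : {N : ℕ} → Vec (Fin N) N → Fin N → Fin N → Vec (Fin N) N
swapPos u i j = tabulate (λ k → lookup u (if does (k ≟F i) then j else (if does (k ≟F j) then i else k)))

BStep : {N : ℕ} → Vec (Fin N) N → Vec (Fin N) N → Set
BStep u v = ∃₂ λ i j → toℕ i < toℕ j × v ≡ swapPos u i j × lenP u < lenP v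

BruhatLe : {N : ℕ} → Vec (Fin N) N → Vec (Fin N) N → Set
BruhatLe = Star BStep

DomLe : {N : ℕ} → Vec ℕ N → Vec ℕ N → Set
DomLe {N} μ lam = ∀ k → k ≤ N → sum (take k (toList μ)) ≤ sum (take k (toList lam))

DomLt : {N : ℕ} → Vec ℕ N → Vec ℕ N → Set
DomLt μ lam = DomLe μ lam × μ ≢ lam

CompLe : {N : ℕ} → Vec ℕ N → Vec ℕ N → Set
CompLe {N} μ lam = ∃₂ λ (lam⁺ mu⁺ : Vec ℕ N) → IsPlus lam lam⁺ × IsPlus μ mu⁺ ×
  (DomLt mu⁺ lam⁺ ⊎ (mu⁺ ≡ lam⁺ × ∃₂ λ wlam wmu → IsMinPerm lam⁺ lam wlam × IsMinPerm mu⁺ μ wmu × BruhatLe wlam wmu))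

padV : (N : ℕ) → List ℕ → Vec ℕ N
padV N l = tabulate (λ i → nthD l (toℕ i))

compLen : SP → ℕ
compLen (a , s) = length a + length s

SPLe : SP → SP → Set
SPLe Ω Λ = let N = compLen Ω ⊔ compLen Λ in
  CompLe (padV N (proj₁ Ω ++ proj₂ Ω)) (padV N (proj₁ Λ ++ proj₂ Λ))

SPLt : SP → SP → Set
SPLt Ω Λ = SPLe Ω Λ × Ω ≢ Λ

AllSPar : ℕ → ℕ → LC → Set
AllSPar n m L = All (λ p → IsSPar n m (proj₂ p)) L

InP : ℕ → ℕ → SF → Set
InP n m f = ∃ λ L → AllSPar n m L × f ≈ lin monoSF L

IsBasisE : ℕ → ℕ → Set
IsBasisE n m =
  (∀ Λ → IsSPar n m Λ → InP n m (eLam Λ)) ×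
  (∀ f → InP n m f → ∃ λ L → AllSPar n m L × f ≈ lin eLam L) ×
  (∀ L → AllSPar n m L → lin eLam L ≈ zeroSF → ∀ Λ → coeffOf L Λ ≡ + 0)

{-# OPTIONS --safe #-}

-- A coefficient of ẽ⋯ẽ e⋯e counts, with signs, the ways to split a monomial among
-- the factors.  The first j variables of a monomial of e_k carry at most min(j, k)
-- letters x, those of a monomial of ẽ_k at most min(j, k) letters x and min(j, k+1)
-- letters x or θ, and these bounds add up over the factors.  Since the product is a
-- symmetric superfunction, its coefficient at m_Ω can be read off the monomial whose
-- exponents are the rows of C[Ω], the circled rows carrying a θ.  If it is nonzero,
-- the partial sums of the rows of Ω are therefore bounded by those of Λ', both with
-- and without counting the circles.  Either Ω^* is strictly dominated by (Λ')^*, or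
-- Ω^* = (Λ')^* and the circles of Ω lie weakly below those of Λ'; since w_Ω is the
-- shuffle determined by the circled rows, moving one circle down by one row at a time
-- gives a Bruhat chain.  At Ω = Λ' every bound is attained, which forces the splitting,
-- so that the coefficient is ±1, and +1 when the ẽ's are multiplied in increasing order.
-- Hence the e_Λ are related to the m_Λ' by a triangular matrix with units on the diagonal
-- (the sum of all partial sums of the rows serves as the linear order), and conjugation
-- being an involution they form a basis.

module Submission where

open import Defs
open import Data.Bool using (Bool; true; false; if_then_else_; _∧_; _∨_; T)
import Data.Bool.Properties as 𝔹
open import Data.Nat as ℕ using (ℕ; zero; suc; _+_; _*_; _∸_; _⊔_; _⊓_; _≤_; _<_; _>_; _≥_; z≤n; s≤s; _<ᵇ_; _≤ᵇ_; _≡ᵇ_; _!)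
open import Data.Nat.Properties as ℕP using (≤-trans; ≤-reflexive; ≤-refl; <⇒≤; +-identityʳ; +-suc; m≤m+n; m≤n+m; ≤-pred; suc-injective)
open import Data.Integer as ℤ using (ℤ; +_; -_; _/ℕ_) renaming (_+_ to _+ℤ_; _*_ to _*ℤ_)
import Data.Integer.Properties as ℤP
import Data.Integer.Tactic.RingSolver as ℤR
import Data.Nat.Tactic.RingSolver as ℕR
open import Data.List as List using (List; []; _∷_; _++_; map; concatMap; length; replicate; upTo; applyUpTo; reverse; take; drop; allFin; filter; deduplicate; cartesianProduct)
import Data.List.Properties as LP
open import Data.Nat.ListAction using (sum; product)
import Data.Nat.ListAction.Properties as LAP
open import Data.Bool.ListAction using (all)
open import Data.List.Relation.Unary.All as All using (All; []; _∷_)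
import Data.List.Relation.Unary.All.Properties as AllP
open import Data.List.Relation.Unary.Any using (here; there)
open import Data.List.Relation.Unary.AllPairs as AP using (AllPairs; []; _∷_)
open import Data.List.Relation.Unary.Linked as Linked using (Linked; []; [-]; _∷_)
import Data.List.Relation.Unary.Linked.Properties as LinkedP
open import Data.List.Relation.Unary.Unique.Propositional using (Unique)
import Data.List.Relation.Unary.Unique.Propositional.Properties as UP
open import Data.List.Membership.Propositional using (_∈_; _∉_; find; lose)
import Data.List.Membership.Propositional.Properties as MP
open import Data.Vec using (Vec; lookup; tabulate; toList)
import Data.Vec.Properties as VP
open import Data.Fin as Fin using (Fin; toℕ; fromℕ<) renaming (_≟_ to _≟F_)
import Data.Fin.Properties as FP
open import Data.Maybe using (just)
open import Data.Product using (∃; ∃₂; _×_; _,_; proj₁; proj₂)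
import Data.Product.Properties as PP
open import Data.Sum using (_⊎_; inj₁; inj₂)
open import Data.Empty using (⊥; ⊥-elim)
open import Data.Unit using (⊤)
open import Relation.Nullary using (¬_; Dec; does; yes; no; contradiction)
open import Relation.Nullary.Decidable using (dec-true; dec-false)
open import Relation.Binary.PropositionalEquality using (_≡_; _≢_; refl; sym; trans; cong; cong₂; subst; subst₂; setoid; resp₂; module ≡-Reasoning)
open import Relation.Binary.Construct.Closure.ReflexiveTransitive as Star using (Star; ε; _◅_; _◅◅_)
open import Function using (_∘_; id; case_of_)
open import Function.Bundles using (_⇔_; mk⇔; Equivalence)
open import Data.List.Relation.Binary.Permutation.Propositional using (_↭_; ↭-sym; ↭-refl; ↭-trans; ↭-prep; ↭-reflexive; ↭⇒↭ₛ)
import Data.List.Relation.Binary.Permutation.Propositional.Properties as ↭P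
import Data.List.Relation.Binary.Permutation.Setoid.Properties as ↭SP
import Data.List.Relation.Unary.AllPairs.Properties as APP

-- Finite sums and products of superfunctions

-- Superfunctions are given on sparse codes in infinitely many variables, while the inductions run
-- along dense lists; blindness to trailing blank letters (`Stable`) connects the two. The awkward
-- object is m_Ω, a sum over all permutations divided by a factorial. Splitting off one variable at
-- a time shows this sum to be the factorial times the sign of sorting the monomial, or zero; so the
-- division is exact and each coefficient of m_Ω is a sign or zero. One weight would see only
-- exponents: with both, the partial sums determine the monomial, and this is what turns attained
-- bounds into a unique splitting. The factors are kept as a list in any order: the bounds ignore
-- the order, only the sign of the leading coefficient feels it. In the extremal monomial the θ of
-- ẽ_k sits in variable k+1, so increasing order of the ẽ's lists the θ's from left to right, which
-- explains the reversed product. For the basis, whose products run the other way, it is enough that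
-- the sign squares to one.

∑ : {A : Set} → List A → (A → ℤ) → ℤ
∑ xs h = sumℤ (map h xs)

module _ {A : Set} where

  ∑-cong∈ : (xs : List A) {h k : A → ℤ} → (∀ {x} → x ∈ xs → h x ≡ k x) → ∑ xs h ≡ ∑ xs k
  ∑-cong∈ []       e = refl
  ∑-cong∈ (x ∷ xs) e = cong₂ _+ℤ_ (e (here refl)) (∑-cong∈ xs (e ∘ there))

  ∑-cong : (xs : List A) {h k : A → ℤ} → (∀ x → h x ≡ k x) → ∑ xs h ≡ ∑ xs k
  ∑-cong xs e = ∑-cong∈ xs (λ {x} _ → e x)

  ∑-zero : (xs : List A) {h : A → ℤ} → (∀ {x} → x ∈ xs → h x ≡ + 0) → ∑ xs h ≡ + 0
  ∑-zero []       e = refl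
  ∑-zero (x ∷ xs) e = cong₂ _+ℤ_ (e (here refl)) (∑-zero xs (e ∘ there))

  ∑-* : (xs : List A) (c : ℤ) (h : A → ℤ) → ∑ xs (λ x → c *ℤ h x) ≡ c *ℤ ∑ xs h
  ∑-* []       c h = sym (ℤP.*-zeroʳ c)
  ∑-* (x ∷ xs) c h = trans (cong (c *ℤ h x +ℤ_) (∑-* xs c h)) (sym (ℤP.*-distribˡ-+ c (h x) (∑ xs h)))

  ∑-+ : (xs : List A) (h k : A → ℤ) → ∑ xs (λ x → h x +ℤ k x) ≡ ∑ xs h +ℤ ∑ xs k
  ∑-+ []       h k = refl
  ∑-+ (x ∷ xs) h k rewrite ∑-+ xs h k = lem (h x) (k x) (∑ xs h) (∑ xs k)
    where
    lem : ∀ a b c d → (a +ℤ b) +ℤ (c +ℤ d) ≡ (a +ℤ c) +ℤ (b +ℤ d)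
    lem = ℤR.solve-∀

  ∑-++ : (xs ys : List A) (h : A → ℤ) → ∑ (xs ++ ys) h ≡ ∑ xs h +ℤ ∑ ys h
  ∑-++ []       ys h = sym (ℤP.+-identityˡ _)
  ∑-++ (x ∷ xs) ys h = trans (cong (h x +ℤ_) (∑-++ xs ys h)) (sym (ℤP.+-assoc (h x) _ _))

  ∑-map : {B : Set} (k : B → A) (xs : List B) (h : A → ℤ) → ∑ (map k xs) h ≡ ∑ xs (h ∘ k)
  ∑-map k xs h = cong sumℤ (sym (LP.map-∘ xs))

  ∑-concatMap : {B : Set} (k : B → List A) (xs : List B) (h : A → ℤ) →
                ∑ (concatMap k xs) h ≡ ∑ xs (λ x → ∑ (k x) h)
  ∑-concatMap k []       h = refl
  ∑-concatMap k (x ∷ xs) h = trans (∑-++ (k x) _ h) (cong (∑ (k x) h +ℤ_) (∑-concatMap k xs h))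

  ∑-single : {xs : List A} {h : A → ℤ} {y : A} → Unique xs → y ∈ xs →
             (∀ {z} → z ∈ xs → z ≢ y → h z ≡ + 0) → ∑ xs h ≡ h y
  ∑-single {x ∷ xs} {h} (x∉ ∷ u) (here refl) e =
    trans (cong (h x +ℤ_) (∑-zero xs λ z∈ → e (there z∈) (λ z≡x → All.lookup x∉ z∈ (sym z≡x)))) (ℤP.+-identityʳ _)
  ∑-single {x ∷ xs} {h} (x∉ ∷ u) (there y∈) e =
    trans (cong₂ _+ℤ_ (e (here refl) (All.lookup x∉ y∈)) (∑-single u y∈ (e ∘ there))) (ℤP.+-identityˡ _)

  ∑-nonzero : (xs : List A) (h : A → ℤ) → ∑ xs h ≢ + 0 → ∃ λ x → x ∈ xs × h x ≢ + 0
  ∑-nonzero [] h ne = ⊥-elim (ne refl)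
  ∑-nonzero (x ∷ xs) h ne with h x ℤ.≟ + 0
  ... | no hx = x , here refl , hx
  ... | yes hx with ∑-nonzero xs h (λ e → ne (cong₂ _+ℤ_ hx e))
  ...   | y , y∈ , hy = y , there y∈ , hy

∑-swap : {A B : Set} (xs : List A) (ys : List B) (h : A → B → ℤ) →
         ∑ xs (λ x → ∑ ys (h x)) ≡ ∑ ys (λ y → ∑ xs (λ x → h x y))
∑-swap []       ys h = sym (∑-zero ys (λ _ → refl))
∑-swap (x ∷ xs) ys h =
  trans (cong (∑ ys (h x) +ℤ_) (∑-swap xs ys h)) (sym (∑-+ ys (h x) _))

sgn-+ : ∀ m n → sgn (m + n) ≡ sgn m *ℤ sgn n
sgn-+ zero    n = sym (ℤP.*-identityˡ _)
sgn-+ (suc m) n = trans (cong -_ (sgn-+ m n)) (ℤP.neg-distribˡ-* (sgn m) (sgn n))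

sgn-sq : ∀ m → sgn m *ℤ sgn m ≡ + 1
sgn-sq zero    = refl
sgn-sq (suc m) = trans (lem (sgn m)) (sgn-sq m)
  where
  lem : ∀ a → - a *ℤ - a ≡ a *ℤ a
  lem = ℤR.solve-∀

*-nonzero : ∀ {a b : ℤ} → a *ℤ b ≢ + 0 → a ≢ + 0 × b ≢ + 0
*-nonzero {a} {b} ne = (λ { refl → ne refl }) , (λ { refl → ne (ℤP.*-zeroʳ a) })

-- Products in dense form, one variable at a time

Letter : Set
Letter = ℕ × Bool

blank : Letter
blank = 0 , false

Coeffs : Set
Coeffs = Dense → ℤ

choicesAt : Letter → ℕ → List (Letter × Letter)
choicesAt (a , t) b = map (λ tt → (b , proj₁ tt) , (a ∸ b , proj₂ tt)) (thetaChoices t)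

choices : Letter → List (Letter × Letter)
choices x = concatMap (choicesAt x) (upTo (suc (proj₁ x)))

∑-choices : ∀ a t (h : Letter × Letter → ℤ) → ∑ (choices (a , t)) h ≡
  ∑ (upTo (suc a)) (λ b → ∑ (thetaChoices t) (λ tt → h ((b , proj₁ tt) , (a ∸ b , proj₂ tt))))
∑-choices a t h = trans (∑-concatMap (choicesAt (a , t)) (upTo (suc a)) h)
  (∑-cong (upTo (suc a)) (λ b → ∑-map (λ tt → (b , proj₁ tt) , (a ∸ b , proj₂ tt)) (thetaChoices t) h))

crossSign : ℕ → Letter × Letter → ℤ
crossSign c (l , r) = sgn (if proj₂ l then c else 0)

-- The product unfolded along the variables. `c` counts the θ's already given to the right factor,
-- which a θ given to the left factor has to jump over. Both factors are carried as functions of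
-- what remains to be read, so inductions need no explicit list of splittings.
Tensor : ℕ → Coeffs → Coeffs → Coeffs
Tensor c f g []      = f [] *ℤ g []
Tensor c f g (x ∷ d) = ∑ (choices x) λ lr →
  crossSign c lr *ℤ Tensor (c + b2n (proj₂ (proj₂ lr))) (f ∘ (proj₁ lr ∷_)) (g ∘ (proj₂ lr ∷_)) d

∑-splits : ∀ c f g d →
  ∑ (splits d) (λ LR → sgn (cross c (proj₁ LR) (proj₂ LR)) *ℤ (f (proj₁ LR) *ℤ g (proj₂ LR))) ≡ Tensor c f g d
∑-splits c f g [] = trans (ℤP.+-identityʳ _) (ℤP.*-identityˡ _)
∑-splits c f g ((a , t) ∷ d) = begin
  ∑ (splits ((a , t) ∷ d)) H
    ≡⟨ ∑-concatMap (λ b → concatMap (extend b) (thetaChoices t)) (upTo (suc a)) H ⟩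
  ∑ (upTo (suc a)) (λ b → ∑ (concatMap (extend b) (thetaChoices t)) H)
    ≡⟨ ∑-cong (upTo (suc a)) (λ b → trans (∑-concatMap (extend b) (thetaChoices t) H)
         (∑-cong (thetaChoices t) (inner b))) ⟩
  ∑ (upTo (suc a)) (λ b → ∑ (thetaChoices t) λ tt → K ((b , proj₁ tt) , (a ∸ b , proj₂ tt)))
    ≡⟨ ∑-choices a t K ⟨
  Tensor c f g ((a , t) ∷ d) ∎
  where
  open ≡-Reasoning
  H : Dense × Dense → ℤ
  H LR = sgn (cross c (proj₁ LR) (proj₂ LR)) *ℤ (f (proj₁ LR) *ℤ g (proj₂ LR))
  K : Letter × Letter → ℤ
  K lr = crossSign c lr *ℤ Tensor (c + b2n (proj₂ (proj₂ lr))) (f ∘ (proj₁ lr ∷_)) (g ∘ (proj₂ lr ∷_)) d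
  cons : ℕ → Bool × Bool → Dense × Dense → Dense × Dense
  cons b tt LR = ((b , proj₁ tt) ∷ proj₁ LR) , ((a ∸ b , proj₂ tt) ∷ proj₂ LR)
  extend : ℕ → Bool × Bool → List (Dense × Dense)
  extend b tt = map (cons b tt) (splits d)
  inner : ∀ b tt → ∑ (extend b tt) H ≡ K ((b , proj₁ tt) , (a ∸ b , proj₂ tt))
  inner b (tl , tr) = begin
    ∑ (extend b (tl , tr)) H
      ≡⟨ ∑-map (cons b (tl , tr)) (splits d) H ⟩
    ∑ (splits d) (H ∘ cons b (tl , tr))
      ≡⟨ ∑-cong (splits d) (λ LR →
          trans (cong (_*ℤ F LR) (sgn-+ (if tl then c else 0) (cross (c + b2n tr) (proj₁ LR) (proj₂ LR))))
                (ℤP.*-assoc (sgn (if tl then c else 0)) (sgn (cross (c + b2n tr) (proj₁ LR) (proj₂ LR))) (F LR))) ⟩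
    ∑ (splits d) (λ LR → sgn (if tl then c else 0) *ℤ (sgn (cross (c + b2n tr) (proj₁ LR) (proj₂ LR)) *ℤ F LR))
      ≡⟨ ∑-* (splits d) (sgn (if tl then c else 0)) (λ LR → sgn (cross (c + b2n tr) (proj₁ LR) (proj₂ LR)) *ℤ F LR) ⟩
    sgn (if tl then c else 0) *ℤ ∑ (splits d) (λ LR → sgn (cross (c + b2n tr) (proj₁ LR) (proj₂ LR)) *ℤ F LR)
      ≡⟨ cong (sgn (if tl then c else 0) *ℤ_) (∑-splits (c + b2n tr) _ _ d) ⟩
    K ((b , tl) , (a ∸ b , tr)) ∎
    where
    F : Dense × Dense → ℤ
    F LR = f ((b , tl) ∷ proj₁ LR) *ℤ g ((a ∸ b , tr) ∷ proj₂ LR)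

-- Scalars instead of plain equality, because exchanging two variables changes each factor by a sign
-- of its own; congruence is the case of scalars 1.
Tensor-scale : ∀ c (f f′ g g′ : Coeffs) s t d → (∀ L → f L ≡ s *ℤ f′ L) → (∀ R → g R ≡ t *ℤ g′ R) →
               Tensor c f g d ≡ (s *ℤ t) *ℤ Tensor c f′ g′ d
Tensor-scale c f f′ g g′ s t [] e e′ rewrite e [] | e′ [] = lem s t (f′ []) (g′ [])
  where
  lem : ∀ s t a b → (s *ℤ a) *ℤ (t *ℤ b) ≡ (s *ℤ t) *ℤ (a *ℤ b)
  lem = ℤR.solve-∀
Tensor-scale c f f′ g g′ s t (x ∷ d) e e′ =
  trans (∑-cong (choices x) (λ { (l , r) →
          trans (cong (crossSign c (l , r) *ℤ_)
                  (Tensor-scale (c + b2n (proj₂ r)) (f ∘ (l ∷_)) (f′ ∘ (l ∷_)) (g ∘ (r ∷_)) (g′ ∘ (r ∷_)) s t d (e ∘ (l ∷_)) (e′ ∘ (r ∷_))))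
                (lem (crossSign c (l , r)) (s *ℤ t) _) }))
        (∑-* (choices x) (s *ℤ t) _)
  where
  lem : ∀ a b u → a *ℤ (b *ℤ u) ≡ b *ℤ (a *ℤ u)
  lem = ℤR.solve-∀

Tensor-cong : ∀ c (f f′ g g′ : Coeffs) d → (∀ L → f L ≡ f′ L) → (∀ R → g R ≡ g′ R) →
              Tensor c f g d ≡ Tensor c f′ g′ d
Tensor-cong c f f′ g g′ d e e′ = trans
  (Tensor-scale c f f′ g g′ (+ 1) (+ 1) d (λ L → trans (e L) (sym (ℤP.*-identityˡ _))) (λ R → trans (e′ R) (sym (ℤP.*-identityˡ _))))
  (ℤP.*-identityˡ _)

-- Adding the θ-flags as numbers encodes θ_j^2 = 0: two flags would give 2, which no Boolean
-- reaches.
Split₁ : Letter → Letter → Letter → Set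
Split₁ x l r = proj₁ x ≡ proj₁ l + proj₁ r × b2n (proj₂ x) ≡ b2n (proj₂ l) + b2n (proj₂ r)

data Split : Dense → Dense → Dense → Set where
  []  : Split [] [] []
  _∷_ : ∀ {x l r d L R} → Split₁ x l r → Split d L R → Split (x ∷ d) (l ∷ L) (r ∷ R)

∈-thetaChoices : ∀ {t tl tr} → (tl , tr) ∈ thetaChoices t → b2n t ≡ b2n tl + b2n tr
∈-thetaChoices {false} (here refl) = refl
∈-thetaChoices {true} (here refl) = refl
∈-thetaChoices {true} (there (here refl)) = refl

∈-choices : ∀ {x l r} → (l , r) ∈ choices x → Split₁ x l r
∈-choices {a , t} p with MP.∈-concatMap⁻ (choicesAt (a , t)) {xs = upTo (suc a)} p
... | q with find q
... | b , b∈ , r with MP.∈-map⁻ _ r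
... | tt , tt∈ , refl = sym (ℕP.m+[n∸m]≡n (ℕP.<⇒≤pred (MP.∈-upTo⁻ b∈))) , ∈-thetaChoices tt∈

∑-choices-single : ∀ x l r (h : Letter × Letter → ℤ) → Split₁ x l r →
  (∀ l′ r′ → Split₁ x l′ r′ → (l′ , r′) ≢ (l , r) → h (l′ , r′) ≡ + 0) → ∑ (choices x) h ≡ h (l , r)
∑-choices-single (a , t) (b , tl) (b′ , tr) h (refl , e) z =
  trans (∑-choices a t h) (trans
    (∑-single (UP.upTo⁺ (suc (b + b′))) (MP.∈-upTo⁺ (s≤s (m≤m+n b b′)))
       (λ {c} c∈ c≢b → ∑-zero (thetaChoices t) (λ tt∈ →
          z _ _ (sym (ℕP.m+[n∸m]≡n (ℕP.<⇒≤pred (MP.∈-upTo⁻ c∈))) , ∈-thetaChoices tt∈)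
            (λ q → c≢b (cong (proj₁ ∘ proj₁) q)))))
    (subst (λ k → ∑ (thetaChoices t) (λ tt → h ((b , proj₁ tt) , (k , proj₂ tt))) ≡ h ((b , tl) , (b′ , tr)))
       (sym (ℕP.m+n∸m≡n b b′)) (fin t tl tr e z)))
  where
  fin : ∀ t tl tr → b2n t ≡ b2n tl + b2n tr →
    (∀ l′ r′ → Split₁ (b + b′ , t) l′ r′ → (l′ , r′) ≢ ((b , tl) , (b′ , tr)) → h (l′ , r′) ≡ + 0) →
    ∑ (thetaChoices t) (λ tt → h ((b , proj₁ tt) , (b′ , proj₂ tt))) ≡ h ((b , tl) , (b′ , tr))
  fin false false false _ z = ℤP.+-identityʳ _
  fin true true false _ z rewrite z (b , false) (b′ , true) (refl , refl) (λ ()) = ℤP.+-identityʳ _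
  fin true false true _ z rewrite z (b , true) (b′ , false) (refl , refl) (λ ()) =
    trans (ℤP.+-identityˡ _) (ℤP.+-identityʳ _)
  fin true true true () z
  fin true false false () z
  fin false true _ () z
  fin false false true () z

-- The source of all upper bounds: whatever cancellation occurs, a nonzero coefficient needs at
-- least one splitting on which both factors are nonzero.
Tensor-nonzero : ∀ c f g d → Tensor c f g d ≢ + 0 →
                 ∃₂ λ L R → Split d L R × f L ≢ + 0 × g R ≢ + 0
Tensor-nonzero c f g [] ne = [] , [] , [] , *-nonzero {f []} ne
Tensor-nonzero c f g (x ∷ d) ne with ∑-nonzero (choices x) _ ne
... | (l , r) , lr∈ , ne′ with Tensor-nonzero (c + b2n (proj₂ r)) (f ∘ (l ∷_)) (g ∘ (r ∷_)) d (proj₂ (*-nonzero {crossSign c (l , r)} ne′))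
... | L , R , sp , nf , ng = l ∷ L , r ∷ R , ∈-choices lr∈ ∷ sp , nf , ng

-- Uniqueness is assumed only among splittings that contribute. A different choice at the first
-- variable has a vanishing inner sum, for otherwise `Tensor-nonzero` would produce a second
-- contributing splitting.
Tensor-unique-split : ∀ c f g {d L R} → Split d L R →
  (∀ {L′ R′} → Split d L′ R′ → f L′ ≢ + 0 → g R′ ≢ + 0 → L′ ≡ L × R′ ≡ R) →
  Tensor c f g d ≡ sgn (cross c L R) *ℤ (f L *ℤ g R)
Tensor-unique-split c f g [] u = sym (ℤP.*-identityˡ _)
Tensor-unique-split c f g {x ∷ d} {l ∷ L} {r ∷ R} (s ∷ sp) u = begin
  Tensor c f g (x ∷ d)
    ≡⟨ ∑-choices-single x l r _ s (λ l′ r′ s′ ne → other l′ r′ s′ ne) ⟩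
  crossSign c (l , r) *ℤ Tensor (c + b2n (proj₂ r)) (f ∘ (l ∷_)) (g ∘ (r ∷_)) d
    ≡⟨ cong (crossSign c (l , r) *ℤ_) (Tensor-unique-split (c + b2n (proj₂ r)) _ _ sp
         (λ sp′ nf ng → let (p , q) = u (s ∷ sp′) nf ng in LP.∷-injectiveʳ p , LP.∷-injectiveʳ q)) ⟩
  crossSign c (l , r) *ℤ (sgn (cross (c + b2n (proj₂ r)) L R) *ℤ (f (l ∷ L) *ℤ g (r ∷ R)))
    ≡⟨ ℤP.*-assoc (crossSign c (l , r)) _ _ ⟨
  (crossSign c (l , r) *ℤ sgn (cross (c + b2n (proj₂ r)) L R)) *ℤ (f (l ∷ L) *ℤ g (r ∷ R))
    ≡⟨ cong (_*ℤ _) (sgn-+ (if proj₂ l then c else 0) _) ⟨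
  sgn (cross c (l ∷ L) (r ∷ R)) *ℤ (f (l ∷ L) *ℤ g (r ∷ R)) ∎
  where
  open ≡-Reasoning
  other : ∀ l′ r′ → Split₁ x l′ r′ → (l′ , r′) ≢ (l , r) →
    crossSign c (l′ , r′) *ℤ Tensor (c + b2n (proj₂ r′)) (f ∘ (l′ ∷_)) (g ∘ (r′ ∷_)) d ≡ + 0
  other l′ r′ s′ ne with Tensor (c + b2n (proj₂ r′)) (f ∘ (l′ ∷_)) (g ∘ (r′ ∷_)) d ℤ.≟ + 0
  ... | yes e = trans (cong (crossSign c (l′ , r′) *ℤ_) e) (ℤP.*-zeroʳ (crossSign c (l′ , r′)))
  ... | no n with Tensor-nonzero (c + b2n (proj₂ r′)) (f ∘ (l′ ∷_)) (g ∘ (r′ ∷_)) d n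
  ...   | L′ , R′ , sp′ , nf , ng with u (s′ ∷ sp′) nf ng
  ...     | refl , refl = ⊥-elim (ne refl)

-- Symmetry

swapSign : Letter → Letter → ℤ
swapSign x y = if proj₂ x ∧ proj₂ y then - + 1 else + 1

-- Adjacent transpositions of the variables suffice. The sign comes from rewriting θ_iθ_j with
-- increasing indices after the exchange.
Symmetric : Coeffs → Set
Symmetric f = ∀ p x y d → f (p ++ x ∷ y ∷ d) ≡ swapSign x y *ℤ f (p ++ y ∷ x ∷ d)

symmetric-∷ : ∀ f x → Symmetric f → Symmetric (f ∘ (x ∷_))
symmetric-∷ f x s p = s (x ∷ p)

sgn-suc′ : ∀ c → sgn (c + 1) ≡ - sgn c
sgn-suc′ c = cong sgn (ℕP.+-comm c 1)

-- The sign bookkeeping for two adjacent variables: crossing signs and the swap signs of the two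
-- factors combine to the swap sign of the product. The θ of each variable is absent, left or right,
-- which gives nine cases; the others contradict the flag equations.
split-swapSign : ∀ c l₁ r₁ l₂ r₂ {x y} → Split₁ x l₁ r₁ → Split₁ y l₂ r₂ → ∀ u →
  crossSign c (l₁ , r₁) *ℤ (crossSign (c + b2n (proj₂ r₁)) (l₂ , r₂) *ℤ ((swapSign l₁ l₂ *ℤ swapSign r₁ r₂) *ℤ u)) ≡
  swapSign x y *ℤ (crossSign c (l₂ , r₂) *ℤ (crossSign (c + b2n (proj₂ r₂)) (l₁ , r₁) *ℤ u))
split-swapSign c (_ , tl) (_ , tr) (_ , ul) (_ , ur) {_ , t} {_ , v} (_ , e) (_ , e′) u = go tl tr ul ur t v e e′
  where
  s = sgn c
  s0 = cong sgn (+-identityʳ c)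
  go : ∀ tl tr ul ur t v → b2n t ≡ b2n tl + b2n tr → b2n v ≡ b2n ul + b2n ur →
    sgn (if tl then c else 0) *ℤ (sgn (if ul then c + b2n tr else 0) *ℤ
       (((if tl ∧ ul then - + 1 else + 1) *ℤ (if tr ∧ ur then - + 1 else + 1)) *ℤ u)) ≡
    (if t ∧ v then - + 1 else + 1) *ℤ (sgn (if ul then c else 0) *ℤ (sgn (if tl then c + b2n ur else 0) *ℤ u))
  go false false false false false false _ _ = refl
  go false false false true false true _ _ = refl
  go false false true false false true _ _ rewrite s0 = lem s u
    where
    lem : ∀ s u → + 1 *ℤ (s *ℤ (+ 1 *ℤ u)) ≡ + 1 *ℤ (s *ℤ (+ 1 *ℤ u))
    lem _ _ = refl
  go false true false false true false _ _ = refl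
  go false true false true true true _ _ = lem u
    where
    lem : ∀ u → + 1 *ℤ (+ 1 *ℤ ((+ 1 *ℤ - + 1) *ℤ u)) ≡ - + 1 *ℤ (+ 1 *ℤ (+ 1 *ℤ u))
    lem = ℤR.solve-∀
  go false true true false true true _ _ rewrite sgn-suc′ c = lem s u
    where
    lem : ∀ s u → + 1 *ℤ (- s *ℤ ((+ 1 *ℤ + 1) *ℤ u)) ≡ - + 1 *ℤ (s *ℤ (+ 1 *ℤ u))
    lem = ℤR.solve-∀
  go true false false false true false _ _ rewrite s0 = lem s u
    where
    lem : ∀ s u → s *ℤ (+ 1 *ℤ ((+ 1 *ℤ + 1) *ℤ u)) ≡ + 1 *ℤ (+ 1 *ℤ (s *ℤ u))
    lem = ℤR.solve-∀
  go true false false true true true _ _ rewrite sgn-suc′ c = lem s u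
    where
    lem : ∀ s u → s *ℤ (+ 1 *ℤ ((+ 1 *ℤ + 1) *ℤ u)) ≡ - + 1 *ℤ (+ 1 *ℤ (- s *ℤ u))
    lem = ℤR.solve-∀
  go true false true false true true _ _ rewrite s0 = lem s u
    where
    lem : ∀ s u → s *ℤ (s *ℤ ((- + 1 *ℤ + 1) *ℤ u)) ≡ - + 1 *ℤ (s *ℤ (s *ℤ u))
    lem = ℤR.solve-∀
  go false false true true _ false _ ()
  go false false true true _ true _ ()
  go false true true true _ false _ ()
  go false true true true _ true _ ()
  go true false true true _ false _ ()
  go true false true true _ true _ ()
  go true true _ _ false _ () _
  go true true _ _ true _ () _

tensor-symmetric : ∀ c f g → Symmetric f → Symmetric g → Symmetric (Tensor c f g)
tensor-symmetric c f g sf sg (z ∷ p) x y d = begin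
  ∑ (choices z) _
    ≡⟨ ∑-cong (choices z) (λ { (l , r) → trans (cong (crossSign c (l , r) *ℤ_)
         (tensor-symmetric (c + b2n (proj₂ r)) (f ∘ (l ∷_)) (g ∘ (r ∷_)) (symmetric-∷ f l sf) (symmetric-∷ g r sg) p x y d))
         (lem (crossSign c (l , r)) (swapSign x y) _) }) ⟩
  ∑ (choices z) _
    ≡⟨ ∑-* (choices z) (swapSign x y) _ ⟩
  swapSign x y *ℤ Tensor c f g (z ∷ p ++ y ∷ x ∷ d) ∎
  where
  open ≡-Reasoning
  lem : ∀ a b u → a *ℤ (b *ℤ u) ≡ b *ℤ (a *ℤ u)
  lem = ℤR.solve-∀
tensor-symmetric c f g sf sg [] x y d = begin
  ∑ (choices x) (λ lr → crossSign c lr *ℤ ∑ (choices y) (λ lr′ →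
     crossSign (c + θr lr) lr′ *ℤ U lr lr′))
    ≡⟨ ∑-cong (choices x) (λ lr → ∑-* (choices y) (crossSign c lr) _) ⟨
  ∑ (choices x) (λ lr → ∑ (choices y) (λ lr′ →
     crossSign c lr *ℤ (crossSign (c + θr lr) lr′ *ℤ U lr lr′)))
    ≡⟨ ∑-cong∈ (choices x) (λ {lr} lr∈ → ∑-cong∈ (choices y) (λ {lr′} lr′∈ →
         trans (cong (λ w → crossSign c lr *ℤ (crossSign (c + θr lr) lr′ *ℤ w)) (swap lr lr′))
               (split-swapSign c (proj₁ lr) (proj₂ lr) (proj₁ lr′) (proj₂ lr′) {x} {y} (∈-choices lr∈) (∈-choices lr′∈) (U lr′ lr)))) ⟩
  ∑ (choices x) (λ lr → ∑ (choices y) (λ lr′ → V lr lr′))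
    ≡⟨ ∑-swap (choices x) (choices y) V ⟩
  ∑ (choices y) (λ lr′ → ∑ (choices x) (λ lr → V lr lr′))
    ≡⟨ ∑-cong (choices y) (λ lr′ → trans (∑-* (choices x) (swapSign x y) _)
         (cong (swapSign x y *ℤ_) (∑-* (choices x) (crossSign c lr′) _))) ⟩
  ∑ (choices y) (λ lr′ → swapSign x y *ℤ (crossSign c lr′ *ℤ ∑ (choices x) (λ lr →
     crossSign (c + θr lr′) lr *ℤ U lr′ lr)))
    ≡⟨ ∑-* (choices y) (swapSign x y) _ ⟩
  swapSign x y *ℤ Tensor c f g (y ∷ x ∷ d) ∎
  where
  open ≡-Reasoning
  θr : Letter × Letter → ℕ
  θr lr = b2n (proj₂ (proj₂ lr))
  U : Letter × Letter → Letter × Letter → ℤ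
  U lr lr′ = Tensor (c + θr lr + θr lr′) (λ L → f (proj₁ lr ∷ proj₁ lr′ ∷ L)) (λ R → g (proj₂ lr ∷ proj₂ lr′ ∷ R)) d
  V : Letter × Letter → Letter × Letter → ℤ
  V lr lr′ = swapSign x y *ℤ (crossSign c lr′ *ℤ (crossSign (c + θr lr′) lr *ℤ U lr′ lr))
  +-swap : ∀ a b e → a + b + e ≡ a + e + b
  +-swap = ℕR.solve-∀
  -- Exchanging the two letters costs each factor its own sign, while the number of θ's handed to
  -- the right factor stays the same.
  swap : ∀ lr lr′ → U lr lr′ ≡ (swapSign (proj₁ lr) (proj₁ lr′) *ℤ swapSign (proj₂ lr) (proj₂ lr′)) *ℤ U lr′ lr
  swap lr lr′ rewrite +-swap c (θr lr) (θr lr′) =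
    Tensor-scale (c + θr lr′ + θr lr)
      _ (λ L → f (proj₁ lr′ ∷ proj₁ lr ∷ L)) _ (λ R → g (proj₂ lr′ ∷ proj₂ lr ∷ R))
      (swapSign (proj₁ lr) (proj₁ lr′)) (swapSign (proj₂ lr) (proj₂ lr′)) d (sf [] (proj₁ lr) (proj₁ lr′)) (sg [] (proj₂ lr) (proj₂ lr′))

-- Stability and the two codes of a monomial

Stable : Coeffs → Set
Stable f = ∀ d → f (d ++ blank ∷ []) ≡ f d

tensor-stable : ∀ c {f g} → Stable f → Stable g → Stable (Tensor c f g)
tensor-stable c {f} {g} sf sg [] = trans (ℤP.+-identityʳ _) (trans (ℤP.*-identityˡ _) (cong₂ _*ℤ_ (sf []) (sg [])))
tensor-stable c {f} {g} sf sg (x ∷ d) =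
  ∑-cong (choices x) (λ { (l , r) → cong (crossSign c (l , r) *ℤ_)
    (tensor-stable (c + b2n (proj₂ r)) (sf ∘ (l ∷_)) (sg ∘ (r ∷_)) d) })

at : Dense → ℕ → Letter
at []      _       = blank
at (x ∷ d) zero    = x
at (x ∷ d) (suc i) = at d i

infix 4 _≃_
_≃_ : Dense → Dense → Set
d ≃ d′ = ∀ i → at d i ≡ at d′ i

-- Lists that agree under `at` differ only by trailing blanks, that is, by variables that do not
-- occur. The codomain is general since `toMono`, `toSP` and `partialSum` are stable too, not only
-- coefficients.
stable-≃ : ∀ {A : Set} {f : Dense → A} → (∀ d → f (d ++ blank ∷ []) ≡ f d) → ∀ d d′ → d ≃ d′ → f d ≡ f d′
stable-≃ sf [] [] e = refl
stable-≃ {f = f} sf [] (y ∷ d′) e with refl ← e 0 =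
  trans (sym (sf [])) (stable-≃ {f = f ∘ (blank ∷_)} (sf ∘ (blank ∷_)) [] d′ (e ∘ suc))
stable-≃ {f = f} sf (x ∷ d) [] e with refl ← e 0 =
  trans (stable-≃ {f = f ∘ (blank ∷_)} (sf ∘ (blank ∷_)) d [] (e ∘ suc)) (sf [])
stable-≃ {f = f} sf (x ∷ d) (y ∷ d′) e with refl ← e 0 =
  stable-≃ {f = f ∘ (x ∷_)} (sf ∘ (x ∷_)) d d′ (e ∘ suc)

toMonoG-stable : ∀ g d → toMonoG g (d ++ blank ∷ []) ≡ toMonoG g d
toMonoG-stable g [] = refl
toMonoG-stable g ((zero , false) ∷ d) = toMonoG-stable (suc g) d
toMonoG-stable g ((suc a , false) ∷ d) = cong (_ ∷_) (toMonoG-stable 0 d)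
toMonoG-stable g ((zero , true) ∷ d) = cong (_ ∷_) (toMonoG-stable 0 d)
toMonoG-stable g ((suc a , true) ∷ d) = cong (_ ∷_) (toMonoG-stable 0 d)

≃-++ : ∀ p {d d′} → d ≃ d′ → p ++ d ≃ p ++ d′
≃-++ [] e = e
≃-++ (x ∷ p) e zero = refl
≃-++ (x ∷ p) e (suc i) = ≃-++ p e i

≃-∷ : ∀ x {d d′} → d ≃ d′ → x ∷ d ≃ x ∷ d′
≃-∷ x = ≃-++ (x ∷ [])

at-blanks : ∀ g i → at (replicate g blank) i ≡ blank
at-blanks zero    i       = refl
at-blanks (suc g) zero    = refl
at-blanks (suc g) (suc i) = at-blanks g i

replicate-shift : ∀ {A : Set} (x : A) g d → replicate (suc g) x ++ d ≡ replicate g x ++ x ∷ d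
replicate-shift x zero d = refl
replicate-shift x (suc g) d = cong (x ∷_) (replicate-shift x g d)

toDense-toMonoG : ∀ g d → toDense (toMonoG g d) ≃ replicate g blank ++ d
toDense-toMonoG g [] i = trans (sym (at-blanks g i)) (cong (λ l → at l i) (sym (LP.++-identityʳ (replicate g blank))))
toDense-toMonoG g ((zero , false) ∷ d) i =
  trans (toDense-toMonoG (suc g) d i) (cong (λ l → at l i) (replicate-shift blank g d))
toDense-toMonoG g ((suc a , false) ∷ d) = ≃-++ (replicate g blank) (≃-∷ _ (toDense-toMonoG 0 d))
toDense-toMonoG g ((zero , true) ∷ d) = ≃-++ (replicate g blank) (≃-∷ _ (toDense-toMonoG 0 d))
toDense-toMonoG g ((suc a , true) ∷ d) = ≃-++ (replicate g blank) (≃-∷ _ (toDense-toMonoG 0 d))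

toDense-toMono : ∀ d → toDense (toMono d) ≃ d
toDense-toMono = toDense-toMonoG 0

toMonoG-blanks : ∀ g h d → toMonoG g (replicate h blank ++ d) ≡ toMonoG (h + g) d
toMonoG-blanks g zero d = refl
toMonoG-blanks g (suc h) d = trans (toMonoG-blanks (suc g) h d) (cong (λ k → toMonoG k d) (+-suc h g))

toMono-toDense : ∀ μ → toMono (toDense μ) ≡ μ
toMono-toDense [] = refl
toMono-toDense ((g , inj₁ a) ∷ μ) = trans (toMonoG-blanks 0 g _)
  (cong₂ (λ h ν → (h , inj₁ a) ∷ ν) (+-identityʳ g) (toMono-toDense μ))
toMono-toDense ((g , inj₂ zero) ∷ μ) = trans (toMonoG-blanks 0 g _)
  (cong₂ (λ h ν → (h , inj₂ 0) ∷ ν) (+-identityʳ g) (toMono-toDense μ))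
toMono-toDense ((g , inj₂ (suc a)) ∷ μ) = trans (toMonoG-blanks 0 g _)
  (cong₂ (λ h ν → (h , inj₂ (suc a)) ∷ ν) (+-identityʳ g) (toMono-toDense μ))

-- A factor (t , n) stands for ẽ_n if t is true and for e_n otherwise.
Factor : Set
Factor = Bool × ℕ

⟦_⟧ : Factor → SF
⟦ true , n ⟧ = etSF n
⟦ false , n ⟧ = eSF n

-- e_n and ẽ_n read by one automaton: the flag tells whether a θ is still to come, the number how
-- many letters x are.
elem : Bool → ℕ → Coeffs
elem t n ((zero , false) ∷ d) = elem t n d
elem false zero [] = + 1
elem false (suc n) [] = + 0
elem true n [] = + 0
elem t (suc n) ((suc zero , false) ∷ d) = elem t n d
elem true n ((zero , true) ∷ d) = elem false n d
elem _ _ _ = + 0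

b→ℤ : Bool → ℤ
b→ℤ b = if b then + 1 else + 0

eSF-elem : ∀ n g d → eSF n (toMonoG g d) ≡ elem false n d
eSF-elem zero g [] = refl
eSF-elem (suc n) g [] = refl
eSF-elem n g ((zero , false) ∷ d) = eSF-elem n (suc g) d
eSF-elem zero g ((suc zero , false) ∷ d) = cong b→ℤ (𝔹.∧-zeroʳ (all isX1 (toMonoG 0 d)))
eSF-elem (suc n) g ((suc zero , false) ∷ d) = eSF-elem n 0 d
eSF-elem zero g ((suc (suc a) , false) ∷ d) = refl
eSF-elem (suc n) g ((suc (suc a) , false) ∷ d) = refl
eSF-elem zero g ((zero , true) ∷ d) = refl
eSF-elem (suc n) g ((zero , true) ∷ d) = refl
eSF-elem zero g ((suc a , true) ∷ d) = refl
eSF-elem (suc n) g ((suc zero , true) ∷ d) = refl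
eSF-elem (suc n) g ((suc (suc a) , true) ∷ d) = refl

-- Once the θ of ẽ_n has been read, no further one may follow, so the test for ẽ_n on the rest
-- becomes the test for e_n.
all-noθ : ∀ μ b → all (λ v → isX1 v ∨ isθ0 v) μ ∧ (countB isθ0 μ ≡ᵇ 0) ∧ b ≡ all isX1 μ ∧ b
all-noθ [] b = refl
all-noθ ((g , inj₁ zero) ∷ μ) b = all-noθ μ b
all-noθ ((g , inj₁ (suc _)) ∷ μ) b = refl
all-noθ ((g , inj₂ zero) ∷ μ) b = 𝔹.∧-zeroʳ (all (λ v → isX1 v ∨ isθ0 v) μ)
all-noθ ((g , inj₂ (suc _)) ∷ μ) b = refl

etSF-elem : ∀ n g d → etSF n (toMonoG g d) ≡ elem true n d
etSF-elem zero g [] = refl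
etSF-elem (suc n) g [] = refl
etSF-elem n g ((zero , false) ∷ d) = etSF-elem n (suc g) d
etSF-elem zero g ((suc zero , false) ∷ d) = cong b→ℤ (lem (all (λ v → isX1 v ∨ isθ0 v) (toMonoG 0 d)) (toMonoG 0 d))
  where
  lem : ∀ b μ → b ∧ (countB isθ0 μ ≡ᵇ 1) ∧ (length μ ≡ᵇ 0) ≡ false
  lem b [] = 𝔹.∧-zeroʳ b
  lem b (x ∷ μ) = trans (cong (b ∧_) (𝔹.∧-zeroʳ _)) (𝔹.∧-zeroʳ b)
etSF-elem (suc n) g ((suc zero , false) ∷ d) = etSF-elem n 0 d
etSF-elem zero g ((suc (suc a) , false) ∷ d) = refl
etSF-elem (suc n) g ((suc (suc a) , false) ∷ d) = refl
etSF-elem zero g ((zero , true) ∷ d) = trans (cong b→ℤ (all-noθ (toMonoG 0 d) _)) (eSF-elem zero 0 d)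
etSF-elem (suc n) g ((zero , true) ∷ d) = trans (cong b→ℤ (all-noθ (toMonoG 0 d) _)) (eSF-elem (suc n) 0 d)
etSF-elem zero g ((suc a , true) ∷ d) = refl
etSF-elem (suc n) g ((suc zero , true) ∷ d) = refl
etSF-elem (suc n) g ((suc (suc a) , true) ∷ d) = refl

⟦⟧-elem : ∀ t n d → ⟦ t , n ⟧ (toMono d) ≡ elem t n d
⟦⟧-elem true n d = etSF-elem n 0 d
⟦⟧-elem false n d = eSF-elem n 0 d

elem-stable : ∀ t n → Stable (elem t n)
elem-stable t n d = trans (sym (⟦⟧-elem t n (d ++ blank ∷ []))) (trans (cong ⟦ t , n ⟧ (toMonoG-stable 0 d)) (⟦⟧-elem t n d))

prodCoeff : List Factor → Coeffs
prodCoeff []             = elem false 0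
prodCoeff ((t , n) ∷ fs) = Tensor 0 (elem t n) (prodCoeff fs)

prodCoeff-stable : ∀ fs → Stable (prodCoeff fs)
prodCoeff-stable [] = elem-stable false 0
prodCoeff-stable ((t , n) ∷ fs) = tensor-stable 0 (elem-stable t n) (prodCoeff-stable fs)

-- The right factor of a splitting is read through `toMono` and back through `toDense`, which
-- restores it only up to trailing blanks; stability absorbs the difference.
prodSF-coeff : ∀ fs μ → prodSF (map ⟦_⟧ fs) μ ≡ prodCoeff fs (toDense μ)
prodSF-coeff [] μ = trans (lem μ) (trans (cong (eSF 0) (sym (toMono-toDense μ))) (eSF-elem 0 0 (toDense μ)))
  where
  lem : ∀ μ → oneSF μ ≡ eSF 0 μ
  lem [] = refl
  lem (x ∷ μ) = cong b→ℤ (sym (𝔹.∧-zeroʳ (all isX1 (x ∷ μ))))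
prodSF-coeff ((t , n) ∷ fs) μ = trans (∑-splits 0 (⟦ t , n ⟧ ∘ toMono) (prodSF (map ⟦_⟧ fs) ∘ toMono) (toDense μ))
  (Tensor-cong 0 (⟦ t , n ⟧ ∘ toMono) (elem t n) (prodSF (map ⟦_⟧ fs) ∘ toMono) (prodCoeff fs) (toDense μ) (⟦⟧-elem t n)
    (λ R → trans (prodSF-coeff fs (toMono R)) (stable-≃ (prodCoeff-stable fs) _ R (toDense-toMono R))))

-- Products of elementary functions

data Elementary : Bool → ℕ → Dense → Set where
  nil  : Elementary false 0 []
  skip : ∀ {t n d} → Elementary t n d → Elementary t n ((0 , false) ∷ d)
  put  : ∀ {t n d} → Elementary t n d → Elementary t (suc n) ((1 , false) ∷ d)
  mark : ∀ {n d} → Elementary false n d → Elementary true n ((0 , true) ∷ d)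

elem-one : ∀ {t n d} → Elementary t n d → elem t n d ≡ + 1
elem-one nil      = refl
elem-one (skip e) = elem-one e
elem-one (put e)  = elem-one e
elem-one (mark e) = elem-one e

elem-nonzero : ∀ t n d → elem t n d ≢ + 0 → Elementary t n d
elem-nonzero false zero    [] _ = nil
elem-nonzero false (suc n) [] z = ⊥-elim (z refl)
elem-nonzero true  n       [] z = ⊥-elim (z refl)
elem-nonzero t n ((zero , false) ∷ d) z = skip (elem-nonzero t n d z)
elem-nonzero t zero ((suc zero , false) ∷ d) z = ⊥-elim (z refl)
elem-nonzero t (suc n) ((suc zero , false) ∷ d) z = put (elem-nonzero t n d z)
elem-nonzero t zero ((suc (suc a) , false) ∷ d) z = ⊥-elim (z refl)
elem-nonzero t (suc n) ((suc (suc a) , false) ∷ d) z = ⊥-elim (z refl)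
elem-nonzero true n ((zero , true) ∷ d) z = mark (elem-nonzero false n d z)
elem-nonzero true zero ((suc a , true) ∷ d) z = ⊥-elim (z refl)
elem-nonzero true (suc n) ((suc zero , true) ∷ d) z = ⊥-elim (z refl)
elem-nonzero true (suc n) ((suc (suc a) , true) ∷ d) z = ⊥-elim (z refl)
elem-nonzero false zero ((zero , true) ∷ d) z = ⊥-elim (z refl)
elem-nonzero false (suc n) ((zero , true) ∷ d) z = ⊥-elim (z refl)
elem-nonzero false zero ((suc a , true) ∷ d) z = ⊥-elim (z refl)
elem-nonzero false (suc n) ((suc zero , true) ∷ d) z = ⊥-elim (z refl)
elem-nonzero false (suc n) ((suc (suc a) , true) ∷ d) z = ⊥-elim (z refl)

-- At most one θ occurs in such a monomial, so an exchange never produces a sign.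
elementary-swap : ∀ p {x y t n d} → Elementary t n (p ++ x ∷ y ∷ d) →
                  Elementary t n (p ++ y ∷ x ∷ d) × swapSign x y ≡ + 1
elementary-swap [] (skip (skip e)) = skip (skip e) , refl
elementary-swap [] (skip (put e))  = put (skip e) , refl
elementary-swap [] (skip (mark e)) = mark (skip e) , refl
elementary-swap [] (put (skip e))  = skip (put e) , refl
elementary-swap [] (put (put e))   = put (put e) , refl
elementary-swap [] (put (mark e))  = mark (put e) , refl
elementary-swap [] (mark (skip e)) = skip (mark e) , refl
elementary-swap [] (mark (put e))  = put (mark e) , refl
elementary-swap (_ ∷ p) (skip e) = let (e′ , s) = elementary-swap p e in skip e′ , s
elementary-swap (_ ∷ p) (put e)  = let (e′ , s) = elementary-swap p e in put e′ , s
elementary-swap (_ ∷ p) (mark e) = let (e′ , s) = elementary-swap p e in mark e′ , s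

elem-symmetric : ∀ t n → Symmetric (elem t n)
elem-symmetric t n p x y d with elem t n (p ++ x ∷ y ∷ d) ℤ.≟ + 0 | elem t n (p ++ y ∷ x ∷ d) ℤ.≟ + 0
... | yes z | yes z′ = trans z (sym (trans (cong (swapSign x y *ℤ_) z′) (ℤP.*-zeroʳ (swapSign x y))))
... | yes z | no nz = contradiction (trans (sym (elem-one (proj₁ (elementary-swap p (elem-nonzero t n _ nz))))) z) λ ()
... | no nz | _ = let e = elem-nonzero t n _ nz ; (e′ , s) = elementary-swap p e in
  trans (elem-one e) (sym (cong₂ _*ℤ_ s (elem-one e′)))

prodCoeff-symmetric : ∀ fs → Symmetric (prodCoeff fs)
prodCoeff-symmetric [] = elem-symmetric false 0
prodCoeff-symmetric ((t , n) ∷ fs) =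
  tensor-symmetric 0 (elem t n) (prodCoeff fs) (elem-symmetric t n) (prodCoeff-symmetric fs)

-- Exponents are weighed together with the θ's if c is true, alone otherwise:
-- the two weights compare the shapes Λ^* and Λ^⊛ (circles turned into boxes).
weight : Bool → Letter → ℕ
weight c (a , t) = a + b2n (t ∧ c)

size : Bool → Factor → ℕ
size c (t , n) = n + b2n (t ∧ c)

partialSum : Bool → ℕ → Dense → ℕ
partialSum c zero    d       = 0
partialSum c (suc j) []      = 0
partialSum c (suc j) (x ∷ d) = weight c x + partialSum c j d

bound : Bool → ℕ → List Factor → ℕ
bound c j []       = 0
bound c j (f ∷ fs) = (j ⊓ size c f) + bound c j fs

total : Bool → Dense → ℕ
total c d = sum (map (weight c) d)

+-interchange : ∀ a b c d → (a + b) + (c + d) ≡ (a + c) + (b + d)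
+-interchange = ℕR.solve-∀

weight-split : ∀ c x l r → Split₁ x l r → weight c x ≡ weight c l + weight c r
weight-split c (a , t) (b , tl) (b′ , tr) (refl , e) =
  trans (cong (λ k → b + b′ + k) (lem c t tl tr e)) (+-interchange b b′ _ _)
  where
  lem : ∀ c t tl tr → b2n t ≡ b2n tl + b2n tr → b2n (t ∧ c) ≡ b2n (tl ∧ c) + b2n (tr ∧ c)
  lem false t tl tr _ rewrite 𝔹.∧-zeroʳ t | 𝔹.∧-zeroʳ tl | 𝔹.∧-zeroʳ tr = refl
  lem true t tl tr e rewrite 𝔹.∧-identityʳ t | 𝔹.∧-identityʳ tl | 𝔹.∧-identityʳ tr = e

partialSum-split : ∀ c j {d L R} → Split d L R → partialSum c j d ≡ partialSum c j L + partialSum c j R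
partialSum-split c zero sp = refl
partialSum-split c (suc j) [] = refl
partialSum-split c (suc j) (_∷_ {x} {l} {r} s sp) =
  trans (cong₂ _+_ (weight-split c x l r s) (partialSum-split c j sp)) (+-interchange (weight c l) (weight c r) _ _)

total-split : ∀ c {d L R} → Split d L R → total c d ≡ total c L + total c R
total-split c [] = refl
total-split c (_∷_ {x} {l} {r} s sp) =
  trans (cong₂ _+_ (weight-split c x l r s) (total-split c sp)) (+-interchange (weight c l) (weight c r) _ _)

split-length : ∀ {d L R} → Split d L R → length L ≡ length d × length R ≡ length d
split-length []       = refl , refl
split-length (_ ∷ sp) = cong suc (proj₁ (split-length sp)) , cong suc (proj₂ (split-length sp))

elementary-bound : ∀ c j {t n d} → Elementary t n d → partialSum c j d ≤ j ⊓ size c (t , n)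
elementary-bound c zero e = z≤n
elementary-bound c (suc j) nil = z≤n
elementary-bound c (suc j) (skip {t} {n} e) =
  ≤-trans (elementary-bound c j e) (ℕP.⊓-monoˡ-≤ (size c (t , n)) (ℕP.n≤1+n j))
elementary-bound c (suc j) (put e) = s≤s (elementary-bound c j e)
elementary-bound false (suc j) (mark {n} e) =
  ≤-trans (elementary-bound false j e) (ℕP.⊓-monoˡ-≤ (n + 0) (ℕP.n≤1+n j))
elementary-bound true (suc j) (mark {n} e) rewrite ℕP.+-comm n 1 =
  s≤s (subst (λ k → partialSum true j _ ≤ j ⊓ k) (+-identityʳ n) (elementary-bound true j e))

elementary-total : ∀ c {t n d} → Elementary t n d → total c d ≡ size c (t , n)
elementary-total c nil = refl
elementary-total c (skip e) = elementary-total c e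
elementary-total c (put e) = cong suc (elementary-total c e)
elementary-total c (mark {n} e) =
  trans (cong (λ k → b2n c + k) (trans (elementary-total c e) (+-identityʳ n))) (ℕP.+-comm (b2n c) n)

prodCoeff-bound : ∀ fs {d} → prodCoeff fs d ≢ + 0 → ∀ c j → partialSum c j d ≤ bound c j fs
prodCoeff-bound [] {d} nz c j =
  ≤-trans (elementary-bound c j (elem-nonzero false 0 d nz)) (≤-reflexive (ℕP.⊓-zeroʳ j))
prodCoeff-bound ((t , n) ∷ fs) {d} nz c j with Tensor-nonzero 0 (elem t n) (prodCoeff fs) d nz
... | L , R , sp , nf , ng rewrite partialSum-split c j sp =
  ℕP.+-mono-≤ (elementary-bound c j (elem-nonzero t n L nf)) (prodCoeff-bound fs ng c j)

prodCoeff-total : ∀ fs {d} → prodCoeff fs d ≢ + 0 → ∀ c → total c d ≡ sum (map (size c) fs)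
prodCoeff-total [] {d} nz c = elementary-total c (elem-nonzero false 0 d nz)
prodCoeff-total ((t , n) ∷ fs) {d} nz c with Tensor-nonzero 0 (elem t n) (prodCoeff fs) d nz
... | L , R , sp , nf , ng rewrite total-split c sp =
  cong₂ _+_ (elementary-total c (elem-nonzero t n L nf)) (prodCoeff-total fs ng c)

-- The extremal monomial and its coefficient

posCount : List Factor → ℕ
posCount []                 = 0
posCount ((t , zero) ∷ fs)  = posCount fs
posCount ((t , suc n) ∷ fs) = suc (posCount fs)

hasMark : List Factor → Bool
hasMark [] = false
hasMark ((t , suc n) ∷ fs) = hasMark fs
hasMark ((true , zero) ∷ fs) = true
hasMark ((false , zero) ∷ fs) = hasMark fs

lower : Factor → Factor
lower (t , suc n) = t , n
lower (t , zero)  = false , zero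

-- The transpose of the diagram whose rows are the factors: each factor puts its letters x as early
-- as possible, one per variable, and an ẽ then puts its θ into the next variable. Thus a letter
-- counts the rows longer than its index and its flag records a circle in that column. After its θ a
-- factor is inert, which is why `lower` resets the flag at zero.
conjDense : ℕ → List Factor → Dense
conjDense zero    fs = []
conjDense (suc N) fs = (posCount fs , hasMark fs) ∷ conjDense N (map lower fs)

length-conjDense : ∀ N fs → length (conjDense N fs) ≡ N
length-conjDense zero    fs = refl
length-conjDense (suc N) fs = cong suc (length-conjDense N (map lower fs))

-- This is the strictness of Λ^a. Two ẽ's of the same index would send both θ's to one variable,
-- where a Boolean flag cannot count them.
Apart : Factor → Factor → Set
Apart (t , n) (u , k) = t ≡ true → u ≡ true → n ≢ k

Distinct : List Factor → Set
Distinct = AllPairs Apart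

apart-lower : ∀ {f g} → Apart f g → Apart (lower f) (lower g)
apart-lower {t , zero}  {u , k}     ap = λ ()
apart-lower {t , suc n} {u , zero}  ap = λ _ ()
apart-lower {t , suc n} {u , suc k} ap p q e = ap p q (cong suc e)

distinct-lower : ∀ {fs} → Distinct fs → Distinct (map lower fs)
distinct-lower []       = []
distinct-lower (a ∷ as) = AllP.map⁺ (All.map (λ {g} → apart-lower {_} {g}) a) ∷ distinct-lower as

apart-noMark : ∀ fs → All (Apart (true , 0)) fs → hasMark fs ≡ false
apart-noMark [] [] = refl
apart-noMark ((true , zero) ∷ fs) (a ∷ as) = ⊥-elim (a refl refl refl)
apart-noMark ((false , zero) ∷ fs) (a ∷ as) = apart-noMark fs as
apart-noMark ((t , suc n) ∷ fs) (a ∷ as) = apart-noMark fs as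

conjDense-split : ∀ N {f fs} → Distinct (f ∷ fs) → Split (conjDense N (f ∷ fs)) (conjDense N (f ∷ [])) (conjDense N fs)
conjDense-split zero d = []
conjDense-split (suc N) {f} {fs} (a ∷ d) = (pos f , mk f a) ∷ conjDense-split N (distinct-lower (a ∷ d))
  where
  pos : ∀ f → posCount (f ∷ fs) ≡ posCount (f ∷ []) + posCount fs
  pos (t , zero)  = refl
  pos (t , suc n) = refl
  mk : ∀ f → All (Apart f) fs → b2n (hasMark (f ∷ fs)) ≡ b2n (hasMark (f ∷ [])) + b2n (hasMark fs)
  mk (true , zero) a rewrite apart-noMark fs a = refl
  mk (false , zero) a = refl
  mk (t , suc n) a = refl

conjDense-blank : ∀ N → Elementary false 0 (conjDense N ((false , 0) ∷ []))
conjDense-blank zero = nil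
conjDense-blank (suc N) = skip (conjDense-blank N)

conjDense-elementary : ∀ N t n → n + b2n t ≤ N → Elementary t n (conjDense N ((t , n) ∷ []))
conjDense-elementary zero false zero p = nil
conjDense-elementary (suc N) false zero p = skip (conjDense-elementary N false zero z≤n)
conjDense-elementary (suc N) true zero p = mark (conjDense-blank N)
conjDense-elementary (suc N) t (suc n) (s≤s p) = put (conjDense-elementary N t n p)

-- For a positive size, min(j+1, s) = 1 + min(j, s-1): the 1's add up to the weight of the first
-- letter and the rest is the bound of the lowered factors. When θ's are weighed, a spent ẽ still
-- has size 1, matched by the flag; distinctness ensures that it is the only one.
conjDense-partialSum : ∀ c j N {fs} → j ≤ N → Distinct fs → partialSum c j (conjDense N fs) ≡ bound c j fs
conjDense-partialSum c zero N {fs} _ _ = sym (lem fs)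
  where
  lem : ∀ fs → bound c 0 fs ≡ 0
  lem []       = refl
  lem (f ∷ fs) = lem fs
conjDense-partialSum c (suc j) (suc N) {fs} (s≤s p) d =
  trans (cong (λ k → weight c (posCount fs , hasMark fs) + k) (conjDense-partialSum c j N p (distinct-lower d))) (sym (step c fs d))
  where
  step : ∀ c fs → Distinct fs → bound c (suc j) fs ≡ weight c (posCount fs , hasMark fs) + bound c j (map lower fs)
  step c [] _ = refl
  step c ((t , suc n) ∷ fs) (_ ∷ d) = cong suc (trans (cong (λ k → (j ⊓ (n + b2n (t ∧ c))) + k) (step c fs d))
    (lem (j ⊓ (n + b2n (t ∧ c))) (weight c (posCount fs , hasMark fs)) (bound c j (map lower fs))))
    where
    lem : ∀ a b c → a + (b + c) ≡ b + (a + c)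
    lem = ℕR.solve-∀
  step c ((false , zero) ∷ fs) (_ ∷ d) rewrite ℕP.⊓-zeroʳ j = step c fs d
  step false ((true , zero) ∷ fs) (_ ∷ d) rewrite ℕP.⊓-zeroʳ j | step false fs d | 𝔹.∧-zeroʳ (hasMark fs) = refl
  step true ((true , zero) ∷ fs) (a ∷ d) rewrite ℕP.⊓-zeroʳ j | step true fs d | apart-noMark fs a =
    lem (posCount fs) (bound true j (map lower fs))
    where
    lem : ∀ a b → 1 + (a + 0 + b) ≡ a + 1 + b
    lem = ℕR.solve-∀

-- The first partial sum without θ's gives the first exponent, the one with θ's then gives its flag;
-- both are cancelled from the remaining sums.
partialSum-injective : ∀ {d d′} → length d ≡ length d′ →
  (∀ c j → j ≤ length d → partialSum c j d ≡ partialSum c j d′) → d ≡ d′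
partialSum-injective {[]} {[]} _ _ = refl
partialSum-injective {(a , t) ∷ d} {(b , u) ∷ d′} len e = cong₂ _∷_ head
  (partialSum-injective (suc-injective len) (λ c j p → ℕP.+-cancelˡ-≡ (weight c (a , t)) _ _
     (trans (e c (suc j) (s≤s p)) (cong (λ x → weight c x + partialSum c j d′) (sym head)))))
  where
  first : ∀ c → weight c (a , t) ≡ weight c (b , u)
  first c = trans (sym (+-identityʳ _)) (trans (e c 1 (s≤s z≤n)) (+-identityʳ _))
  a≡b : a ≡ b
  a≡b = trans (sym (lem a t)) (trans (first false) (lem b u))
    where
    lem : ∀ a t → weight false (a , t) ≡ a
    lem a t rewrite 𝔹.∧-zeroʳ t = +-identityʳ a
  b2n-injective : ∀ t u → b2n t ≡ b2n u → t ≡ u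
  b2n-injective false false _ = refl
  b2n-injective true true _ = refl
  head : (a , t) ≡ (b , u)
  head with refl ← a≡b = cong (a ,_) (subst₂ _≡_ (𝔹.∧-identityʳ t) (𝔹.∧-identityʳ u)
    (b2n-injective (t ∧ true) (u ∧ true) (ℕP.+-cancelˡ-≡ a _ _ (first true))))

-- The signs of the forced splittings, accumulated over the factors. It depends on their order but
-- always squares to one, so it is invertible over the integers.
leadingSign : ℕ → List Factor → ℤ
leadingSign N []       = + 1
leadingSign N (f ∷ fs) = sgn (cross 0 (conjDense N (f ∷ [])) (conjDense N fs)) *ℤ leadingSign N fs

Fits : ℕ → List Factor → Set
Fits N = All (λ f → size true f ≤ N)

≤-sum-tight : ∀ {a b a′ b′} → a ≤ a′ → b ≤ b′ → a + b ≡ a′ + b′ → a ≡ a′ × b ≡ b′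
≤-sum-tight {a} {b} {a′} {b′} p q e = a≡ , ℕP.+-cancelˡ-≡ a _ _ (trans e (cong (_+ b′) (sym a≡)))
  where
  a≡ : a ≡ a′
  a≡ = ℕP.≤-antisym p (ℕP.+-cancelʳ-≤ b′ a′ a (≤-trans (≤-reflexive (sym e)) (ℕP.+-monoʳ-≤ a q)))

-- At conjDense all bounds are attained, so a contributing splitting attains the bounds
-- of both factors; this leaves a single splitting.
prodCoeff-leading : ∀ N {fs} → Fits N fs → Distinct fs → prodCoeff fs (conjDense N fs) ≡ leadingSign N fs
prodCoeff-leading N {[]} _ _ = elem-one (lem N)
  where
  lem : ∀ N → Elementary false 0 (conjDense N [])
  lem zero = nil
  lem (suc N) = skip (lem N)
prodCoeff-leading N {(t , n) ∷ fs} (p ∷ ps) (a ∷ ds) =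
  trans (Tensor-unique-split 0 (elem t n) (prodCoeff fs) (conjDense-split N (a ∷ ds)) unique)
    (cong (sgn (cross 0 (conjDense N ((t , n) ∷ [])) (conjDense N fs)) *ℤ_)
      (trans (cong₂ _*ℤ_ (elem-one (conjDense-elementary N t n (subst (λ b → n + b2n b ≤ N) (𝔹.∧-identityʳ t) p)))
                         (prodCoeff-leading N ps ds))
             (ℤP.*-identityˡ _)))
  where
  unique : ∀ {L R} → Split (conjDense N ((t , n) ∷ fs)) L R → elem t n L ≢ + 0 → prodCoeff fs R ≢ + 0 →
           L ≡ conjDense N ((t , n) ∷ []) × R ≡ conjDense N fs
  unique {L} {R} sp nf ng =
    partialSum-injective (trans lenL (sym (length-conjDense N _)))
      (λ c j j≤ → trans (proj₁ (tight c j (subst (j ≤_) lenL j≤)))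
         (trans (sym (+-identityʳ _)) (sym (conjDense-partialSum c j N (subst (j ≤_) lenL j≤) ([] ∷ []))))) ,
    partialSum-injective (trans lenR (sym (length-conjDense N _)))
      (λ c j j≤ → trans (proj₂ (tight c j (subst (j ≤_) lenR j≤)))
         (sym (conjDense-partialSum c j N (subst (j ≤_) lenR j≤) ds)))
    where
    lenL : length L ≡ N
    lenL = trans (proj₁ (split-length sp)) (length-conjDense N _)
    lenR : length R ≡ N
    lenR = trans (proj₂ (split-length sp)) (length-conjDense N _)
    tight : ∀ c j → j ≤ N → partialSum c j L ≡ j ⊓ size c (t , n) × partialSum c j R ≡ bound c j fs
    tight c j j≤ = ≤-sum-tight (elementary-bound c j (elem-nonzero t n L nf)) (prodCoeff-bound fs ng c j)
      (trans (sym (partialSum-split c j sp)) (conjDense-partialSum c j N j≤ (a ∷ ds)))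

leadingSign-sq : ∀ N fs → leadingSign N fs *ℤ leadingSign N fs ≡ + 1
leadingSign-sq N [] = refl
leadingSign-sq N (f ∷ fs) = trans (lem (sgn k) (leadingSign N fs)) (cong₂ _*ℤ_ (sgn-sq k) (leadingSign-sq N fs))
  where
  k = cross 0 (conjDense N (f ∷ [])) (conjDense N fs)
  lem : ∀ a b → (a *ℤ b) *ℤ (a *ℤ b) ≡ (a *ℤ a) *ℤ (b *ℤ b)
  lem = ℤR.solve-∀

cross-unmarked : ∀ c N n d → cross c (conjDense N ((false , n) ∷ [])) d ≡ 0
cross-unmarked c zero n d = refl
cross-unmarked c (suc N) n [] = refl
cross-unmarked c (suc N) zero ((_ , tr) ∷ d) = cross-unmarked (c + b2n tr) N zero d
cross-unmarked c (suc N) (suc n) ((_ , tr) ∷ d) = cross-unmarked (c + b2n tr) N n d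

data Increasing : List Factor → Set where
  []  : Increasing []
  _∷_  : ∀ {t n fs} → All (λ g → t ≡ true → proj₁ g ≡ true → n < proj₂ g) fs → Increasing fs → Increasing ((t , n) ∷ fs)

above-apart : ∀ {n g} → (proj₁ g ≡ true → suc n < proj₂ g) → Apart (true , 0) g
above-apart p _ q refl with () ← p q

above-lower : ∀ {n g} → (proj₁ g ≡ true → suc n < proj₂ g) → proj₁ (lower g) ≡ true → n < proj₂ (lower g)
above-lower {g = t , zero}  p ()
above-lower {g = t , suc k} p q = ℕP.<-pred (p q)

-- The θ of ẽ_n stands in variable n, counted from 0, and those of the later factors stand strictly
-- further right; no pair has to be exchanged.
cross-increasing : ∀ N n fs → All (λ g → proj₁ g ≡ true → n < proj₂ g) fs →
                   cross 0 (conjDense N ((true , n) ∷ [])) (conjDense N fs) ≡ 0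
cross-increasing zero n fs a = refl
cross-increasing (suc N) zero fs a = cross-unmarked (b2n (hasMark fs)) N zero (conjDense N (map lower fs))
cross-increasing (suc N) (suc n) fs a rewrite apart-noMark fs (All.map (λ {g} → above-apart {n} {g}) a) =
  cross-increasing N n (map lower fs) (AllP.map⁺ (All.map (λ {g} → above-lower {n} {g}) a))

leadingSign-increasing : ∀ N {fs} → Increasing fs → leadingSign N fs ≡ + 1
leadingSign-increasing N [] = refl
leadingSign-increasing N {(false , n) ∷ fs} (_ ∷ i)
  rewrite cross-unmarked 0 N n (conjDense N fs) = trans (ℤP.*-identityˡ _) (leadingSign-increasing N i)
leadingSign-increasing N {(true , n) ∷ fs} (a ∷ i)
  rewrite cross-increasing N n fs (All.map (λ p → p refl) a) = trans (ℤP.*-identityˡ _) (leadingSign-increasing N i)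

-- Sorting a monomial

-- Letters with θ come first, then the others, each kind by decreasing exponent. A sorted monomial
-- is therefore θ_1⋯θ_m x^Λ, with exponents reading Λ^c.
before : Letter → Letter → Bool
before (a , true)  (b , true)  = b ≤ᵇ a
before (a , true)  (b , false) = true
before (a , false) (b , true)  = false
before (a , false) (b , false) = b ≤ᵇ a

repeated : Letter → Letter → Bool
repeated (a , t) (b , u) = t ∧ u ∧ (a ≡ᵇ b)

insert : Letter → Dense → Dense
insert x []      = x ∷ []
insert x (y ∷ l) = if before x y then x ∷ y ∷ l else y ∷ insert x l

-- The factor a symmetric function picks up when the letter moves to its place. The value zero
-- stands for two equal letters carrying θ, on which every symmetric function vanishes.
insertSign : Letter → Dense → ℤ
insertSign x []      = + 1
insertSign x (y ∷ l) = if before x y then (if repeated x y then + 0 else + 1) else swapSign x y *ℤ insertSign x l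

sort : Dense → Dense
sort []      = []
sort (x ∷ d) = insert x (sort d)

sortSign : Dense → ℤ
sortSign []      = + 1
sortSign (x ∷ d) = insertSign x (sort d) *ℤ sortSign d

repeated⇒ : ∀ x y → repeated x y ≡ true → x ≡ y × proj₂ x ≡ true
repeated⇒ (a , true) (b , true) e = cong (_, true) (ℕP.≡ᵇ⇒≡ a b (subst T (sym e) _)) , refl

neg-fixed : ∀ {z : ℤ} → z ≡ - + 1 *ℤ z → z ≡ + 0
neg-fixed {z} e with z ℤ.≟ + 0
... | yes p = p
neg-fixed {+ zero} e | no p = refl
neg-fixed {+ suc n} () | no p
neg-fixed {ℤ.-[1+ n ]} () | no p

symmetric-insert : ∀ f → Symmetric f → ∀ x l → f (x ∷ l) ≡ insertSign x l *ℤ f (insert x l)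
symmetric-insert f s x [] = sym (ℤP.*-identityˡ _)
symmetric-insert f s x (y ∷ l) with before x y
... | false = begin
    f (x ∷ y ∷ l)                                        ≡⟨ s [] x y l ⟩
    swapSign x y *ℤ f (y ∷ x ∷ l)                        ≡⟨ cong (swapSign x y *ℤ_) (symmetric-insert (f ∘ (y ∷_)) (symmetric-∷ f y s) x l) ⟩
    swapSign x y *ℤ (insertSign x l *ℤ f (y ∷ insert x l)) ≡⟨ ℤP.*-assoc (swapSign x y) _ _ ⟨
    (swapSign x y *ℤ insertSign x l) *ℤ f (y ∷ insert x l) ∎
  where open ≡-Reasoning
... | true with repeated x y in eq
...   | false = sym (ℤP.*-identityˡ _)
...   | true with refl , t ← repeated⇒ x y eq =
  -- Exchanging the two equal letters changes nothing but the sign, and an integer equal to its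
  -- negative is zero.
  neg-fixed (trans (s [] x x l) (cong (λ b → (if b ∧ b then - + 1 else + 1) *ℤ f (x ∷ x ∷ l)) t))

symmetric-sort : ∀ f → Symmetric f → ∀ d → f d ≡ sortSign d *ℤ f (sort d)
symmetric-sort f s [] = sym (ℤP.*-identityˡ _)
symmetric-sort f s (x ∷ d) = begin
  f (x ∷ d)                                                     ≡⟨ symmetric-sort (f ∘ (x ∷_)) (symmetric-∷ f x s) d ⟩
  sortSign d *ℤ f (x ∷ sort d)                                  ≡⟨ cong (sortSign d *ℤ_) (symmetric-insert f s x (sort d)) ⟩
  sortSign d *ℤ (insertSign x (sort d) *ℤ f (sort (x ∷ d)))     ≡⟨ lem (sortSign d) (insertSign x (sort d)) _ ⟩
  (insertSign x (sort d) *ℤ sortSign d) *ℤ f (sort (x ∷ d))     ∎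
  where
  open ≡-Reasoning
  lem : ∀ a b c → a *ℤ (b *ℤ c) ≡ (b *ℤ a) *ℤ c
  lem = ℤR.solve-∀

Precedes : Letter → Letter → Set
Precedes (a , true)  (b , true)  = b < a
Precedes (a , true)  (b , false) = ⊤
Precedes (a , false) (b , true)  = ⊥
Precedes (a , false) (b , false) = b ≤ a

Sorted : Dense → Set
Sorted = AllPairs Precedes

precedes-trans : ∀ {x y z} → Precedes x y → Precedes y z → Precedes x z
precedes-trans {_ , true}  {_ , true}  {_ , true}  p q = ℕP.<-trans q p
precedes-trans {_ , true}  {_}         {_ , false} p q = _
precedes-trans {_ , false} {_ , false} {_ , false} p q = ≤-trans q p

≤ᵇ-false : ∀ {a b} → (b ≤ᵇ a) ≡ false → a < b
≤ᵇ-false {a} {b} e = ℕP.≰⇒> λ p → case trans (sym e) (Equivalence.to 𝔹.T-≡ (ℕP.≤⇒≤ᵇ p)) of λ ()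

≤ᵇ-true : ∀ {a b} → (a ≤ᵇ b) ≡ true → a ≤ b
≤ᵇ-true {a} {b} e = ℕP.≤ᵇ⇒≤ a b (subst T (sym e) _)

before-false : ∀ x y → before x y ≡ false → Precedes y x
before-false (a , true)  (b , true)  e = ≤ᵇ-false e
before-false (a , false) (b , true)  e = _
before-false (a , false) (b , false) e = <⇒≤ (≤ᵇ-false e)

before-true : ∀ x y → before x y ≡ true → repeated x y ≡ false → Precedes x y
before-true (a , true) (b , true) e r = ℕP.≤∧≢⇒< (≤ᵇ-true e) λ { refl → case trans (sym r) (lem a) of λ () }
  where
  lem : ∀ a → (a ≡ᵇ a) ≡ true
  lem zero = refl
  lem (suc a) = lem a
before-true (a , true) (b , false) e r = _
before-true (a , false) (b , false) e r = ≤ᵇ-true e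

insert-all : ∀ {P : Letter → Set} x l → P x → All P l → All P (insert x l)
insert-all x [] p [] = p ∷ []
insert-all x (y ∷ l) p (q ∷ qs) with before x y
... | true  = p ∷ q ∷ qs
... | false = q ∷ insert-all x l p qs

insert-sorted : ∀ x l → insertSign x l ≢ + 0 → Sorted l → Sorted (insert x l)
insert-sorted x [] _ _ = [] ∷ []
insert-sorted x (y ∷ l) nz (a ∷ s) with before x y in eb
... | false = insert-all x l (before-false x y eb) a ∷ insert-sorted x l (proj₂ (*-nonzero {swapSign x y} nz)) s
... | true with repeated x y in er
...   | true  = ⊥-elim (nz refl)
...   | false = (p ∷ All.map (λ {z} q → precedes-trans {x} {y} {z} p q) a) ∷ a ∷ s
  where p = before-true x y eb er

sort-sorted : ∀ d → sortSign d ≢ + 0 → Sorted (sort d)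
sort-sorted [] _ = []
sort-sorted (x ∷ d) nz = insert-sorted x (sort d) (proj₁ n) (sort-sorted d (proj₂ n))
  where n = *-nonzero {insertSign x (sort d)} nz

_≟L_ : (x y : Letter) → Dec (x ≡ y)
_≟L_ = PP.≡-dec ℕ._≟_ 𝔹._≟_

_≟D_ : (d d′ : Dense) → Dec (d ≡ d′)
_≟D_ = LP.≡-dec _≟L_

letterCount : Letter → Dense → ℕ
letterCount x []      = 0
letterCount x (y ∷ l) = b2n (does (y ≟L x)) + letterCount x l

delete : Letter → Dense → Dense
delete x []      = []
delete x (y ∷ l) = if does (y ≟L x) then l else y ∷ delete x l

before-refl : ∀ x → before x x ≡ true
before-refl (a , true)  = ≤ᵇ-refl a
  where
  ≤ᵇ-refl : ∀ a → (a ≤ᵇ a) ≡ true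
  ≤ᵇ-refl a = Equivalence.to 𝔹.T-≡ (ℕP.≤⇒≤ᵇ (≤-refl {a}))
before-refl (a , false) = Equivalence.to 𝔹.T-≡ (ℕP.≤⇒≤ᵇ (≤-refl {a}))

delete-insert : ∀ x l → delete x (insert x l) ≡ l
delete-insert x [] rewrite dec-true (x ≟L x) refl = refl
delete-insert x (y ∷ l) with before x y in eb
... | true rewrite dec-true (x ≟L x) refl = refl
... | false with y ≟L x
...   | yes refl = case trans (sym eb) (before-refl x) of λ ()
...   | no _ = cong (y ∷_) (delete-insert x l)

∈-insert : ∀ x l → x ∈ insert x l
∈-insert x [] = here refl
∈-insert x (y ∷ l) with before x y
... | true  = here refl
... | false = there (∈-insert x l)

letterCount-∈ : ∀ x l → letterCount x l ≢ 0 → x ∈ l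
letterCount-∈ x [] n = ⊥-elim (n refl)
letterCount-∈ x (y ∷ l) n with y ≟L x
... | yes e = here (sym e)
... | no _  = there (letterCount-∈ x l n)

∈-letterCount : ∀ {x l} → x ∈ l → letterCount x l ≢ 0
∈-letterCount {x} {y ∷ l} p with y ≟L x
... | yes _ = λ ()
∈-letterCount {x} {y ∷ l} (here e) | no n = ⊥-elim (n (sym e))
∈-letterCount {x} {y ∷ l} (there p) | no n = ∈-letterCount p

precedes-before : ∀ x y → Precedes y x → y ≢ x → before x y ≡ false
precedes-before (a , true) (b , true) p n = lem a b p
  where
  lem : ∀ a b → a < b → (b ≤ᵇ a) ≡ false
  lem a b p with b ≤ᵇ a in e
  ... | false = refl
  ... | true = ⊥-elim (ℕP.<⇒≱ p (≤ᵇ-true e))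
precedes-before (a , false) (b , true) p n = refl
precedes-before (a , false) (b , false) p n with b ≤ᵇ a in e
... | false = refl
... | true = ⊥-elim (n (cong (_, false) (ℕP.≤-antisym (≤ᵇ-true e) p)))

precedes⇒before : ∀ x y → Precedes x y → before x y ≡ true
precedes⇒before x y p with before x y in e
... | true = refl
... | false = both x y p (before-false x y e) e
  where
  both : ∀ x y → Precedes x y → Precedes y x → before x y ≡ false → false ≡ true
  both (_ , true) (_ , true) p q e = ⊥-elim (ℕP.<-asym p q)
  both (a , false) (_ , false) p q e with refl ← ℕP.≤-antisym p q = trans (sym e) (before-refl (a , false))

insert-delete : ∀ {x l} → Sorted l → x ∈ l → insert x (delete x l) ≡ l
insert-delete {x} {y ∷ l} (a ∷ s) p with y ≟L x
insert-delete {x} {.x ∷ []} (a ∷ s) p | yes refl = refl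
insert-delete {x} {.x ∷ z ∷ l} ((q ∷ a) ∷ s) p | yes refl rewrite precedes⇒before x z q = refl
insert-delete {x} {y ∷ l} (a ∷ s) (here e) | no n = ⊥-elim (n (sym e))
insert-delete {x} {y ∷ l} (a ∷ s) (there p) | no n
  rewrite precedes-before x y (All.lookup a p) n = cong (y ∷_) (insert-delete s p)

delete-all : ∀ {P : Letter → Set} x {l} → All P l → All P (delete x l)
delete-all x [] = []
delete-all x {y ∷ l} (p ∷ ps) with does (y ≟L x)
... | true  = ps
... | false = p ∷ delete-all x ps

delete-sorted : ∀ x {l} → Sorted l → Sorted (delete x l)
delete-sorted x [] = []
delete-sorted x {y ∷ l} (a ∷ s) with does (y ≟L x)
... | true  = s
... | false = delete-all x a ∷ delete-sorted x s

length-delete : ∀ {x l} → x ∈ l → suc (length (delete x l)) ≡ length l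
length-delete {x} {y ∷ l} p with y ≟L x
... | yes _ = refl
length-delete {x} {y ∷ l} (here e) | no n = ⊥-elim (n (sym e))
length-delete {x} {y ∷ l} (there p) | no n = cong suc (length-delete p)

-- Sums over the occurrences of the letter, evaluating `G` on what is left. A letter with θ pays a
-- sign for each letter passed; in a sorted list these carry θ's as well, so this is the sign of
-- moving its θ to the front.
pick : Letter → Dense → Coeffs → ℤ
pick x []      G = + 0
pick x (y ∷ l) G = (if does (y ≟L x) then G l else + 0) +ℤ
                   (if proj₂ x then - + 1 else + 1) *ℤ pick x l (G ∘ (y ∷_))

insertSign-unmarked : ∀ a l → insertSign (a , false) l ≡ + 1
insertSign-unmarked a [] = refl
insertSign-unmarked a (y ∷ l) with before (a , false) y
... | true  = refl
... | false = trans (ℤP.*-identityˡ _) (insertSign-unmarked a l)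

insertSign-sorted : ∀ x l → All (Precedes x) l → insertSign x l ≡ + 1
insertSign-sorted x [] _ = refl
insertSign-sorted x (y ∷ l) (p ∷ _) rewrite precedes⇒before x y p with repeated x y in e
... | false = refl
... | true with refl , t ← repeated⇒ x y e = ⊥-elim (irr x p t)
  where
  irr : ∀ x → Precedes x x → proj₂ x ≡ true → ⊥
  irr (_ , true) p _ = ℕP.<-irrefl refl p

delete-minimal : ∀ {v} l → All (Precedes (v , false)) l → Sorted l → (v , false) ∈ l → (v , false) ∷ delete (v , false) l ≡ l
delete-minimal {v} ((u , true) ∷ l) (() ∷ a) s p
delete-minimal {v} ((u , false) ∷ l) (q ∷ a) s p with (u , false) ≟L (v , false)
... | yes refl = refl
delete-minimal {v} ((u , false) ∷ l) (q ∷ a) s (here refl) | no n = ⊥-elim (n refl)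
delete-minimal {v} ((u , false) ∷ l) (q ∷ a) (b ∷ s) (there p) | no n =
  ⊥-elim (n (cong (_, false) (ℕP.≤-antisym q (All.lookup b p))))

-- All copies of a letter without θ leave the same remainder, which accounts for the multiplicity. A
-- letter with θ occurs at most once in a sorted list, and the signs paid on the way are those of
-- inserting it back.
pick-sorted : ∀ x l G → Sorted l →
  pick x l G ≡ + letterCount x l *ℤ (insertSign x (delete x l) *ℤ G (delete x l))
pick-sorted x [] G s = refl
pick-sorted x (y ∷ l) G (a ∷ s) with y ≟L x | letterCount x l ℕ.≟ 0
... | no n | yes z rewrite pick-sorted x l (G ∘ (y ∷_)) s | z =
  trans (ℤP.+-identityˡ _) (ℤP.*-zeroʳ (if proj₂ x then - + 1 else + 1))
... | no n | no c rewrite pick-sorted x l (G ∘ (y ∷_)) s | precedes-before x y (All.lookup a (letterCount-∈ x l c)) n =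
  trans (cong (λ w → + 0 +ℤ w *ℤ (+ letterCount x l *ℤ (insertSign x (delete x l) *ℤ G (y ∷ delete x l))))
          (sgn-eq x y (All.lookup a (letterCount-∈ x l c))))
        (lem (swapSign x y) (+ letterCount x l) (insertSign x (delete x l)) _)
  where
  lem : ∀ a b c d → + 0 +ℤ a *ℤ (b *ℤ (c *ℤ d)) ≡ b *ℤ ((a *ℤ c) *ℤ d)
  lem = ℤR.solve-∀
  sgn-eq : ∀ x y → Precedes y x → (if proj₂ x then - + 1 else + 1) ≡ swapSign x y
  sgn-eq (_ , true) (_ , true) _ = refl
  sgn-eq (_ , false) _ _ = refl
pick-sorted x (.x ∷ l) G (a ∷ s) | yes refl | yes z
  rewrite pick-sorted x l (G ∘ (x ∷_)) s | z | insertSign-sorted x l a =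
  trans (cong (G l +ℤ_) (ℤP.*-zeroʳ (if proj₂ x then - + 1 else + 1))) (lem (G l))
  where
  lem : ∀ g → g +ℤ + 0 ≡ + 1 *ℤ (+ 1 *ℤ g)
  lem = ℤR.solve-∀
pick-sorted (v , true) (.(v , true) ∷ l) G (a ∷ s) | yes refl | no c =
  ⊥-elim (ℕP.<-irrefl refl (All.lookup a (letterCount-∈ (v , true) l c)))
pick-sorted (v , false) (.(v , false) ∷ l) G (a ∷ s) | yes refl | no c
  rewrite pick-sorted (v , false) l (G ∘ ((v , false) ∷_)) s
        | insertSign-unmarked v (delete (v , false) l) | insertSign-unmarked v l
        | delete-minimal l a s (letterCount-∈ (v , false) l c) = lem (+ letterCount (v , false) l) (G l)
  where
  lem : ∀ k g → g +ℤ + 1 *ℤ (k *ℤ (+ 1 *ℤ g)) ≡ (+ 1 +ℤ k) *ℤ (+ 1 *ℤ g)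
  lem = ℤR.solve-∀

-- Sums over permutations

insertAt : ℕ → ℕ → List ℕ → List ℕ
insertAt zero    x τ       = x ∷ τ
insertAt (suc i) x []      = x ∷ []
insertAt (suc i) x (y ∷ τ) = y ∷ insertAt i x τ

insertAll-insertAt : ∀ x τ → insertAll x τ ≡ applyUpTo (λ i → insertAt i x τ) (suc (length τ))
insertAll-insertAt x [] = refl
insertAll-insertAt x (y ∷ τ) = cong ((x ∷ y ∷ τ) ∷_)
  (trans (cong (map (y ∷_)) (insertAll-insertAt x τ)) (LP.map-applyUpTo (λ i → insertAt i x τ) (y ∷_) (suc (length τ))))

insertAll-map : ∀ (f : ℕ → ℕ) x ys → insertAll (f x) (map f ys) ≡ map (map f) (insertAll x ys)
insertAll-map f x [] = refl
insertAll-map f x (y ∷ ys) = cong ((f x ∷ f y ∷ map f ys) ∷_) (trans (cong (map (f y ∷_)) (insertAll-map f x ys))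
  (trans (sym (LP.map-∘ (insertAll x ys))) (LP.map-∘ (insertAll x ys))))

perms-map : ∀ (f : ℕ → ℕ) xs → perms (map f xs) ≡ map (map f) (perms xs)
perms-map f [] = refl
perms-map f (x ∷ xs) = begin
  concatMap (insertAll (f x)) (perms (map f xs))       ≡⟨ cong (concatMap (insertAll (f x))) (perms-map f xs) ⟩
  concatMap (insertAll (f x)) (map (map f) (perms xs)) ≡⟨ LP.concatMap-map (insertAll (f x)) (map f) (perms xs) ⟩
  concatMap (insertAll (f x) ∘ map f) (perms xs)       ≡⟨ LP.concatMap-cong (insertAll-map f x) (perms xs) ⟩
  concatMap (map (map f) ∘ insertAll x) (perms xs)     ≡⟨ LP.map-concatMap (map f) (insertAll x) (perms xs) ⟨
  map (map f) (perms (x ∷ xs))                         ∎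
  where open ≡-Reasoning

∑< : ℕ → (ℕ → ℤ) → ℤ
∑< n h = sumℤ (applyUpTo h n)

∑<-cong : ∀ n {h k} → (∀ i → i < n → h i ≡ k i) → ∑< n h ≡ ∑< n k
∑<-cong zero    e = refl
∑<-cong (suc n) e = cong₂ _+ℤ_ (e 0 (s≤s z≤n)) (∑<-cong n (λ i p → e (suc i) (s≤s p)))

∑<-* : ∀ n c h → ∑< n (λ i → c *ℤ h i) ≡ c *ℤ ∑< n h
∑<-* zero    c h = sym (ℤP.*-zeroʳ c)
∑<-* (suc n) c h = trans (cong (c *ℤ h 0 +ℤ_) (∑<-* n c (h ∘ suc))) (sym (ℤP.*-distribˡ-+ c (h 0) _))

removeAt : Dense → ℕ → Dense
removeAt []      i       = []
removeAt (y ∷ l) zero    = l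
removeAt (y ∷ l) (suc i) = y ∷ removeAt l i

passSign : Letter → ℕ → ℤ
passSign x i = if proj₂ x then sgn i else + 1

pickAt : Letter → Dense → Coeffs → ℕ → ℤ
pickAt x l G i = if does (at l i ≟L x) then passSign x i *ℤ G (removeAt l i) else + 0

pick-∑< : ∀ x l G → pick x l G ≡ ∑< (length l) (pickAt x l G)
pick-∑< x [] G = refl
pick-∑< x (y ∷ l) G = cong₂ _+ℤ_ head (trans (cong (s *ℤ_) (pick-∑< x l (G ∘ (y ∷_))))
  (trans (sym (∑<-* (length l) s (pickAt x l (G ∘ (y ∷_))))) (∑<-cong (length l) (λ i _ → step i))))
  where
  s = if proj₂ x then - + 1 else + 1
  pass0 : ∀ t → (if t then sgn 0 else + 1) ≡ + 1
  pass0 true  = refl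
  pass0 false = refl
  head : (if does (y ≟L x) then G l else + 0) ≡ (if does (y ≟L x) then passSign x 0 *ℤ G l else + 0)
  head = cong (λ w → if does (y ≟L x) then w else + 0)
    (trans (sym (ℤP.*-identityˡ (G l))) (cong (_*ℤ G l) (sym (pass0 (proj₂ x)))))
  pass-suc : ∀ t i g → (if t then - + 1 else + 1) *ℤ ((if t then sgn i else + 1) *ℤ g) ≡ (if t then sgn (suc i) else + 1) *ℤ g
  pass-suc true  i g = lem (sgn i) g
    where
    lem : ∀ a b → - + 1 *ℤ (a *ℤ b) ≡ - a *ℤ b
    lem = ℤR.solve-∀
  pass-suc false i g = ℤP.*-identityˡ (+ 1 *ℤ g)
  step : ∀ i → s *ℤ pickAt x l (G ∘ (y ∷_)) i ≡ pickAt x (y ∷ l) G (suc i)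
  step i with does (at l i ≟L x)
  ... | true  = pass-suc (proj₂ x) i (G (y ∷ removeAt l i))
  ... | false = ℤP.*-zeroʳ s

∑-pick : {A : Set} (xs : List A) (x : Letter) (l : Dense) (G : A → Coeffs) →
         ∑ xs (λ a → pick x l (G a)) ≡ pick x l (λ l′ → ∑ xs (λ a → G a l′))
∑-pick xs x [] G = ∑-zero xs (λ _ → refl)
∑-pick xs x (y ∷ l) G = trans (∑-+ xs _ _) (cong₂ _+ℤ_ head
  (trans (∑-* xs s (λ a → pick x l (G a ∘ (y ∷_)))) (cong (s *ℤ_) (∑-pick xs x l (λ a → G a ∘ (y ∷_))))))
  where
  s = if proj₂ x then - + 1 else + 1
  head : ∑ xs (λ a → if does (y ≟L x) then G a l else + 0) ≡ (if does (y ≟L x) then ∑ xs (λ a → G a l) else + 0)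
  head with does (y ≟L x)
  ... | true  = refl
  ... | false = ∑-zero xs (λ _ → refl)

indexOf-map-suc : ∀ p τ → indexOf (suc p) (map suc τ) ≡ indexOf p τ
indexOf-map-suc p [] = refl
indexOf-map-suc p (t ∷ τ) with t ≡ᵇ p
... | true  = refl
... | false = cong suc (indexOf-map-suc p τ)

indexOf-insertAt : ∀ i τ → i ≤ length τ → indexOf 0 (insertAt i 0 (map suc τ)) ≡ i
indexOf-insertAt zero τ _ = refl
indexOf-insertAt (suc i) (t ∷ τ) (s≤s p) = cong suc (indexOf-insertAt i τ p)

at-removeAt : ∀ l i p τ → i ≤ length τ → i < length l →
  at l (indexOf (suc p) (insertAt i 0 (map suc τ))) ≡ at (removeAt l i) (indexOf p τ)
at-removeAt (y ∷ l) zero p τ _ _ rewrite indexOf-map-suc p τ = refl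
at-removeAt (y ∷ l) (suc i) p (t ∷ τ) (s≤s q) (s≤s r) with t ≡ᵇ p
... | true  = refl
... | false = at-removeAt l i p τ q r

-- The monomial produced by K_σ up to sign: variable p receives the letter whose position σ sends to
-- p.
layout : Dense → ℕ → List ℕ → Dense
layout l N σ = applyUpTo (λ p → at l (indexOf p σ)) N

applyUpTo-cong : ∀ {A : Set} {f g : ℕ → A} n → (∀ i → f i ≡ g i) → applyUpTo f n ≡ applyUpTo g n
applyUpTo-cong zero    e = refl
applyUpTo-cong (suc n) e = cong₂ _∷_ (e 0) (applyUpTo-cong n (e ∘ suc))

layout-insertAt : ∀ l N i τ → i ≤ length τ → i < length l →
  layout l (suc N) (insertAt i 0 (map suc τ)) ≡ at l i ∷ layout (removeAt l i) N τ
layout-insertAt l N i τ p q = cong₂ _∷_ (cong (at l) (indexOf-insertAt i τ p))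
  (applyUpTo-cong N (λ j → at-removeAt l i j τ p q))

countB-map : ∀ {A B : Set} (p : B → Bool) (f : A → B) xs → countB p (map f xs) ≡ countB (p ∘ f) xs
countB-map p f [] = refl
countB-map p f (x ∷ xs) = cong (λ k → b2n (p (f x)) + k) (countB-map p f xs)

invs-map-suc : ∀ ρ → invs (map suc ρ) ≡ invs ρ
invs-map-suc [] = refl
invs-map-suc (x ∷ ρ) = cong₂ _+_ (countB-map (λ y → y <ᵇ suc x) suc ρ) (invs-map-suc ρ)

countB-insertAt : ∀ t i ρ → i ≤ length ρ → countB (λ y → y <ᵇ suc t) (insertAt i 0 (map suc ρ)) ≡ suc (countB (λ y → y <ᵇ t) ρ)
countB-insertAt t zero ρ _ = cong suc (countB-map (λ y → y <ᵇ suc t) suc ρ)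
countB-insertAt t (suc i) (r ∷ ρ) (s≤s p) =
  trans (cong (λ k → b2n (r <ᵇ t) + k) (countB-insertAt t i ρ p)) (+-suc (b2n (r <ᵇ t)) _)

invs-insertAt : ∀ i ρ → i ≤ length ρ → invs (insertAt i 0 (map suc ρ)) ≡ i + invs ρ
invs-insertAt zero ρ _ = cong₂ _+_ (none ρ) (invs-map-suc ρ)
  where
  none : ∀ ρ → countB (λ y → y <ᵇ 0) (map suc ρ) ≡ 0
  none [] = refl
  none (_ ∷ ρ) = none ρ
invs-insertAt (suc i) (t ∷ ρ) (s≤s p) rewrite countB-insertAt t i ρ p | invs-insertAt i ρ p =
  lem (countB (λ y → y <ᵇ t) ρ) i (invs ρ)
  where
  lem : ∀ a b c → suc (a + (b + c)) ≡ suc (b + (a + c))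
  lem = ℕR.solve-∀

take-insertAt-< : ∀ m i τ → i ≤ m → take (suc m) (insertAt i 0 (map suc τ)) ≡ insertAt i 0 (map suc (take m τ))
take-insertAt-< m zero τ _ = cong (0 ∷_) (LP.take-map m τ)
take-insertAt-< (suc m) (suc i) [] (s≤s p) = refl
take-insertAt-< (suc m) (suc i) (t ∷ τ) (s≤s p) = cong (suc t ∷_) (take-insertAt-< m i τ p)

take-insertAt-≥ : ∀ m i τ → m ≤ i → i ≤ length τ → take m (insertAt i 0 (map suc τ)) ≡ map suc (take m τ)
take-insertAt-≥ zero i τ _ _ = refl
take-insertAt-≥ (suc m) (suc i) (t ∷ τ) (s≤s p) (s≤s q) = cong (suc t ∷_) (take-insertAt-≥ m i τ p q)

θcount : Dense → ℕ
θcount []      = 0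
θcount (x ∷ l) = b2n (proj₂ x) + θcount l

unmarked-tail : ∀ {v l} → All (Precedes (v , false)) l → All (λ y → proj₂ y ≡ false) l
unmarked-tail [] = []
unmarked-tail {l = (_ , false) ∷ l} (_ ∷ a) = refl ∷ unmarked-tail a

unmarked-θcount : ∀ {l} → All (λ y → proj₂ y ≡ false) l → θcount l ≡ 0
unmarked-θcount [] = refl
unmarked-θcount (refl ∷ a) = unmarked-θcount a

unmarked-at : ∀ {l} → All (λ y → proj₂ y ≡ false) l → ∀ i → proj₂ (at l i) ≡ false
unmarked-at []      i       = refl
unmarked-at (e ∷ a) zero    = e
unmarked-at (e ∷ a) (suc i) = unmarked-at a i

θcount-marked : ∀ {l} i → Sorted l → proj₂ (at l i) ≡ true → i < θcount l × suc (θcount (removeAt l i)) ≡ θcount l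
θcount-marked {(v , true) ∷ l} zero s e = s≤s z≤n , refl
θcount-marked {(v , true) ∷ l} (suc i) (a ∷ s) e = let (p , q) = θcount-marked i s e in s≤s p , cong suc q
θcount-marked {(v , false) ∷ l} (suc i) (a ∷ s) e = case trans (sym e) (unmarked-at (unmarked-tail a) i) of λ ()

θcount-unmarked : ∀ {l} i → Sorted l → proj₂ (at l i) ≡ false → θcount l ≤ i × θcount (removeAt l i) ≡ θcount l
θcount-unmarked {[]} i s e = z≤n , refl
θcount-unmarked {(v , false) ∷ l} zero (a ∷ s) e = ≤-reflexive (unmarked-θcount (unmarked-tail a)) , refl
θcount-unmarked {(v , true) ∷ l} (suc i) (a ∷ s) e = let (p , q) = θcount-unmarked i s e in s≤s p , cong suc q
θcount-unmarked {(v , false) ∷ l} (suc i) (a ∷ s) e = let (p , q) = θcount-unmarked i s e in ℕP.m≤n⇒m≤1+n p , q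

permTerm : Dense → ℕ → Dense → List ℕ → ℤ
permTerm l N D σ = if does (layout l N σ ≟D D) then sgn (invs (take (θcount l) σ)) else + 0

-- The θ-letters form a prefix of the sorted list. If letter i carries θ, the value 0 lies among the
-- entries that determine the sign and is inverted with the i entries before it; otherwise it lies
-- beyond them and leaves their inversions alone.
permSign-insertAt : ∀ l i τ x → Sorted l → length l ≡ suc (length τ) → i ≤ length τ → at l i ≡ x →
  sgn (invs (take (θcount l) (insertAt i 0 (map suc τ)))) ≡ passSign x i *ℤ sgn (invs (take (θcount (removeAt l i)) τ))
permSign-insertAt l i τ (v , true) s len p e with θcount-marked i s (cong proj₂ e)
... | q , r = begin
  sgn (invs (take (θcount l) (insertAt i 0 (map suc τ))))
    ≡⟨ cong (λ k → sgn (invs (take k (insertAt i 0 (map suc τ))))) r ⟨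
  sgn (invs (take (suc m) (insertAt i 0 (map suc τ))))
    ≡⟨ cong (sgn ∘ invs) (take-insertAt-< m i τ i≤m) ⟩
  sgn (invs (insertAt i 0 (map suc (take m τ))))
    ≡⟨ cong sgn (invs-insertAt i (take m τ) (subst (i ≤_) (sym (LP.length-take m τ)) (ℕP.⊓-glb i≤m p))) ⟩
  sgn (i + invs (take m τ))
    ≡⟨ sgn-+ i _ ⟩
  sgn i *ℤ sgn (invs (take m τ)) ∎
  where
  open ≡-Reasoning
  m = θcount (removeAt l i)
  i≤m : i ≤ m
  i≤m = ≤-pred (subst (i <_) (sym r) q)
permSign-insertAt l i τ (v , false) s len p e with θcount-unmarked i s (cong proj₂ e)
... | q , r = trans (cong (sgn ∘ invs) (take-insertAt-≥ (θcount l) i τ q p))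
  (trans (cong sgn (invs-map-suc (take (θcount l) τ)))
    (trans (cong (λ k → sgn (invs (take k τ))) (sym r)) (sym (ℤP.*-identityˡ _))))

if-∷ : ∀ {y x : Letter} {L D : Dense} (d₁ : Dec (y ≡ x)) (d₂ : Dec (L ≡ D)) (d₃ : Dec (y ∷ L ≡ x ∷ D)) {s c s′ : ℤ} →
       (y ≡ x → s ≡ c *ℤ s′) →
       (if does d₃ then s else + 0) ≡ (if does d₁ then c *ℤ (if does d₂ then s′ else + 0) else + 0)
if-∷ (yes _) (yes _) (yes e) h = h (LP.∷-injectiveˡ e)
if-∷ (yes p) (yes q) (no n)  h = ⊥-elim (n (cong₂ _∷_ p q))
if-∷ (yes _) (no n)  (yes e) h = ⊥-elim (n (LP.∷-injectiveʳ e))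
if-∷ (yes _) (no _)  (no _) {c = c} h = sym (ℤP.*-zeroʳ c)
if-∷ (no n)  _       (yes e) h = ⊥-elim (n (LP.∷-injectiveˡ e))
if-∷ (no _)  _       (no _)  h = refl

permTerm-insertAt : ∀ l i τ x D → Sorted l → length l ≡ suc (length τ) → i ≤ length τ →
  permTerm l (suc (length τ)) (x ∷ D) (insertAt i 0 (map suc τ)) ≡ pickAt x l (λ l′ → permTerm l′ (length τ) D τ) i
permTerm-insertAt l i τ x D s len p = trans
  (cong (λ L → if does (L ≟D (x ∷ D)) then sgn (invs (take (θcount l) (insertAt i 0 (map suc τ)))) else + 0)
    (layout-insertAt l (length τ) i τ p (subst (i <_) (sym len) (s≤s p))))
  (if-∷ (at l i ≟L x) (layout (removeAt l i) (length τ) τ ≟D D) (_ ≟D _)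
    {c = passSign x i} {s′ = sgn (invs (take (θcount (removeAt l i)) τ))} (permSign-insertAt l i τ x s len p))

permSum : Dense → Coeffs
permSum l D = ∑ (perms (upTo (length l))) (permTerm l (length l) D)

insertAll-length : ∀ x τ {σ} → σ ∈ insertAll x τ → length σ ≡ suc (length τ)
insertAll-length x [] (here refl) = refl
insertAll-length x (y ∷ τ) (here refl) = refl
insertAll-length x (y ∷ τ) (there p) with MP.∈-map⁻ (y ∷_) p
... | σ , q , refl = cong suc (insertAll-length x τ q)

perms-length : ∀ xs {σ} → σ ∈ perms xs → length σ ≡ length xs
perms-length [] (here refl) = refl
perms-length (x ∷ xs) p with find (MP.∈-concatMap⁻ (insertAll x) {xs = perms xs} p)
... | τ , τ∈ , q = trans (insertAll-length x τ q) (cong suc (perms-length xs τ∈))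

-- The permutations are grouped by the position of 0 in their one-line notation.
permSum-∷ : ∀ l x D N → Sorted l → length l ≡ suc N →
  permSum l (x ∷ D) ≡ pick x l (λ l′ → ∑ (perms (upTo N)) (permTerm l′ N D))
permSum-∷ l x D N s len rewrite len = begin
  ∑ (concatMap (insertAll 0) (perms (applyUpTo suc N))) H
    ≡⟨ ∑-concatMap (insertAll 0) (perms (applyUpTo suc N)) H ⟩
  ∑ (perms (applyUpTo suc N)) (λ τ → ∑ (insertAll 0 τ) H)
    ≡⟨ cong (λ ps → ∑ ps (λ τ → ∑ (insertAll 0 τ) H))
         (trans (cong perms (sym (LP.map-upTo suc N))) (perms-map suc (upTo N))) ⟩
  ∑ (map (map suc) (perms (upTo N))) (λ τ → ∑ (insertAll 0 τ) H)
    ≡⟨ ∑-map (map suc) (perms (upTo N)) (λ τ → ∑ (insertAll 0 τ) H) ⟩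
  ∑ (perms (upTo N)) (λ τ → ∑ (insertAll 0 (map suc τ)) H)
    ≡⟨ ∑-cong∈ (perms (upTo N)) (λ {τ} τ∈ → inner τ (trans (perms-length (upTo N) τ∈) (LP.length-upTo N))) ⟩
  ∑ (perms (upTo N)) (λ τ → pick x l (λ l′ → permTerm l′ N D τ))
    ≡⟨ ∑-pick (perms (upTo N)) x l (λ τ l′ → permTerm l′ N D τ) ⟩
  pick x l (λ l′ → ∑ (perms (upTo N)) (permTerm l′ N D)) ∎
  where
  open ≡-Reasoning
  H : List ℕ → ℤ
  H = permTerm l (suc N) (x ∷ D)
  inner : ∀ τ → length τ ≡ N → ∑ (insertAll 0 (map suc τ)) H ≡ pick x l (λ l′ → permTerm l′ N D τ)
  inner τ refl = begin
    ∑ (insertAll 0 (map suc τ)) H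
      ≡⟨ cong (λ σs → ∑ σs H) (insertAll-insertAt 0 (map suc τ)) ⟩
    ∑ (applyUpTo (λ i → insertAt i 0 (map suc τ)) (suc (length (map suc τ)))) H
      ≡⟨ cong sumℤ (LP.map-applyUpTo (λ i → insertAt i 0 (map suc τ)) H (suc (length (map suc τ)))) ⟩
    ∑< (suc (length (map suc τ))) (λ i → H (insertAt i 0 (map suc τ)))
      ≡⟨ cong (λ k → ∑< (suc k) (λ i → H (insertAt i 0 (map suc τ)))) (LP.length-map suc τ) ⟩
    ∑< (suc (length τ)) (λ i → H (insertAt i 0 (map suc τ)))
      ≡⟨ ∑<-cong (suc (length τ)) (λ { i (s≤s p) → permTerm-insertAt l i τ x D s len p }) ⟩
    ∑< (suc (length τ)) (pickAt x l (λ l′ → permTerm l′ (length τ) D τ))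
      ≡⟨ cong (λ k → ∑< k (pickAt x l (λ l′ → permTerm l′ (length τ) D τ))) len ⟨
    ∑< (length l) (pickAt x l (λ l′ → permTerm l′ (length τ) D τ))
      ≡⟨ pick-∑< x l (λ l′ → permTerm l′ (length τ) D τ) ⟨
    pick x l (λ l′ → permTerm l′ (length τ) D τ) ∎

product-single-ratio : ∀ K v (h k : ℕ → ℕ) c → v < K → (∀ w → w ≢ v → h w ≡ k w) → h v ≡ c * k v →
  product (applyUpTo h K) ≡ c * product (applyUpTo k K)
product-single-ratio (suc K) zero h k c _ e e′ = trans (cong₂ _*_ e′ (cong product (applyUpTo-cong K (λ i → e (suc i) λ ()))))
  (ℕP.*-assoc c (k 0) _)
product-single-ratio (suc K) (suc v) h k c (s≤s p) e e′ = trans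
  (cong₂ _*_ (e 0 λ ()) (product-single-ratio K v (h ∘ suc) (k ∘ suc) c p (λ w n → e (suc w) (n ∘ suc-injective)) e′))
  (lem (k 0) c (product (applyUpTo (k ∘ suc) K)))
  where
  lem : ∀ a b c → a * (b * c) ≡ b * (a * c)
  lem = ℕR.solve-∀

letterCount-delete : ∀ {x l} → x ∈ l → letterCount x l ≡ suc (letterCount x (delete x l))
letterCount-delete {x} {y ∷ l} p with y ≟L x in eq
... | yes refl = refl
letterCount-delete {x} {y ∷ l} (here e) | no n = ⊥-elim (n (sym e))
letterCount-delete {x} {y ∷ l} (there p) | no n rewrite eq = letterCount-delete p

letterCount-delete-≢ : ∀ {x y} l → y ≢ x → letterCount y l ≡ letterCount y (delete x l)
letterCount-delete-≢ [] n = refl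
letterCount-delete-≢ {x} {y} (z ∷ l) n with z ≟L x
... | yes refl rewrite dec-false (x ≟L y) (n ∘ sym) = refl
... | no _ = cong (λ k → b2n (does (z ≟L y)) + k) (letterCount-delete-≢ l n)

letterCount-∉ : ∀ x l → x ∉ l → letterCount x l ≡ 0
letterCount-∉ x l n with letterCount x l ℕ.≟ 0
... | yes e = e
... | no c = ⊥-elim (n (letterCount-∈ x l c))

letterCount-marked : ∀ {v l} → Sorted l → (v , true) ∈ l → letterCount (v , true) l ≡ 1
letterCount-marked {v} {y ∷ l} (a ∷ s) p with y ≟L (v , true)
... | yes refl = cong suc (letterCount-∉ (v , true) l (λ q → ℕP.<-irrefl refl (All.lookup a q)))
letterCount-marked {v} {y ∷ l} (a ∷ s) (here e) | no n = ⊥-elim (n (sym e))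
letterCount-marked {v} {y ∷ l} (a ∷ s) (there p) | no n = letterCount-marked s p

multFact : ℕ → Dense → ℕ
multFact K l = product (applyUpTo (λ v → letterCount (v , false) l !) K)

multFact-delete : ∀ K {x l} → Sorted l → x ∈ l → (proj₂ x ≡ false → proj₁ x < K) →
  multFact K l ≡ letterCount x l * multFact K (delete x l)
multFact-delete K {v , false} {l} s p b = product-single-ratio K v _ _ (letterCount (v , false) l) (b refl)
  (λ w n → cong _! (letterCount-delete-≢ l (n ∘ cong proj₁)))
  (subst (λ k → k ! ≡ k * letterCount (v , false) (delete (v , false) l) !) (sym (letterCount-delete p)) refl)
multFact-delete K {v , true} {l} s p b rewrite letterCount-marked s p =
  trans (cong product (applyUpTo-cong K (λ w → cong _! (letterCount-delete-≢ {v , true} {w , false} l λ ()))))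
        (sym (ℕP.*-identityˡ _))

indicator : ∀ {P : Set} → Dec P → ℤ → ℤ
indicator d z = if does d then z else + 0

indicator-⇔ : ∀ {P Q : Set} (p : Dec P) (q : Dec Q) {z w} → (P → Q) → (Q → P) → (P → z ≡ w) → indicator p z ≡ indicator q w
indicator-⇔ (yes p) (yes q) f g e = e p
indicator-⇔ (yes p) (no n)  f g e = ⊥-elim (n (f p))
indicator-⇔ (no n)  (yes q) f g e = ⊥-elim (n (g q))
indicator-⇔ (no n)  (no m)  f g e = refl

indicator-no : ∀ {P : Set} (p : Dec P) {z} → ¬ P → indicator p z ≡ + 0
indicator-no (yes p) n = ⊥-elim (n p)
indicator-no (no _)  n = refl

indicator-zero : ∀ {P : Set} (p : Dec P) → indicator p (+ 0) ≡ + 0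
indicator-zero (yes _) = refl
indicator-zero (no _)  = refl

indicator-* : ∀ {P : Set} (p : Dec P) c {z} → c *ℤ indicator p z ≡ indicator p (c *ℤ z)
indicator-* (yes _) c = refl
indicator-* (no _)  c = ℤP.*-zeroʳ c

-- Giving the first variable its letter deletes that letter from `l`. Its multiplicity k appears as
-- a factor, and k! = k (k-1)! rebuilds the product of factorials, while the signs of reinsertion
-- rebuild the sign of sorting. Hence the permutation sum is divisible by n_Λ!.
permSum-sorted : ∀ D l K → length l ≡ length D → Sorted l → All (λ y → proj₂ y ≡ false → proj₁ y < K) l →
  permSum l D ≡ + multFact K l *ℤ indicator (sort D ≟D l) (sortSign D)
permSum-sorted [] [] K _ _ _ = sym (cong (λ k → + k *ℤ + 1) (ones K))
  where
  ones : ∀ K → multFact K [] ≡ 1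
  ones zero    = refl
  ones (suc K) = trans (ℕP.*-identityˡ _) (ones K)
permSum-sorted (x ∷ D) l K len s b = trans (permSum-∷ l x D (length D) s len) (trans (pick-sorted x l G s) step)
  where
  G : Coeffs
  G l′ = ∑ (perms (upTo (length D))) (permTerm l′ (length D) D)
  step : + letterCount x l *ℤ (insertSign x (delete x l) *ℤ G (delete x l)) ≡
         + multFact K l *ℤ indicator (insert x (sort D) ≟D l) (sortSign (x ∷ D))
  step with letterCount x l ℕ.≟ 0
  -- A letter of the monomial missing from `l` also rules out that sorting the monomial gives `l`,
  -- so both sides vanish.
  ... | yes z = trans (cong (λ k → + k *ℤ (insertSign x (delete x l) *ℤ G (delete x l))) z)
    (sym (trans (cong (+ multFact K l *ℤ_) (indicator-no (insert x (sort D) ≟D l)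
            (λ e → ∈-letterCount (subst (x ∈_) e (∈-insert x (sort D))) z)))
         (ℤP.*-zeroʳ (+ multFact K l))))
  ... | no nz = begin
    + c *ℤ (insertSign x l′ *ℤ G l′)
      ≡⟨ cong (λ w → + c *ℤ (insertSign x l′ *ℤ w)) (trans (cong (λ n → ∑ (perms (upTo n)) (permTerm l′ n D)) (sym len′))
            (permSum-sorted D l′ K len′ (delete-sorted x s) (delete-all x b))) ⟩
    + c *ℤ (insertSign x l′ *ℤ (+ multFact K l′ *ℤ indicator (sort D ≟D l′) (sortSign D)))
      ≡⟨ lem (+ c) (insertSign x l′) (+ multFact K l′) (indicator (sort D ≟D l′) (sortSign D)) ⟩
    (+ c *ℤ + multFact K l′) *ℤ (insertSign x l′ *ℤ indicator (sort D ≟D l′) (sortSign D))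
      ≡⟨ cong₂ _*ℤ_ (trans (sym (ℤP.pos-* c (multFact K l′))) (cong +_ (sym (multFact-delete K s x∈ (All.lookup b x∈)))))
           (trans (indicator-* (sort D ≟D l′) (insertSign x l′))
             (indicator-⇔ (sort D ≟D l′) (insert x (sort D) ≟D l)
               (λ e → trans (cong (insert x) e) (insert-delete s x∈))
               (λ e → trans (sym (delete-insert x (sort D))) (cong (delete x) e))
               (λ e → cong (λ q → insertSign x q *ℤ sortSign D) (sym e)))) ⟩
    + multFact K l *ℤ indicator (insert x (sort D) ≟D l) (sortSign (x ∷ D)) ∎
    where
    open ≡-Reasoning
    c = letterCount x l
    l′ = delete x l
    x∈ = letterCount-∈ x l nz
    len′ : length l′ ≡ length D
    len′ = suc-injective (trans (length-delete x∈) len)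
    lem : ∀ a b c d → a *ℤ (b *ℤ (c *ℤ d)) ≡ (a *ℤ c) *ℤ (b *ℤ d)
    lem = ℤR.solve-∀

-- Superpartitions as sorted monomials

thetas : Dense → List ℕ
thetas []                = []
thetas ((v , true)  ∷ d) = v ∷ thetas d
thetas ((v , false) ∷ d) = thetas d

parts : Dense → List ℕ
parts []                    = []
parts ((v , true)  ∷ d)     = parts d
parts ((zero , false) ∷ d)  = parts d
parts ((suc v , false) ∷ d) = suc v ∷ parts d

toSP : Dense → SP
toSP d = thetas d , parts d

marked unmarked : List ℕ → Dense
marked   = map (_, true)
unmarked = map (_, false)

canonical : SP → Dense
canonical (a , s) = marked a ++ unmarked s

toSP-canonical : ∀ {a s} k → All (λ v → 0 < v) s → toSP (canonical (a , s) ++ replicate k blank) ≡ (a , s)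
toSP-canonical {a} {s} k pos = cong₂ _,_ (th a) (pa a)
  where
  th0 : ∀ k → thetas (replicate k blank) ≡ []
  th0 zero = refl
  th0 (suc k) = th0 k
  ths : ∀ s → thetas (unmarked s ++ replicate k blank) ≡ []
  ths [] = th0 k
  ths (x ∷ s) = ths s
  th : ∀ a → thetas ((marked a ++ unmarked s) ++ replicate k blank) ≡ a
  th [] = ths s
  th (x ∷ a) = cong (x ∷_) (th a)
  pa0 : ∀ k → parts (replicate k blank) ≡ []
  pa0 zero = refl
  pa0 (suc k) = pa0 k
  pas : ∀ {s} → All (λ v → 0 < v) s → parts (unmarked s ++ replicate k blank) ≡ s
  pas [] = pa0 k
  pas {suc x ∷ s} (p ∷ ps) = cong (suc x ∷_) (pas ps)
  pa : ∀ a → parts ((marked a ++ unmarked s) ++ replicate k blank) ≡ s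
  pa [] = pas pos
  pa (x ∷ a) = pa a

precedes-blank : ∀ x → Precedes x blank
precedes-blank (_ , true) = _
precedes-blank (_ , false) = z≤n

sorted-++ : ∀ {l l′} → Sorted l → Sorted l′ → All (λ x → All (Precedes x) l′) l → Sorted (l ++ l′)
sorted-++ = APP.++⁺

sorted-blanks : ∀ k → Sorted (replicate k blank)
sorted-blanks zero    = []
sorted-blanks (suc k) = AllP.replicate⁺ k z≤n ∷ sorted-blanks k

>-allPairs : ∀ {a} → Linked _>_ a → AllPairs _>_ a
>-allPairs = LinkedP.Linked⇒AllPairs (λ p q → ℕP.<-trans q p)

≥-allPairs : ∀ {a} → Linked _≥_ a → AllPairs _≥_ a
≥-allPairs = LinkedP.Linked⇒AllPairs (λ p q → ≤-trans q p)

canonical-sorted : ∀ {n m Λ} k → IsSPar n m Λ → Sorted (canonical Λ ++ replicate k blank)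
canonical-sorted {Λ = a , s} k isp = sorted-++
  (sorted-++ (APP.map⁺ (>-allPairs (IsSPar.antiStrict isp))) (APP.map⁺ (≥-allPairs (IsSPar.symWeak isp)))
    (AllP.map⁺ (All.universal (λ _ → AllP.map⁺ (All.universal (λ _ → _) s)) a)))
  (sorted-blanks k)
  (All.universal (λ x → AllP.replicate⁺ k (precedes-blank x)) _)

-- A sorted list is determined by its superpartition up to the number of trailing blanks; this
-- number is later fixed by the length.
sorted-canonical : ∀ {l} → Sorted l → ∃ λ k → l ≡ canonical (toSP l) ++ replicate k blank
sorted-canonical [] = 0 , refl
sorted-canonical {(v , true) ∷ l} (_ ∷ s) = let (k , e) = sorted-canonical s in k , cong ((v , true) ∷_) e
sorted-canonical {(zero , false) ∷ l} (a ∷ _) = suc (length l) ,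
  trans (cong (blank ∷_) (blanks l a)) (cong (λ S → canonical S ++ replicate (suc (length l)) blank) (sym (empty l a)))
  where
  blanks : ∀ l → All (Precedes blank) l → l ≡ replicate (length l) blank
  blanks [] [] = refl
  blanks ((zero , false) ∷ l) (p ∷ a) = cong (blank ∷_) (blanks l a)
  blanks ((suc _ , false) ∷ l) (() ∷ a)
  blanks ((_ , true) ∷ l) (() ∷ a)
  empty : ∀ l → All (Precedes blank) l → toSP l ≡ ([] , [])
  empty [] [] = refl
  empty ((zero , false) ∷ l) (p ∷ a) = empty l a
  empty ((suc _ , false) ∷ l) (() ∷ a)
  empty ((_ , true) ∷ l) (() ∷ a)
sorted-canonical {(suc v , false) ∷ l} (a ∷ s) with sorted-canonical s
... | k , e = k , trans (cong ((suc v , false) ∷_) (trans e (cong (λ t → canonical (t , parts l) ++ replicate k blank) noθ)))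
                        (cong (λ t → canonical (t , suc v ∷ parts l) ++ replicate k blank) (sym noθ))
  where
  none : ∀ l → All (Precedes (suc v , false)) l → thetas l ≡ []
  none [] [] = refl
  none ((_ , false) ∷ l) (_ ∷ a) = none l a
  none ((_ , true) ∷ l) (() ∷ a)
  noθ = none l a

-- The closed form of the coefficients of m_Ω: only monomials that sort to Ω occur, each with the
-- sign of its sorting. That sign is zero if a letter with θ is repeated.
monoCoeff : SP → Coeffs
monoCoeff Ω d = indicator (toSP (sort d) ≟SP Ω) (sortSign d)

canonical-sort⇔ : ∀ {n m Ω} k D → IsSPar n m Ω → length (canonical Ω ++ replicate k blank) ≡ length D →
  indicator (sort D ≟D (canonical Ω ++ replicate k blank)) (sortSign D) ≡ monoCoeff Ω D
canonical-sort⇔ {Ω = a , s} k D isp len with sortSign D ℤ.≟ + 0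
... | yes z rewrite z = trans (indicator-zero (sort D ≟D _)) (sym (indicator-zero (toSP (sort D) ≟SP _)))
... | no nz = indicator-⇔ (sort D ≟D _) (toSP (sort D) ≟SP _)
   (λ e → trans (cong toSP e) (toSP-canonical k (IsSPar.symPos isp))) back (λ _ → refl)
  where
  length-insert : ∀ x l → length (insert x l) ≡ suc (length l)
  length-insert x [] = refl
  length-insert x (y ∷ l) with before x y
  ... | true = refl
  ... | false = cong suc (length-insert x l)
  length-sort : ∀ D → length (sort D) ≡ length D
  length-sort [] = refl
  length-sort (x ∷ D) = trans (length-insert x (sort D)) (cong suc (length-sort D))
  back : toSP (sort D) ≡ (a , s) → sort D ≡ canonical (a , s) ++ replicate k blank
  back e with sorted-canonical (sort-sorted D nz)
  ... | k′ , e′ = trans e″ (cong (λ j → canonical (a , s) ++ replicate j blank) k′≡k)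
    where
    e″ : sort D ≡ canonical (a , s) ++ replicate k′ blank
    e″ = trans e′ (cong (λ S → canonical S ++ replicate k′ blank) e)
    len-++ : ∀ j → length (canonical (a , s) ++ replicate j blank) ≡ length (canonical (a , s)) + j
    len-++ j = trans (LP.length-++ (canonical (a , s))) (cong (λ i → length (canonical (a , s)) + i) (LP.length-replicate j))
    k′≡k : k′ ≡ k
    k′≡k = ℕP.+-cancelˡ-≡ (length (canonical (a , s))) _ _
      (trans (sym (len-++ k′)) (trans (cong length (sym e″)) (trans (length-sort D) (trans (sym len) (len-++ k)))))

insert-stable : ∀ x l → insert x (l ++ blank ∷ []) ≡ insert x l ++ blank ∷ [] × insertSign x (l ++ blank ∷ []) ≡ insertSign x l
insert-stable x [] rewrite precedes⇒before x blank (precedes-blank x) = refl , sgn-eq x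
  where
  sgn-eq : ∀ x → (if repeated x blank then + 0 else + 1) ≡ + 1
  sgn-eq (_ , true) = refl
  sgn-eq (_ , false) = refl
insert-stable x (y ∷ l) with before x y
... | true  = refl , refl
... | false = let (p , q) = insert-stable x l in cong (y ∷_) p , cong (swapSign x y *ℤ_) q

sort-stable : ∀ d → sort (d ++ blank ∷ []) ≡ sort d ++ blank ∷ [] × sortSign (d ++ blank ∷ []) ≡ sortSign d
sort-stable [] = refl , refl
sort-stable (x ∷ d) with sort-stable d
... | p , q with insert-stable x (sort d)
...   | p′ , q′ = trans (cong (insert x) p) p′ , cong₂ _*ℤ_ (trans (cong (insertSign x) p) q′) q

toSP-stable : ∀ l → toSP (l ++ blank ∷ []) ≡ toSP l
toSP-stable [] = refl
toSP-stable ((v , true) ∷ l) = cong (λ S → v ∷ proj₁ S , proj₂ S) (toSP-stable l)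
toSP-stable ((zero , false) ∷ l) = toSP-stable l
toSP-stable ((suc v , false) ∷ l) = cong (λ S → proj₁ S , suc v ∷ proj₂ S) (toSP-stable l)

monoCoeff-stable : ∀ Ω → Stable (monoCoeff Ω)
monoCoeff-stable Ω d = cong₂ (λ S → indicator (S ≟SP Ω))
  (trans (cong toSP (proj₁ (sort-stable d))) (toSP-stable (sort d))) (proj₂ (sort-stable d))

-- Integer division takes the floor, so the quotient q of p z satisfies q p ≤ p z < (q+1) p;
-- cancelling p leaves q = z.
divZ-* : ∀ p z → p ≢ 0 → divZ (+ p *ℤ z) p ≡ z
divZ-* zero z n = ⊥-elim (n refl)
divZ-* (suc k) z _ = ℤP.≤-antisym q≤z z≤q
  where
  import Data.Integer.DivMod as ℤD
  q = (+ suc k *ℤ z) /ℕ suc k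
  q≤z : q ℤ.≤ z
  q≤z = ℤP.*-cancelʳ-≤-pos q z (+ suc k) (ℤP.≤-trans (ℤD.[n/ℕd]*d≤n (+ suc k *ℤ z) (suc k))
          (ℤP.≤-reflexive (ℤP.*-comm (+ suc k) z)))
  z≤q : z ℤ.≤ q
  z≤q = subst (z ℤ.≤_) (ℤP.pred-suc q) (ℤP.i<j⇒i≤pred[j] (ℤP.*-cancelʳ-<-nonNeg {z} {ℤ.suc q} (+ suc k)
          (ℤP.≤-<-trans (ℤP.≤-reflexive (ℤP.*-comm z (+ suc k))) (ℤD.n<s[n/ℕd]*d (+ suc k *ℤ z) (suc k)))))

at-marked-unmarked : ∀ a s i → at (marked a ++ unmarked s) i ≡ (nthD (a ++ s) i , (i <ᵇ length a))
at-marked-unmarked [] [] i = refl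
at-marked-unmarked [] (x ∷ s) zero = refl
at-marked-unmarked [] (x ∷ s) (suc i) = at-marked-unmarked [] s i
at-marked-unmarked (x ∷ a) s zero = refl
at-marked-unmarked (x ∷ a) s (suc i) = at-marked-unmarked a s i

θcount-marked-unmarked : ∀ a s → θcount (marked a ++ unmarked s) ≡ length a
θcount-marked-unmarked [] [] = refl
θcount-marked-unmarked [] (x ∷ s) = θcount-marked-unmarked [] s
θcount-marked-unmarked (x ∷ a) s = cong suc (θcount-marked-unmarked a s)

letter≟ : ∀ w v → does ((w , false) ≟L (v , false)) ≡ (w ≡ᵇ v)
letter≟ w v with (w , false) ≟L (v , false)
... | yes refl = sym (Equivalence.to 𝔹.T-≡ (ℕP.≡⇒≡ᵇ w w refl))
... | no n with w ≡ᵇ v in e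
...   | false = refl
...   | true = ⊥-elim (n (cong (_, false) (ℕP.≡ᵇ⇒≡ w v (subst T (sym e) _))))

letterCount-marked-unmarked : ∀ v a s → letterCount (v , false) (marked a ++ unmarked s) ≡ countB (λ y → y ≡ᵇ v) s
letterCount-marked-unmarked v [] [] = refl
letterCount-marked-unmarked v [] (x ∷ s) = cong₂ (λ b k → b2n b + k) (letter≟ x v) (letterCount-marked-unmarked v [] s)
letterCount-marked-unmarked v (x ∷ a) s rewrite dec-false ((x , true) ≟L (v , false)) (λ ()) = letterCount-marked-unmarked v a s

≃-pad : ∀ d k → d ++ replicate k blank ≃ d
≃-pad [] k i = at-blanks k i
≃-pad (x ∷ d) k zero = refl
≃-pad (x ∷ d) k (suc i) = ≃-pad d k i

≃-length : ∀ d d′ → d ≃ d′ → length d ≡ length d′ → d ≡ d′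
≃-length [] [] e _ = refl
≃-length (x ∷ d) (y ∷ d′) e len = cong₂ _∷_ (e 0) (≃-length d d′ (e ∘ suc) (suc-injective len))

drop-length-++ : ∀ (xs ys : List ℕ) → drop (length xs) (xs ++ ys) ≡ ys
drop-length-++ []       ys = refl
drop-length-++ (x ∷ xs) ys = drop-length-++ xs ys

≤-sum : ∀ xs → All (λ x → x ≤ sum xs) xs
≤-sum [] = []
≤-sum (x ∷ xs) = m≤m+n x _ ∷ All.map (λ p → ≤-trans p (m≤n+m _ x)) (≤-sum xs)

-- Both the monomial and Ω are padded with blanks to the number N of variables used in the
-- definition. There the permutation sum is evaluated and the factorials cancel; stability then
-- removes the padding.
monoSF-coeff : ∀ {n m Ω} → IsSPar n m Ω → ∀ μ → monoSF Ω μ ≡ monoCoeff Ω (toDense μ)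
monoSF-coeff {n} {m} {Ω@(a , s)} isp μ = begin
  divZ (∑ (perms (upTo N)) (λ σ → termCoeff N Ω σ μ)) (nfact N Ω)
    ≡⟨ cong (λ z → divZ z (nfact N Ω)) (∑-cong (perms (upTo N)) term) ⟩
  divZ (∑ (perms (upTo N)) (permTerm l N D)) (nfact N Ω)
    ≡⟨ cong₂ divZ (trans (cong (λ k → ∑ (perms (upTo k)) (permTerm l k D)) (sym len-l)) permSum-l) nfact-l ⟩
  divZ (+ multFact K l *ℤ indicator (sort D ≟D l) (sortSign D)) (multFact K l)
    ≡⟨ divZ-* (multFact K l) _ (ℕ.≢-nonZero⁻¹ _ {{multFact-nonZero}}) ⟩
  indicator (sort D ≟D l) (sortSign D)
    ≡⟨ cong (λ l′ → indicator (sort D ≟D l′) (sortSign D)) l≡ ⟩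
  indicator (sort D ≟D (canonical Ω ++ replicate k blank)) (sortSign D)
    ≡⟨ canonical-sort⇔ k D isp (trans (cong length (sym l≡)) (trans len-l (sym len-D))) ⟩
  monoCoeff Ω D
    ≡⟨ stable-≃ (monoCoeff-stable Ω) D (toDense μ) (≃-pad (toDense μ) _) ⟩
  monoCoeff Ω (toDense μ) ∎
  where
  open ≡-Reasoning
  N = length (toDense μ) ⊔ ell Ω
  k = N ∸ (length a + length s)
  sp = s ++ replicate k 0
  l = marked a ++ unmarked sp
  D = toDense μ ++ replicate (N ∸ length (toDense μ)) blank
  -- The range of the product in `nfact`; it exceeds every entry of Λ^s.
  K = suc (sum sp)
  l≡ : l ≡ canonical Ω ++ replicate k blank
  l≡ = trans (cong (marked a ++_) (trans (LP.map-++ (_, false) s (replicate k 0)) (cong (unmarked s ++_) (LP.map-replicate (_, false) k 0))))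
             (sym (LP.++-assoc (marked a) (unmarked s) _))
  len-D : length D ≡ N
  len-D = trans (LP.length-++ (toDense μ)) (trans (cong (λ j → length (toDense μ) + j) (LP.length-replicate _))
            (ℕP.m+[n∸m]≡n (ℕP.m≤m⊔n (length (toDense μ)) (ell Ω))))
  len-full : length (a ++ sp) ≡ N
  len-full = trans (LP.length-++ a) (trans (cong (λ j → length a + j) (trans (LP.length-++ s) (cong (λ j → length s + j) (LP.length-replicate k))))
    (trans (sym (ℕP.+-assoc (length a) (length s) k)) (ℕP.m+[n∸m]≡n (ℕP.m≤n⊔m (length (toDense μ)) (ell Ω)))))
  len-l : length l ≡ N
  len-l = trans (LP.length-++ (marked a)) (trans (cong₂ _+_ (LP.length-map _ a) (LP.length-map _ sp)) (trans (sym (LP.length-++ a)) len-full))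
  s-l : Sorted l
  s-l = subst Sorted (sym l≡) (canonical-sorted k isp)
  small : All (λ y → proj₂ y ≡ false → proj₁ y < K) l
  small = AllP.++⁺ (AllP.map⁺ (All.universal (λ _ ()) a)) (AllP.map⁺ (All.map (λ p _ → s≤s p) (≤-sum sp)))
  permSum-l : permSum l D ≡ + multFact K l *ℤ indicator (sort D ≟D l) (sortSign D)
  permSum-l = permSum-sorted D l K (trans len-l (sym len-D)) s-l small
  nfact-l : nfact N Ω ≡ multFact K l
  nfact-l = trans (cong (λ xs → product (map (λ v → countB (λ y → y ≡ᵇ v) xs !) (upTo (suc (sum xs))))) (drop-length-++ a sp))
    (cong product (trans (LP.map-upTo (λ v → countB (λ y → y ≡ᵇ v) sp !) K) (applyUpTo-cong K (λ v → cong _! (sym (letterCount-marked-unmarked v a sp))))))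
  multFact-nonZero : ℕ.NonZero (multFact K l)
  multFact-nonZero = LAP.product≢0 (AllP.applyUpTo⁺₂ _ K (λ v → ℕP._!≢0 (letterCount (v , false) l)))
  term : ∀ σ → termCoeff N Ω σ μ ≡ permTerm l N D σ
  term σ = trans (cong (λ d → indicator (toMono d ≟M μ) (sgn (invs (take (length a) σ)))) dense-eq)
    (indicator-⇔ (toMono (layout l N σ) ≟M μ) (layout l N σ ≟D D)
      (λ e → ≃-length (layout l N σ) D (λ i → trans (sym (toDense-toMono (layout l N σ) i))
           (trans (cong (λ ν → at (toDense ν) i) e) (sym (≃-pad (toDense μ) _ i))))
         (trans (LP.length-applyUpTo _ N) (sym len-D)))
      (λ e → trans (cong toMono e) (trans (stable-≃ (toMonoG-stable 0) D (toDense μ) (≃-pad (toDense μ) _)) (toMono-toDense μ)))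
      (λ _ → cong (λ j → sgn (invs (take j σ))) (sym (θcount-marked-unmarked a sp))))
    where
    dense-eq : map (λ p → nthD (a ++ sp) (indexOf p σ) , (indexOf p σ <ᵇ length a)) (upTo N) ≡ layout l N σ
    dense-eq = trans (LP.map-upTo _ N) (applyUpTo-cong N (λ p → sym (at-marked-unmarked a sp (indexOf p σ))))

-- Expansion in monomial functions

listsUpTo : ℕ → ℕ → List (List ℕ)
listsUpTo zero    b = [] ∷ []
listsUpTo (suc k) b = [] ∷ concatMap (λ x → map (x ∷_) (listsUpTo k b)) (upTo b)

∈-listsUpTo : ∀ k b {l} → length l ≤ k → All (λ x → x < b) l → l ∈ listsUpTo k b
∈-listsUpTo zero    b {[]} p a = here refl
∈-listsUpTo (suc k) b {[]} p a = here refl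
∈-listsUpTo (suc k) b {x ∷ l} (s≤s p) (q ∷ a) =
  there (MP.∈-concatMap⁺ (λ y → map (y ∷_) (listsUpTo k b)) {xs = upTo b} (lose (MP.∈-upTo⁺ q) (MP.∈-map⁺ (x ∷_) (∈-listsUpTo k b p a))))

isSPar? : ∀ n m Λ → Dec (IsSPar n m Λ)
isSPar? n m (a , s)
  with length a ℕ.≟ m | Linked.linked? ℕ._>?_ a | Linked.linked? ℕ._≥?_ s | All.all? (λ k → 0 ℕ.<? k) s | (sum a + sum s) ℕ.≟ n
... | yes p | yes q | yes r | yes t | yes u = yes (record { antiLength = p ; antiStrict = q ; symWeak = r ; symPos = t ; total = u })
... | no c | _ | _ | _ | _ = no (c ∘ IsSPar.antiLength)
... | _ | no c | _ | _ | _ = no (c ∘ IsSPar.antiStrict)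
... | _ | _ | no c | _ | _ = no (c ∘ IsSPar.symWeak)
... | _ | _ | _ | no c | _ = no (c ∘ IsSPar.symPos)
... | _ | _ | _ | _ | no c = no (c ∘ IsSPar.total)

-- A finite search space: entries are at most n, and Λ^s has at most n parts because they are
-- positive. Duplicates are removed so that a sum over this list can be reduced to a single term.
superpartitions : ℕ → ℕ → List SP
superpartitions n m = filter (isSPar? n m) (deduplicate _≟SP_ (cartesianProduct (listsUpTo m (suc n)) (listsUpTo n (suc n))))

superpartitions-unique : ∀ n m → Unique (superpartitions n m)
superpartitions-unique n m = UP.filter⁺ (isSPar? n m)
  (deduplicate-! _≟SP_ (cartesianProduct (listsUpTo m (suc n)) (listsUpTo n (suc n))))
  where open import Data.List.Relation.Unary.Unique.DecPropositional.Properties using (deduplicate-!)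

superpartitions-sound : ∀ {n m Λ} → Λ ∈ superpartitions n m → IsSPar n m Λ
superpartitions-sound {n} {m} p = proj₂ (MP.∈-filter⁻ (isSPar? n m) {xs = deduplicate _≟SP_ (cartesianProduct (listsUpTo m (suc n)) (listsUpTo n (suc n)))} p)

length≤sum : ∀ {xs} → All (λ k → 0 < k) xs → length xs ≤ sum xs
length≤sum [] = z≤n
length≤sum (p ∷ ps) = ℕP.+-mono-≤ p (length≤sum ps)

isSPar-bounded : ∀ {n m a s} → IsSPar n m (a , s) → All (λ x → x ≤ n) a × All (λ x → x ≤ n) s × length s ≤ n
isSPar-bounded {a = a} {s} isp =
  All.map (λ p → ≤-trans p (≤-trans (m≤m+n _ _) t)) (≤-sum a) ,
  All.map (λ p → ≤-trans p (≤-trans (m≤n+m _ _) t)) (≤-sum s) ,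
  ≤-trans (length≤sum (IsSPar.symPos isp)) (≤-trans (m≤n+m _ (sum a)) t)
  where t = ≤-reflexive (IsSPar.total isp)

superpartitions-complete : ∀ {n m Λ} → IsSPar n m Λ → Λ ∈ superpartitions n m
superpartitions-complete {n} {m} {a , s} isp = MP.∈-filter⁺ (isSPar? n m)
  (MP.∈-deduplicate⁺ _≟SP_ (MP.∈-cartesianProduct⁺
    (∈-listsUpTo m (suc n) (≤-reflexive (IsSPar.antiLength isp)) (All.map s≤s (proj₁ (isSPar-bounded isp))))
    (∈-listsUpTo n (suc n) (proj₂ (proj₂ (isSPar-bounded isp))) (All.map s≤s (proj₁ (proj₂ (isSPar-bounded isp)))))))
  isp

weight-false : ∀ x → weight false x ≡ proj₁ x
weight-false (a , t) rewrite 𝔹.∧-zeroʳ t = +-identityʳ a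

weight-true : ∀ x → weight true x ≡ proj₁ x + b2n (proj₂ x)
weight-true (a , t) rewrite 𝔹.∧-identityʳ t = refl

total-true : ∀ l → total true l ≡ total false l + length (thetas l)
total-true [] = refl
total-true ((v , true) ∷ l) rewrite total-true l = lem v (total false l) (length (thetas l))
  where
  lem : ∀ a b c → a + 1 + (b + c) ≡ a + 0 + b + suc c
  lem = ℕR.solve-∀
total-true ((v , false) ∷ l) rewrite total-true l = sym (ℕP.+-assoc (v + 0) _ _)

total-false : ∀ l → sum (thetas l) + sum (parts l) ≡ total false l
total-false [] = refl
total-false ((v , true) ∷ l) rewrite sym (total-false l) = lem v (sum (thetas l)) (sum (parts l))
  where
  lem : ∀ a b c → a + b + c ≡ a + 0 + (b + c)
  lem = ℕR.solve-∀
total-false ((zero , false) ∷ l) = total-false l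
total-false ((suc v , false) ∷ l) rewrite sym (total-false l) = lem v (sum (thetas l)) (sum (parts l))
  where
  lem : ∀ a b c → b + (suc a + c) ≡ suc (a + 0 + (b + c))
  lem = ℕR.solve-∀

thetas-all : ∀ {P : ℕ → Set} {l} → All (λ y → proj₂ y ≡ true → P (proj₁ y)) l → All P (thetas l)
thetas-all [] = []
thetas-all {l = (_ , true) ∷ l} (p ∷ a) = p refl ∷ thetas-all a
thetas-all {l = (_ , false) ∷ l} (p ∷ a) = thetas-all a

parts-all : ∀ {P : ℕ → Set} {l} → All (λ y → proj₂ y ≡ false → P (proj₁ y)) l → All P (parts l)
parts-all [] = []
parts-all {l = (_ , true) ∷ l} (p ∷ a) = parts-all a
parts-all {l = (zero , false) ∷ l} (p ∷ a) = parts-all a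
parts-all {l = (suc _ , false) ∷ l} (p ∷ a) = p refl ∷ parts-all a

parts-positive : ∀ l → All (λ k → 0 < k) (parts l)
parts-positive [] = []
parts-positive ((_ , true) ∷ l) = parts-positive l
parts-positive ((zero , false) ∷ l) = parts-positive l
parts-positive ((suc _ , false) ∷ l) = s≤s z≤n ∷ parts-positive l

module _ {Q : Letter → Letter → Set}
         (anti : ∀ {v w} → Q (v , true) (w , true) → v > w) (weak : ∀ {v w} → Q (v , false) (w , false) → v ≥ w) where

  thetas-pairs : ∀ {l} → AllPairs Q l → AllPairs _>_ (thetas l)
  thetas-pairs [] = []
  thetas-pairs {(_ , true) ∷ l} (a ∷ s) = thetas-all (All.map (λ { {_ , true} q refl → anti q }) a) ∷ thetas-pairs s
  thetas-pairs {(_ , false) ∷ l} (a ∷ s) = thetas-pairs s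

  parts-pairs : ∀ {l} → AllPairs Q l → AllPairs _≥_ (parts l)
  parts-pairs [] = []
  parts-pairs {(_ , true) ∷ l} (a ∷ s) = parts-pairs s
  parts-pairs {(zero , false) ∷ l} (a ∷ s) = parts-pairs s
  parts-pairs {(suc _ , false) ∷ l} (a ∷ s) = parts-all (All.map (λ { {_ , false} q refl → weak q }) a) ∷ parts-pairs s

  -- `Q` will be `Precedes` for sorted monomials and `RowOrder` for diagrams. The two totals differ
  -- by the number of θ's, which yields m.
  toSP-isSPar : ∀ {n m l} → AllPairs Q l → total false l ≡ n → total true l ≡ n + m → IsSPar n m (toSP l)
  toSP-isSPar {n} {m} {l} s e e′ = record
    { antiLength = ℕP.+-cancelˡ-≡ n _ _ (trans (cong (λ k → k + length (thetas l)) (sym e)) (trans (sym (total-true l)) e′))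
    ; antiStrict = LinkedP.AllPairs⇒Linked (thetas-pairs s)
    ; symWeak    = LinkedP.AllPairs⇒Linked (parts-pairs s)
    ; symPos     = parts-positive l
    ; total      = trans (total-false l) e
    }

total-insert : ∀ c x l → total c (insert x l) ≡ weight c x + total c l
total-insert c x [] = refl
total-insert c x (y ∷ l) with before x y
... | true = refl
... | false = trans (cong (λ k → weight c y + k) (total-insert c x l)) (lem (weight c y) (weight c x) (total c l))
  where
  lem : ∀ a b c → a + (b + c) ≡ b + (a + c)
  lem = ℕR.solve-∀

total-sort : ∀ c d → total c (sort d) ≡ total c d
total-sort c [] = refl
total-sort c (x ∷ d) = trans (total-insert c x (sort d)) (cong (λ k → weight c x + k) (total-sort c d))

-- Degree n in the x's and m in the θ's, phrased through the two weights so that the totals of a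
-- product give it directly.
Homogeneous : ℕ → ℕ → Coeffs → Set
Homogeneous n m f = ∀ d → f d ≢ + 0 → total false d ≡ n × total true d ≡ n + m

toSP-sort-isSPar : ∀ {n m} d → sortSign d ≢ + 0 → total false d ≡ n → total true d ≡ n + m → IsSPar n m (toSP (sort d))
toSP-sort-isSPar d nz e e′ = toSP-isSPar {Q = Precedes} id id (sort-sorted d nz)
  (trans (total-sort false d) e) (trans (total-sort true d) e′)

canonical-stable : ∀ {f} → Stable f → ∀ l → Sorted l → f l ≡ f (canonical (toSP l))
canonical-stable {f} st l s with sorted-canonical s
... | k , e = trans (cong f e) (stable-≃ st _ _ (≃-pad (canonical (toSP l)) k))

-- A monomial lies in the support of at most one m_Ω, namely that of its sorted form, and symmetry
-- with stability moves the value of `f` there. If `f` vanishes at the monomial, its sorted form may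
-- have another bidegree and be absent from the list, so this case is treated by itself.
monomial-expansion : ∀ {n m f} → Symmetric f → Stable f → Homogeneous n m f → ∀ d →
  f d ≡ ∑ (superpartitions n m) (λ Ω → f (canonical Ω) *ℤ monoCoeff Ω d)
monomial-expansion {n} {m} {f} sy st ho d with sortSign d ℤ.≟ + 0
... | yes z = trans (symmetric-sort f sy d) (trans (cong (_*ℤ f (sort d)) z)
  (sym (∑-zero (superpartitions n m) (λ {Ω} _ → trans (cong (λ w → f (canonical Ω) *ℤ indicator (toSP (sort d) ≟SP Ω) w) z)
    (trans (cong (f (canonical Ω) *ℤ_) (indicator-zero (toSP (sort d) ≟SP Ω))) (ℤP.*-zeroʳ (f (canonical Ω))))))))
... | no nz = trans (symmetric-sort f sy d) (trans (cong (sortSign d *ℤ_) (canonical-stable {f} st (sort d) (sort-sorted d nz)))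
        (trans (ℤP.*-comm (sortSign d) _) (sym rhs)))
  where
  Ω₀ = toSP (sort d)
  other : ∀ {Ω} → Ω ≢ Ω₀ → f (canonical Ω) *ℤ monoCoeff Ω d ≡ + 0
  other {Ω} n = trans (cong (f (canonical Ω) *ℤ_) (indicator-no (Ω₀ ≟SP Ω) (n ∘ sym))) (ℤP.*-zeroʳ (f (canonical Ω)))
  diag : f (canonical Ω₀) *ℤ monoCoeff Ω₀ d ≡ f (canonical Ω₀) *ℤ sortSign d
  diag = cong (f (canonical Ω₀) *ℤ_) (cong (λ b → if b then sortSign d else + 0) (dec-true (Ω₀ ≟SP Ω₀) refl))
  rhs : ∑ (superpartitions n m) (λ Ω → f (canonical Ω) *ℤ monoCoeff Ω d) ≡ f (canonical Ω₀) *ℤ sortSign d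
  rhs with f d ℤ.≟ + 0
  ... | no fz = trans (∑-single {y = Ω₀} (superpartitions-unique n m)
          (superpartitions-complete (toSP-sort-isSPar d nz (proj₁ (ho d fz)) (proj₂ (ho d fz)))) (λ _ → other)) diag
  ... | yes fz = trans (∑-zero (superpartitions n m) all-zero) (sym at₀)
    where
    at₀ : f (canonical Ω₀) *ℤ sortSign d ≡ + 0
    at₀ = trans (ℤP.*-comm _ (sortSign d)) (trans (cong (sortSign d *ℤ_) (sym (canonical-stable {f} st (sort d) (sort-sorted d nz))))
      (trans (sym (symmetric-sort f sy d)) fz))
    all-zero : ∀ {Ω} → Ω ∈ superpartitions n m → f (canonical Ω) *ℤ monoCoeff Ω d ≡ + 0
    all-zero {Ω} _ with Ω ≟SP Ω₀
    ... | yes refl = trans diag at₀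
    ... | no ne = other ne

if-elim : ∀ {A : Set} (P : A → Set) b {x y} → P x → P y → P (if b then x else y)
if-elim P true  p q = p
if-elim P false p q = q

symmetric-move : ∀ f → Symmetric f → ∀ a v r → f (marked a ++ (v , false) ∷ r) ≡ f ((v , false) ∷ marked a ++ r)
symmetric-move f s [] v r = refl
symmetric-move f s (x ∷ a) v r = trans (symmetric-move (f ∘ ((x , true) ∷_)) (symmetric-∷ f (x , true) s) a v r)
  (trans (s [] (x , true) (v , false) (marked a ++ r)) (ℤP.*-identityˡ _))

-- Merging the circled and uncircled entries into rows only moves letters without θ past letters
-- with θ, which costs no sign. The partial sums that bound coefficients are to be read along the
-- rows.
symmetric-rows : ∀ f → Symmetric f → ∀ Ω → f (canonical Ω) ≡ f (rows Ω)
symmetric-rows f sy (a , s) = go f sy a s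
  where
  go : ∀ f → Symmetric f → ∀ a s → f (marked a ++ unmarked s) ≡ f (rowsC a s)
  go f sy [] s = refl
  go f sy (x ∷ a) [] = cong f (LP.++-identityʳ (marked (x ∷ a)))
  go f sy (x ∷ a) (y ∷ s) = if-elim (λ l → f (marked (x ∷ a) ++ unmarked (y ∷ s)) ≡ f l) (y ≤ᵇ x)
    (go (f ∘ ((x , true) ∷_)) (symmetric-∷ f (x , true) sy) a (y ∷ s))
    (trans (symmetric-move f sy (x ∷ a) y (unmarked s))
      (go (f ∘ ((y , false) ∷_)) (symmetric-∷ f (y , false) sy) (x ∷ a) s))

-- Diagrams and conjugation

-- Rows of a diagram D[Λ]: of two equal rows the lower one is uncircled. This says at once that the
-- circle sits on the topmost row of its length and that circled lengths are distinct.
RowOrder : Letter → Letter → Set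
RowOrder (a , _) (b , u) = b < a ⊎ (b ≡ a × u ≡ false)

rowOrder-trans : ∀ {x y z} → RowOrder x y → RowOrder y z → RowOrder x z
rowOrder-trans (inj₁ p) (inj₁ q) = inj₁ (ℕP.<-trans q p)
rowOrder-trans (inj₁ p) (inj₂ (refl , _)) = inj₁ p
rowOrder-trans (inj₂ (refl , _)) (inj₁ q) = inj₁ q
rowOrder-trans (inj₂ (refl , _)) (inj₂ q) = inj₂ q

rowOrder-≤ : ∀ x y → RowOrder x y → proj₁ y ≤ proj₁ x
rowOrder-≤ _ _ (inj₁ p) = <⇒≤ p
rowOrder-≤ _ _ (inj₂ (refl , _)) = ≤-refl

rowsC-[] : ∀ a → rowsC a [] ≡ marked a
rowsC-[] [] = refl
rowsC-[] (x ∷ a) = refl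

rowsC-↭ : ∀ a s → rowsC a s ↭ marked a ++ unmarked s
rowsC-↭ [] s = ↭-refl
rowsC-↭ (x ∷ a) [] = ↭-reflexive (sym (LP.++-identityʳ (marked (x ∷ a))))
rowsC-↭ (x ∷ a) (y ∷ s) = if-elim (_↭ marked (x ∷ a) ++ unmarked (y ∷ s)) (y ≤ᵇ x)
  (↭-prep (x , true) (rowsC-↭ a (y ∷ s)))
  (↭-trans (↭-prep (y , false) (rowsC-↭ (x ∷ a) s)) (↭-sym (↭P.shift (y , false) (marked (x ∷ a)) (unmarked s))))

rowsC-all : ∀ {P : Letter → Set} {a s} → All (λ x → P (x , true)) a → All (λ x → P (x , false)) s → All P (rowsC a s)
rowsC-all {a = a} {s} p q = ↭P.All-resp-↭ (↭-sym (rowsC-↭ a s)) (AllP.++⁺ (AllP.map⁺ p) (AllP.map⁺ q))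

if-elim′ : ∀ {A : Set} (P : A → Set) b {x y} → (b ≡ true → P x) → (b ≡ false → P y) → P (if b then x else y)
if-elim′ P true  p q = p refl
if-elim′ P false p q = q refl

rowsC-rowOrder : ∀ {a s} → AllPairs _>_ a → AllPairs _≥_ s → AllPairs RowOrder (rowsC a s)
rowsC-rowOrder {[]} p q = APP.map⁺ (AP.map (λ {x} {y} → lem x y) q)
  where
  lem : ∀ x y → x ≥ y → RowOrder (x , false) (y , false)
  lem x y y≤x with ℕP.m≤n⇒m<n∨m≡n y≤x
  ... | inj₁ r = inj₁ r
  ... | inj₂ r = inj₂ (r , refl)
rowsC-rowOrder {x ∷ a} {[]} p q = APP.map⁺ (AP.map inj₁ p)
rowsC-rowOrder {x ∷ a} {y ∷ s} (p ∷ ps) (q ∷ qs) = if-elim′ (AllPairs RowOrder) (y ≤ᵇ x)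
  (λ e → rowsC-all (All.map inj₁ p) (weak y {t = true} (≤ᵇ-true e) ∷ All.map (λ {z} r → weak z {t = true} (≤-trans r (≤ᵇ-true e))) q) ∷ rowsC-rowOrder ps (q ∷ qs))
  (λ e → rowsC-all (inj₁ (≤ᵇ-false e) ∷ All.map (λ r → inj₁ (ℕP.<-trans r (≤ᵇ-false e))) p) (All.map (λ {z} → weak z {t = false}) q) ∷ rowsC-rowOrder (p ∷ ps) qs)
  where
  weak : ∀ y {x t} → y ≤ x → RowOrder (x , t) (y , false)
  weak y y≤x with ℕP.m≤n⇒m<n∨m≡n y≤x
  ... | inj₁ r = inj₁ r
  ... | inj₂ r = inj₂ (r , refl)

rows-rowOrder : ∀ {n m Λ} → IsSPar n m Λ → AllPairs RowOrder (rows Λ)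
rows-rowOrder isp = rowsC-rowOrder (>-allPairs (IsSPar.antiStrict isp)) (≥-allPairs (IsSPar.symWeak isp))

toSP-rowsC : ∀ a {s} → All (λ v → 0 < v) s → toSP (rowsC a s) ≡ (a , s)
toSP-rowsC [] {[]} p = refl
toSP-rowsC [] {suc y ∷ s} (p ∷ ps) = cong (λ S → proj₁ S , suc y ∷ proj₂ S) (toSP-rowsC [] ps)
toSP-rowsC (x ∷ a) {[]} p = cong (λ S → x ∷ proj₁ S , proj₂ S) (trans (cong toSP (sym (rowsC-[] a))) (toSP-rowsC a []))
toSP-rowsC (x ∷ a) {suc y ∷ s} (p ∷ ps) = if-elim (λ l → toSP l ≡ (x ∷ a , suc y ∷ s)) (suc y ≤ᵇ x)
  (cong (λ S → x ∷ proj₁ S , proj₂ S) (toSP-rowsC a (p ∷ ps)))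
  (cong (λ S → proj₁ S , suc y ∷ proj₂ S) (toSP-rowsC (x ∷ a) ps))

toSP-rows : ∀ {n m Λ} → IsSPar n m Λ → toSP (rows Λ) ≡ Λ
toSP-rows {Λ = a , s} isp = toSP-rowsC a (IsSPar.symPos isp)

-- Merging is forced at each step by the row order. Agreement holds up to blanks because uncircled
-- zeros are dropped from Λ^s.
rows-toSP : ∀ {d} → AllPairs RowOrder d → rows (toSP d) ≃ d
rows-toSP [] i = refl
rows-toSP {(v , true) ∷ d} (p ∷ ps) = λ i → trans (cong (λ l → at l i) (head (thetas d) (parts d) (parts-all {λ y → y ≤ v} (All.map (λ {y} q _ → rowOrder-≤ (v , true) y q) p))))
    (≃-∷ (v , true) (rows-toSP ps) i)
  where
  head : ∀ t s → All (λ y → y ≤ v) s → rowsC (v ∷ t) s ≡ (v , true) ∷ rowsC t s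
  head t [] _ = cong ((v , true) ∷_) (sym (rowsC-[] t))
  head t (y ∷ s) (q ∷ _) = cong (λ b → if b then (v , true) ∷ rowsC t (y ∷ s) else (y , false) ∷ rowsC (v ∷ t) s) (Equivalence.to 𝔹.T-≡ (ℕP.≤⇒≤ᵇ q))
rows-toSP {(suc v , false) ∷ d} (p ∷ ps) = λ i → trans (cong (λ l → at l i) (head (thetas d) (parts d) (thetas-all {λ y → y < suc v} (All.map lt p))))
    (≃-∷ (suc v , false) (rows-toSP ps) i)
  where
  lt : ∀ {y} → RowOrder (suc v , false) y → proj₂ y ≡ true → proj₁ y < suc v
  lt (inj₁ r) _ = r
  lt (inj₂ (refl , refl)) ()
  head : ∀ t s → All (λ y → y < suc v) t → rowsC t (suc v ∷ s) ≡ (suc v , false) ∷ rowsC t s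
  head [] s _ = refl
  head (x ∷ t) s (q ∷ _) with suc v ≤ᵇ x in e
  ... | true  = ⊥-elim (ℕP.<⇒≱ q (≤ᵇ-true e))
  ... | false = refl
rows-toSP {(zero , false) ∷ d} (p ∷ ps) = λ i → trans (cong (λ l → at l i) (empty d p)) (sym (blanks d p i))
  where
  empty : ∀ d → All (RowOrder blank) d → rows (toSP d) ≡ []
  empty [] [] = refl
  empty ((zero , false) ∷ d) (_ ∷ a) = empty d a
  empty ((suc _ , false) ∷ d) (inj₂ (() , _) ∷ a)
  empty ((_ , true) ∷ d) (inj₂ (_ , ()) ∷ a)
  blanks : ∀ d → All (RowOrder blank) d → blank ∷ d ≃ []
  blanks d a zero = refl
  blanks (_ ∷ d) (inj₂ (refl , refl) ∷ a) (suc i) = blanks d a i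
  blanks [] [] (suc i) = refl

exceeds : ℕ → Factor → Bool
exceeds i (t , n) = i <ᵇ n

marksAt : ℕ → Factor → Bool
marksAt i (t , n) = t ∧ (n ≡ᵇ i)

countB-cong : ∀ {A : Set} {p q : A → Bool} xs → (∀ x → p x ≡ q x) → countB p xs ≡ countB q xs
countB-cong [] e = refl
countB-cong (x ∷ xs) e = cong₂ (λ b k → b2n b + k) (e x) (countB-cong xs e)

posCount-countB : ∀ fs → posCount fs ≡ countB (exceeds 0) fs
posCount-countB [] = refl
posCount-countB ((t , zero) ∷ fs) = posCount-countB fs
posCount-countB ((t , suc n) ∷ fs) = cong suc (posCount-countB fs)

hasMark-countB : ∀ fs → hasMark fs ≡ (0 <ᵇ countB (marksAt 0) fs)
hasMark-countB [] = refl
hasMark-countB ((true , zero) ∷ fs) = refl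
hasMark-countB ((false , zero) ∷ fs) = hasMark-countB fs
hasMark-countB ((true , suc n) ∷ fs) = hasMark-countB fs
hasMark-countB ((false , suc n) ∷ fs) = hasMark-countB fs

exceeds-lower : ∀ i f → exceeds i (lower f) ≡ exceeds (suc i) f
exceeds-lower zero    (t , zero)  = refl
exceeds-lower (suc i) (t , zero)  = refl
exceeds-lower i       (t , suc n) = refl

marksAt-lower : ∀ i f → marksAt i (lower f) ≡ marksAt (suc i) f
marksAt-lower i (t , zero)  = sym (𝔹.∧-zeroʳ t)
marksAt-lower i (t , suc n) = refl

countB-zero : ∀ {A : Set} (p : A → Bool) {xs} → All (λ x → p x ≡ false) xs → countB p xs ≡ 0
countB-zero p [] = refl
countB-zero p (e ∷ a) rewrite e = countB-zero p a

fits-lower : ∀ {N fs} → Fits (suc N) fs → Fits N (map lower fs)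
fits-lower a = AllP.map⁺ (All.map (λ {f} → low f) a)
  where
  low : ∀ {N} f → size true f ≤ suc N → size true (lower f) ≤ N
  low (t , zero) _ = z≤n
  low (t , suc n) (s≤s p) = p

at-conjDense : ∀ N fs i → Fits N fs → at (conjDense N fs) i ≡ (countB (exceeds i) fs , (0 <ᵇ countB (marksAt i) fs))
at-conjDense zero fs i a = cong₂ (λ k j → k , (0 <ᵇ j))
  (sym (countB-zero (exceeds i) (All.map (λ {f} → ex i f) a))) (sym (countB-zero (marksAt i) (All.map (λ {f} → mk i f) a)))
  where
  ex : ∀ i f → size true f ≤ 0 → exceeds i f ≡ false
  ex i (t , zero) _ = refl
  mk : ∀ i f → size true f ≤ 0 → marksAt i f ≡ false
  mk i (false , zero) _ = refl
at-conjDense (suc N) fs zero a = cong₂ _,_ (posCount-countB fs) (hasMark-countB fs)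
at-conjDense (suc N) fs (suc i) a = trans (at-conjDense N (map lower fs) i (fits-lower a))
  (cong₂ (λ k j → k , (0 <ᵇ j))
    (trans (countB-map (exceeds i) lower fs) (countB-cong fs (exceeds-lower i)))
    (trans (countB-map (marksAt i) lower fs) (countB-cong fs (marksAt-lower i))))

countB-sum : ∀ {A : Set} (p : A → Bool) xs → countB p xs ≡ sum (map (b2n ∘ p) xs)
countB-sum p [] = refl
countB-sum p (x ∷ xs) = cong (λ k → b2n (p x) + k) (countB-sum p xs)

countB-↭ : ∀ {A : Set} (p : A → Bool) {xs ys} → xs ↭ ys → countB p xs ≡ countB p ys
countB-↭ p {xs} {ys} r = trans (countB-sum p xs) (trans (LAP.sum-↭ (↭P.map⁺ (b2n ∘ p) r)) (sym (countB-sum p ys)))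

toFactor : Letter → Factor
toFactor (a , t) = t , a

wider : ℕ → Letter → Bool
wider i x = i <ᵇ proj₁ x

circled : ℕ → Letter → Bool
circled i x = proj₂ x ∧ (proj₁ x ≡ᵇ i)

-- R and R′ list the rows of two diagrams that are transposes of each other.
Transposed : Dense → Dense → Set
Transposed R R′ = ∀ i j →
  (j < proj₁ (at R′ i) ⇔ i < proj₁ (at R j)) × (at R′ i ≡ (j , true) ⇔ at R j ≡ (i , true))

transposed-sym : ∀ R R′ → Transposed R R′ → Transposed R′ R
transposed-sym R R′ t i j = let (p , q) = t j i in flip p , flip q
  where
  flip : ∀ {A B : Set} → A ⇔ B → B ⇔ A
  flip e = mk⇔ (Equivalence.from e) (Equivalence.to e)

<ᵇ-true : ∀ {a b} → a < b → (a <ᵇ b) ≡ true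
<ᵇ-true p = Equivalence.to 𝔹.T-≡ (ℕP.<⇒<ᵇ p)

<ᵇ-false : ∀ {a b} → ¬ a < b → (a <ᵇ b) ≡ false
<ᵇ-false {a} {b} n with a <ᵇ b in e
... | false = refl
... | true = ⊥-elim (n (ℕP.<ᵇ⇒< a b (subst T (sym e) _)))

-- The equivalences say that exactly the first c rows are wider than i, so counting such rows gives
-- c.
countB-initial : ∀ i R c → (∀ j → j < c ⇔ i < proj₁ (at R j)) → countB (wider i) R ≡ c
countB-initial i [] zero e = refl
countB-initial i [] (suc c) e = case Equivalence.to (e 0) (s≤s z≤n) of λ ()
countB-initial i (x ∷ R) zero e rewrite <ᵇ-false {i} {proj₁ x} (λ p → case Equivalence.from (e 0) p of λ ()) =
  countB-initial i R zero (λ j → mk⇔ (λ ()) (λ p → case Equivalence.from (e (suc j)) p of λ ()))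
countB-initial i (x ∷ R) (suc c) e rewrite <ᵇ-true {i} {proj₁ x} (Equivalence.to (e 0) (s≤s z≤n)) =
  cong suc (countB-initial i R c (λ j → mk⇔ (λ p → Equivalence.to (e (suc j)) (s≤s p)) (λ p → ≤-pred (Equivalence.from (e (suc j)) p))))

circled-countB : ∀ i R → (0 <ᵇ countB (circled i) R) ≡ true → ∃ λ j → at R j ≡ (i , true)
circled-countB i ((v , true) ∷ R) e with v ≡ᵇ i in q
... | true = 0 , cong (_, true) (ℕP.≡ᵇ⇒≡ v i (subst T (sym q) _))
... | false = let (j , p) = circled-countB i R e in suc j , p
circled-countB i ((v , false) ∷ R) e = let (j , p) = circled-countB i R e in suc j , p

countB-circled : ∀ i R j → at R j ≡ (i , true) → (0 <ᵇ countB (circled i) R) ≡ true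
countB-circled i (_ ∷ R) zero refl rewrite Equivalence.to 𝔹.T-≡ (ℕP.≡⇒≡ᵇ i i refl) = refl
countB-circled i (x ∷ R) (suc j) e with circled i x
... | true = refl
... | false = countB-circled i R j e

-- A diagram determines its transpose row by row. This identifies any conjugate with the extremal
-- monomial and makes conjugation an involution.
transposed-at : ∀ R R′ → Transposed R R′ → ∀ i → at R′ i ≡ (countB (wider i) R , (0 <ᵇ countB (circled i) R))
transposed-at R R′ t i = cong₂ _,_ (sym (countB-initial i R (proj₁ (at R′ i)) (λ j → proj₁ (t i j)))) flag
  where
  flag : proj₂ (at R′ i) ≡ (0 <ᵇ countB (circled i) R)
  flag with proj₂ (at R′ i) in e
  ... | true = sym (countB-circled i R _ (Equivalence.to (proj₂ (t i (proj₁ (at R′ i)))) (cong (proj₁ (at R′ i) ,_) e)))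
  ... | false with 0 <ᵇ countB (circled i) R in e′
  ...   | false = refl
  ...   | true with circled-countB i R e′
  ...     | j′ , p = trans (sym e) (cong proj₂ (Equivalence.from (proj₂ (t i j′)) p))

transposed-conjDense : ∀ R R′ N fs → Transposed R R′ → map toFactor R ↭ fs → Fits N fs → R′ ≃ conjDense N fs
transposed-conjDense R R′ N fs t p f i = trans (transposed-at R R′ t i) (sym (trans (at-conjDense N fs i f)
  (cong₂ (λ k j → k , (0 <ᵇ j))
    (trans (countB-↭ (exceeds i) (↭-sym p)) (countB-map (exceeds i) toFactor R))
    (trans (countB-↭ (marksAt i) (↭-sym p)) (countB-map (marksAt i) toFactor R)))))

countB-wider⇔ : ∀ R → AllPairs RowOrder R → ∀ i j → j < countB (wider i) R ⇔ i < proj₁ (at R j)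
countB-wider⇔ [] [] i j = mk⇔ (λ ()) (λ ())
countB-wider⇔ (x ∷ R) (a ∷ s) i j with i ℕ.<? proj₁ x
... | no n rewrite <ᵇ-false n | countB-zero (wider i) (All.map (λ {y} q → <ᵇ-false (λ p → n (ℕP.<-≤-trans p (rowOrder-≤ x y q)))) a) =
  mk⇔ (λ ()) (λ p → ⊥-elim (below j p))
  where
  below : ∀ j → ¬ i < proj₁ (at (x ∷ R) j)
  below zero p = n p
  below (suc j) p = n (ℕP.<-≤-trans p (bd R a j))
    where
    bd : ∀ R → All (RowOrder x) R → ∀ j → proj₁ (at R j) ≤ proj₁ x
    bd [] _ j = z≤n
    bd (y ∷ R) (q ∷ a) zero = rowOrder-≤ x y q
    bd (y ∷ R) (q ∷ a) (suc j) = bd R a j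
countB-wider⇔ (x ∷ R) (a ∷ s) i zero | yes p rewrite <ᵇ-true p = mk⇔ (λ _ → p) (λ _ → s≤s z≤n)
countB-wider⇔ (x ∷ R) (a ∷ s) i (suc j) | yes p rewrite <ᵇ-true p =
  mk⇔ (λ q → Equivalence.to ih (≤-pred q)) (λ q → s≤s (Equivalence.from ih q))
  where ih = countB-wider⇔ R s i j

rowOrder-circled : ∀ x i R → All (RowOrder x) R → ∀ j → at R j ≡ (i , true) → i < proj₁ x
rowOrder-circled x i (_ ∷ R) (inj₁ p ∷ a) zero refl = p
rowOrder-circled x i (_ ∷ R) (inj₂ (_ , ()) ∷ a) zero refl
rowOrder-circled x i (_ ∷ R) (_ ∷ a) (suc j) e = rowOrder-circled x i R a j e

-- The circled row comes first among the rows of its length, so the rows above it are exactly the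
-- longer ones. Hence the transposed circle ends its row.
countB-wider-circled : ∀ R → AllPairs RowOrder R → ∀ i j → at R j ≡ (i , true) → countB (wider i) R ≡ j
countB-wider-circled (x ∷ R) (a ∷ s) i zero refl rewrite <ᵇ-false {i} {i} (ℕP.<-irrefl refl) =
  countB-zero (wider i) (All.map (λ {y} q → <ᵇ-false (ℕP.≤⇒≯ (rowOrder-≤ (i , true) y q))) a)
countB-wider-circled (x ∷ R) (a ∷ s) i (suc j) e rewrite <ᵇ-true {i} {proj₁ x} (rowOrder-circled x i R a j e) =
  cong suc (countB-wider-circled R s i j e)

conjDense-transposed : ∀ R N fs → AllPairs RowOrder R → map toFactor R ↭ fs → Fits N fs → Transposed R (conjDense N fs)
conjDense-transposed R N fs s p f i j
  rewrite at-conjDense N fs i f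
        | trans (countB-↭ (exceeds i) (↭-sym p)) (countB-map (exceeds i) toFactor R)
        | trans (countB-↭ (marksAt i) (↭-sym p)) (countB-map (marksAt i) toFactor R) =
  countB-wider⇔ R s i j , mk⇔ to (λ e → cong₂ _,_ (countB-wider-circled R s i j e) (countB-circled i R j e))
  where
  to : (countB (wider i) R , (0 <ᵇ countB (circled i) R)) ≡ (j , true) → at R j ≡ (i , true)
  to e with circled-countB i R (cong proj₂ e)
  ... | j′ , q = subst (λ k → at R k ≡ (i , true)) (trans (sym (countB-wider-circled R s i j′ q)) (cong proj₁ e)) q

-- A factor that contributes an x or a θ to the next variable was still positive before. So the next
-- exponent together with its flag is at most the present exponent.
conjDense-rowOrder : ∀ N fs → AllPairs RowOrder (conjDense N fs)
conjDense-rowOrder N fs = LinkedP.Linked⇒AllPairs (λ {x} {y} {z} → rowOrder-trans {x} {y} {z}) (linked N fs)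
  where
  count : ∀ fs → posCount (map lower fs) + b2n (hasMark (map lower fs)) ≤ posCount fs
  count [] = z≤n
  count ((t , zero) ∷ fs) = count fs
  count ((false , suc zero) ∷ fs) = ℕP.m≤n⇒m≤1+n (count fs)
  count ((true , suc zero) ∷ fs) = ≤-trans (≤-reflexive (ℕP.+-comm _ 1)) (s≤s (≤-trans (m≤m+n _ _) (count fs)))
  count ((t , suc (suc n)) ∷ fs) = s≤s (count fs)
  order : ∀ a b u t → b + b2n u ≤ a → RowOrder (a , t) (b , u)
  order a b true t p = inj₁ (subst (_≤ a) (ℕP.+-comm b 1) p)
  order a b false t p with ℕP.m≤n⇒m<n∨m≡n (subst (_≤ a) (+-identityʳ b) p)
  ... | inj₁ r = inj₁ r
  ... | inj₂ r = inj₂ (r , refl)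
  linked : ∀ N fs → Linked RowOrder (conjDense N fs)
  linked zero fs = []
  linked (suc zero) fs = [-]
  linked (suc (suc N)) fs = order _ _ (hasMark (map lower fs)) (hasMark fs) (count fs) ∷ linked (suc N) (map lower fs)

-- The factors of a superpartition and its conjugate

eFactors : List ℕ → List ℕ → List Factor
eFactors a s = map (true ,_) a ++ map (false ,_) s

factors : SP → List Factor
factors (a , s) = eFactors a s

toFactor-rows : ∀ Λ → map toFactor (rows Λ) ↭ factors Λ
toFactor-rows (a , s) = ↭-trans (↭P.map⁺ toFactor (rowsC-↭ a s)) (↭-reflexive
  (trans (LP.map-++ toFactor (marked a) (unmarked s)) (cong₂ _++_ (sym (LP.map-∘ a)) (sym (LP.map-∘ s)))))

toFactor-rows-reverse : ∀ a s → map toFactor (rows (a , s)) ↭ eFactors (reverse a) s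
toFactor-rows-reverse a s = ↭-trans (toFactor-rows (a , s))
  (↭P.++⁺ʳ (map (false ,_) s) (↭P.map⁺ (true ,_) (↭-sym (↭P.↭-reverse a))))

prodSF-eFactors : ∀ a s μ → prodSF (map etSF a ++ map eSF s) μ ≡ prodCoeff (eFactors a s) (toDense μ)
prodSF-eFactors a s μ = trans (cong (λ Fs → prodSF Fs μ) (sym
  (trans (LP.map-++ ⟦_⟧ (map (true ,_) a) (map (false ,_) s)) (cong₂ _++_ (sym (LP.map-∘ a)) (sym (LP.map-∘ s))))))
  (prodSF-coeff (eFactors a s) μ)

apart-sym : ∀ {f g} → Apart f g → Apart g f
apart-sym p q r e = p r q (sym e)

module _ {n m Λ} (isp : IsSPar n m Λ) {fs} (p : map toFactor (rows Λ) ↭ fs) where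

  private
    a = proj₁ Λ
    s = proj₂ Λ
    q : factors Λ ↭ fs
    q = ↭-trans (↭-sym (toFactor-rows Λ)) p

  -- Indices are at most n, and one more variable is needed for a θ; the surplus `j` allows partial
  -- sums of any length to be compared. The list `fs` may be in any order, as the ẽ's are multiplied
  -- in two different orders.
  factors-fit : ∀ j → Fits (suc n + j) fs
  factors-fit j = ↭P.All-resp-↭ q (AllP.++⁺
    (AllP.map⁺ (All.map (λ {x} r → ≤-trans (≤-reflexive (ℕP.+-comm x 1)) (≤-trans (s≤s r) (m≤m+n _ j))) (proj₁ b)))
    (AllP.map⁺ (All.map (λ {x} r → ≤-trans (≤-reflexive (+-identityʳ x)) (≤-trans r (≤-trans (ℕP.n≤1+n n) (m≤m+n _ j)))) (proj₁ (proj₂ b)))))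
    where b = isSPar-bounded isp

  factors-distinct : Distinct fs
  factors-distinct = ↭SP.AllPairs-resp-↭ (setoid Factor) (λ {f} {g} → apart-sym {f} {g}) (resp₂ Apart) (↭⇒↭ₛ q)
    (APP.++⁺ (APP.map⁺ (AP.map (λ r _ _ e → ℕP.<-irrefl (sym e) r) (>-allPairs (IsSPar.antiStrict isp))))
             (APP.map⁺ (AP.map (λ _ ()) (≥-allPairs (IsSPar.symWeak isp))))
             (AllP.map⁺ (All.universal (λ _ → AllP.map⁺ (All.universal (λ _ _ ()) s)) a)))

  factors-size : sum (map (size false) fs) ≡ n × sum (map (size true) fs) ≡ n + m
  factors-size =
    trans (sums false) (trans (cong (λ k → k + sum s) (marks0 a)) (IsSPar.total isp)) ,
    trans (sums true) (trans (cong (λ k → k + sum s) (marks1 a))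
      (trans (lem (sum a) (length a) (sum s)) (cong₂ _+_ (IsSPar.total isp) (IsSPar.antiLength isp))))
    where
    lem : ∀ a b c → a + b + c ≡ a + c + b
    lem = ℕR.solve-∀
    marks0 : ∀ a → sum (map (size false) (map (true ,_) a)) ≡ sum a
    marks0 [] = refl
    marks0 (x ∷ a) = cong₂ _+_ (+-identityʳ x) (marks0 a)
    marks1 : ∀ a → sum (map (size true) (map (true ,_) a)) ≡ sum a + length a
    marks1 [] = refl
    marks1 (x ∷ a) = trans (cong (λ k → x + 1 + k) (marks1 a)) (lem′ x (sum a) (length a))
      where
      lem′ : ∀ x y z → x + 1 + (y + z) ≡ x + y + suc z
      lem′ = ℕR.solve-∀
    nomarks : ∀ c s → sum (map (size c) (map (false ,_) s)) ≡ sum s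
    nomarks c [] = refl
    nomarks c (x ∷ s) = cong₂ _+_ (+-identityʳ x) (nomarks c s)
    sums : ∀ c → sum (map (size c) fs) ≡ sum (map (size c) (map (true ,_) a)) + sum s
    sums c = trans (LAP.sum-↭ (↭P.map⁺ (size c) (↭-sym q)))
      (trans (cong sum (LP.map-++ (size c) (map (true ,_) a) (map (false ,_) s)))
        (trans (LAP.sum-++ (map (size c) (map (true ,_) a)) _) (cong (λ k → sum (map (size c) (map (true ,_) a)) + k) (nomarks c s))))

  prodCoeff-homogeneous : Homogeneous n m (prodCoeff fs)
  prodCoeff-homogeneous d nz = trans (prodCoeff-total fs nz false) (proj₁ factors-size) ,
                               trans (prodCoeff-total fs nz true) (proj₂ factors-size)

  coeff-expansion : ∀ μ → prodCoeff fs (toDense μ) ≡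
    ∑ (superpartitions n m) (λ Ω → prodCoeff fs (canonical Ω) *ℤ monoSF Ω μ)
  coeff-expansion μ = trans
    (monomial-expansion (prodCoeff-symmetric fs) (prodCoeff-stable fs) prodCoeff-homogeneous (toDense μ))
    (∑-cong∈ (superpartitions n m) (λ {Ω} Ω∈ →
      cong (prodCoeff fs (canonical Ω) *ℤ_) (sym (monoSF-coeff (superpartitions-sound {n} {m} Ω∈) μ))))

partialSum-stable : ∀ c j d → partialSum c j (d ++ blank ∷ []) ≡ partialSum c j d
partialSum-stable c zero d = refl
partialSum-stable c (suc zero) [] = refl
partialSum-stable c (suc (suc j)) [] = refl
partialSum-stable c (suc j) (x ∷ d) = cong (λ k → weight c x + k) (partialSum-stable c j d)

partialSum-≃ : ∀ c j d d′ → d ≃ d′ → partialSum c j d ≡ partialSum c j d′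
partialSum-≃ c j = stable-≃ (partialSum-stable c j)

toSP-≃ : ∀ d d′ → d ≃ d′ → toSP d ≡ toSP d′
toSP-≃ = stable-≃ toSP-stable

rows-injective : ∀ {n m Λ Ω} → IsSPar n m Λ → IsSPar n m Ω → rows Λ ≃ rows Ω → Λ ≡ Ω
rows-injective {Λ = Λ} {Ω} isp isq e = trans (sym (toSP-rows isp)) (trans (toSP-≃ (rows Λ) (rows Ω) e) (toSP-rows isq))

_≼_ : SP → SP → Set
Ω ≼ Λ = ∀ c j → partialSum c j (rows Ω) ≤ partialSum c j (rows Λ)

module _ {n m Λ} (isp : IsSPar n m Λ) Λ′ (t : Transposed (rows Λ) (rows Λ′))
         {fs} (p : map toFactor (rows Λ) ↭ fs) where

  rows-conjDense : ∀ j → rows Λ′ ≃ conjDense (suc n + j) fs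
  rows-conjDense j = transposed-conjDense (rows Λ) (rows Λ′) (suc n + j) fs t p (factors-fit isp p j)

  coeff-dominated : ∀ {Ω} → prodCoeff fs (canonical Ω) ≢ + 0 → Ω ≼ Λ′
  coeff-dominated {Ω} nz c j = ≤-trans
    (prodCoeff-bound fs (λ z → nz (trans (symmetric-rows (prodCoeff fs) (prodCoeff-symmetric fs) Ω) z)) c j)
    -- The number of variables is chosen after j, so that the first j letters of the extremal
    -- monomial are all present.
    (≤-reflexive (trans (sym (conjDense-partialSum c j (suc n + j) (m≤n+m j (suc n)) (factors-distinct isp p)))
      (sym (partialSum-≃ c j (rows Λ′) _ (rows-conjDense j)))))

  coeff-leading : prodCoeff fs (canonical Λ′) ≡ leadingSign (suc n + 0) fs
  coeff-leading = trans (symmetric-rows (prodCoeff fs) (prodCoeff-symmetric fs) Λ′)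
    (trans (stable-≃ (prodCoeff-stable fs) (rows Λ′) _ (rows-conjDense 0))
      (prodCoeff-leading (suc n + 0) (factors-fit isp p 0) (factors-distinct isp p)))

partialSum-total : ∀ c d j → length d ≤ j → partialSum c j d ≡ total c d
partialSum-total c [] zero _ = refl
partialSum-total c [] (suc j) _ = refl
partialSum-total c (x ∷ d) (suc j) (s≤s p) = cong (λ k → weight c x + k) (partialSum-total c d j p)

bound-size : ∀ c j fs → All (λ f → size c f ≤ j) fs → bound c j fs ≡ sum (map (size c) fs)
bound-size c j [] [] = refl
bound-size c j (f ∷ fs) (p ∷ ps) = cong₂ _+_ (ℕP.m≥n⇒m⊓n≡n p) (bound-size c j fs ps)

size-mono : ∀ f → size false f ≤ size true f
size-mono (t , n) rewrite 𝔹.∧-zeroʳ t = ℕP.+-monoʳ-≤ n z≤n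

conj : ℕ → SP → SP
conj n Λ = toSP (conjDense (suc n + 0) (factors Λ))

conj-isSPar : ∀ {n m Λ} → IsSPar n m Λ → IsSPar n m (conj n Λ)
conj-isSPar {n} {m} {Λ} isp = toSP-isSPar {Q = RowOrder} anti weak (conjDense-rowOrder N fs)
  (trans (tot false (All.map (λ {f} q → ≤-trans (size-mono f) q) fit)) (proj₁ (factors-size isp p)))
  (trans (tot true fit) (proj₂ (factors-size isp p)))
  where
  N = suc n + 0
  fs = factors Λ
  p = toFactor-rows Λ
  fit = factors-fit isp p 0
  anti : ∀ {v w} → RowOrder (v , true) (w , true) → v > w
  anti (inj₁ q) = q
  weak : ∀ {v w} → RowOrder (v , false) (w , false) → v ≥ w
  weak (inj₁ q) = <⇒≤ q
  weak (inj₂ (refl , _)) = ≤-refl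
  tot : ∀ c → All (λ f → size c f ≤ N) fs → total c (conjDense N fs) ≡ sum (map (size c) fs)
  tot c a = trans (sym (partialSum-total c (conjDense N fs) N (≤-reflexive (length-conjDense N fs))))
    (trans (conjDense-partialSum c N N ≤-refl (factors-distinct isp p)) (bound-size c N fs a))

conj-transposed : ∀ {n m Λ} → IsSPar n m Λ → Transposed (rows Λ) (rows (conj n Λ))
conj-transposed {n} {m} {Λ} isp i j rewrite rows-toSP (conjDense-rowOrder (suc n + 0) (factors Λ)) i =
  conjDense-transposed (rows Λ) (suc n + 0) (factors Λ) (rows-rowOrder isp) (toFactor-rows Λ)
    (factors-fit isp (toFactor-rows Λ) 0) i j

-- Λ and its double conjugate are both transposes of the same diagram, hence have the same rows.
conj-involutive : ∀ {n m Λ} → IsSPar n m Λ → conj n (conj n Λ) ≡ Λ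
conj-involutive {n} {m} {Λ} isp = sym (rows-injective isp (conj-isSPar (conj-isSPar isp))
  (λ i → trans (transposed-at R (rows Λ) (transposed-sym (rows Λ) R (conj-transposed isp)) i)
               (sym (transposed-at R (rows (conj n (conj n Λ))) (conj-transposed (conj-isSPar isp)) i))))
  where R = rows (conj n Λ)

nthM-at : ∀ l i {r} → nthM l i ≡ just r → at l i ≡ r
nthM-at (x ∷ l) zero refl = refl
nthM-at (x ∷ l) (suc i) e = nthM-at l i e

at-nthM : ∀ l i → at l i ≢ blank → nthM l i ≡ just (at l i)
at-nthM [] i n = ⊥-elim (n refl)
at-nthM (x ∷ l) zero n = refl
at-nthM (x ∷ l) (suc i) n = at-nthM l i n

-- The default of `at` is a blank row, which has neither box nor circle; nothing is lost against the
-- partial lookup `nthM`.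
box⇔ : ∀ Λ i j → Box Λ i j ⇔ j < proj₁ (at (rows Λ) i)
box⇔ Λ i j = mk⇔ (λ { (r , e , p) → subst (λ x → j < proj₁ x) (sym (nthM-at (rows Λ) i e)) p })
                 (λ p → at (rows Λ) i , at-nthM (rows Λ) i (λ e → case subst (λ x → j < proj₁ x) e p of λ ()) , p)

circle⇔ : ∀ Λ i j → Circle Λ i j ⇔ at (rows Λ) i ≡ (j , true)
circle⇔ Λ i j = mk⇔ (nthM-at (rows Λ) i)
  (λ e → trans (at-nthM (rows Λ) i (λ e′ → case trans (sym e) e′ of λ ())) (cong just e))

isConj-transposed : ∀ {Λ Λ′} → IsConj Λ Λ′ → Transposed (rows Λ) (rows Λ′)
isConj-transposed {Λ} {Λ′} c i j = chain (box⇔ Λ′ i j) (proj₁ (c i j)) (box⇔ Λ j i) ,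
                                   chain (circle⇔ Λ′ i j) (proj₂ (c i j)) (circle⇔ Λ j i)
  where
  chain : ∀ {A B C D : Set} → A ⇔ B → A ⇔ C → C ⇔ D → B ⇔ D
  chain f g h = mk⇔ (Equivalence.to h ∘ Equivalence.to g ∘ Equivalence.from f)
                    (Equivalence.to f ∘ Equivalence.from g ∘ Equivalence.from h)

rows-length : ∀ a s → length (rows (a , s)) ≡ length a + length s
rows-length a s = trans (↭P.↭-length (rowsC-↭ a s)) (trans (LP.length-++ (marked a)) (cong₂ _+_ (LP.length-map _ a) (LP.length-map _ s)))

rank : ℕ → SP → ℕ
rank M Ω = sum (applyUpTo (λ j → partialSum false j (rows Ω) + partialSum true j (rows Ω)) M)

sum-mono : ∀ M {g h} → (∀ j → g j ≤ h j) → sum (applyUpTo g M) ≤ sum (applyUpTo h M)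
sum-mono zero    p = z≤n
sum-mono (suc M) p = ℕP.+-mono-≤ (p 0) (sum-mono M (p ∘ suc))

sum-tight : ∀ M {g h} → (∀ j → g j ≤ h j) → sum (applyUpTo g M) ≡ sum (applyUpTo h M) → ∀ j → j < M → g j ≡ h j
sum-tight (suc M) p e j j<M with ≤-sum-tight (p 0) (sum-mono M (p ∘ suc)) e
sum-tight (suc M) p e zero    _       | e₀ , _ = e₀
sum-tight (suc M) p e (suc j) (s≤s q) | _ , e′ = sum-tight M (p ∘ suc) e′ j q

ell≤ : ∀ {n m Λ} → IsSPar n m Λ → length (rows Λ) ≤ n + m
ell≤ {n} {m} {a , s} isp = ≤-trans (≤-reflexive (rows-length a s)) (≤-trans (≤-reflexive (ℕP.+-comm (length a) _))
  (ℕP.+-mono-≤ (proj₂ (proj₂ (isSPar-bounded isp))) (≤-reflexive (IsSPar.antiLength isp))))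

pad : ℕ → Dense → Dense
pad N d = d ++ replicate (N ∸ length d) blank

length-pad : ∀ N d → length d ≤ N → length (pad N d) ≡ N
length-pad N d p = trans (LP.length-++ d) (trans (cong (λ j → length d + j) (LP.length-replicate _)) (ℕP.m+[n∸m]≡n p))

-- If the sums of termwise ordered partial sums agree, so do all their terms, for both weights, and
-- these determine the rows. A diagram has at most n + m rows, so the lengths 0, ..., n + m are
-- enough.
rank-strict : ∀ {n m Ω Λ} → IsSPar n m Ω → IsSPar n m Λ → Ω ≼ Λ → Ω ≢ Λ → rank (suc (n + m)) Ω < rank (suc (n + m)) Λ
rank-strict {n} {m} {Ω} {Λ} isp isq le ne with rank (suc (n + m)) Ω ℕ.≟ rank (suc (n + m)) Λ
... | no r = ℕP.≤∧≢⇒< (sum-mono (suc (n + m)) (λ j → ℕP.+-mono-≤ (le false j) (le true j))) r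
... | yes e = ⊥-elim (ne (rows-injective isp isq (λ i → trans (sym (≃-pad (rows Ω) _ i)) (trans (cong (λ d → at d i) padded) (≃-pad (rows Λ) _ i)))))
  where
  eq : ∀ c j → j < suc (n + m) → partialSum c j (rows Ω) ≡ partialSum c j (rows Λ)
  eq c j p with ≤-sum-tight (le false j) (le true j) (sum-tight (suc (n + m)) (λ j → ℕP.+-mono-≤ (le false j) (le true j)) e j p)
  eq false j p | q , _ = q
  eq true  j p | _ , q = q
  lenΩ = length-pad (n + m) (rows Ω) (ell≤ isp)
  lenΛ = length-pad (n + m) (rows Λ) (ell≤ isq)
  padded : pad (n + m) (rows Ω) ≡ pad (n + m) (rows Λ)
  padded = partialSum-injective (trans lenΩ (sym lenΛ)) (λ c j p →
    trans (partialSum-≃ c j _ _ (≃-pad (rows Ω) _)) (trans (eq c j (s≤s (≤-trans p (≤-reflexive lenΩ)))) (sym (partialSum-≃ c j _ _ (≃-pad (rows Λ) _)))))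

-- The Bruhat order

data AdjSwap : List Bool → List Bool → Set where
  here  : ∀ {F} → AdjSwap (true ∷ false ∷ F) (false ∷ true ∷ F)
  there : ∀ {b F G} → AdjSwap F G → AdjSwap (b ∷ F) (b ∷ G)

trues : List Bool → ℕ
trues F = sum (map b2n F)

prefixTrues : ℕ → List Bool → ℕ
prefixTrues j F = trues (take j F)

dropFalse : List Bool → List Bool
dropFalse []          = []
dropFalse (false ∷ F) = F
dropFalse (true ∷ F)  = true ∷ dropFalse F

bring-false : ∀ F → trues F < length F → Star AdjSwap (true ∷ F) (false ∷ true ∷ dropFalse F)
bring-false (false ∷ F) _ = here ◅ ε
bring-false (true ∷ F) (s≤s p) = Star.gmap (true ∷_) there (bring-false F p) ◅◅ (here ◅ ε)

length-dropFalse : ∀ F → trues F < length F → suc (length (dropFalse F)) ≡ length F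
length-dropFalse (false ∷ F) _ = refl
length-dropFalse (true ∷ F) (s≤s p) = cong suc (length-dropFalse F p)

trues-dropFalse : ∀ F → trues (dropFalse F) ≡ trues F
trues-dropFalse [] = refl
trues-dropFalse (false ∷ F) = refl
trues-dropFalse (true ∷ F) = cong suc (trues-dropFalse F)

-- If the first j+1 flags contain `false`, deleting the first one keeps all their circles among the
-- first j. Otherwise they are all circles and only j of them fit, whence the minimum.
prefixTrues-dropFalse : ∀ F j → j ⊓ prefixTrues (suc j) F ≤ prefixTrues j (dropFalse F)
prefixTrues-dropFalse [] j = ≤-trans (≤-reflexive (ℕP.⊓-zeroʳ j)) z≤n
prefixTrues-dropFalse (false ∷ F) j = ℕP.m⊓n≤n j _
prefixTrues-dropFalse (true ∷ F) zero = z≤n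
prefixTrues-dropFalse (true ∷ F) (suc j) = s≤s (prefixTrues-dropFalse F j)

trues≤length : ∀ F → trues F ≤ length F
trues≤length [] = z≤n
trues≤length (false ∷ F) = ℕP.m≤n⇒m≤1+n (trues≤length F)
trues≤length (true ∷ F) = s≤s (trues≤length F)

prefixTrues≤ : ∀ j F → prefixTrues j F ≤ j
prefixTrues≤ j F = ≤-trans (trues≤length (take j F)) (≤-trans (≤-reflexive (LP.length-take j F)) (ℕP.m⊓n≤m j _))

-- Greedy from the top: equal first flags are set aside. If only F starts with a circle, its first
-- uncircled row is raised to the top one exchange at a time, and the remaining flags stay
-- dominating. The opposite case contradicts the first prefix count.
adjSwap-chain : ∀ G F → length F ≡ length G → trues F ≡ trues G → (∀ j → prefixTrues j G ≤ prefixTrues j F) → Star AdjSwap F G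
adjSwap-chain [] [] _ _ _ = ε
adjSwap-chain (true ∷ G) (true ∷ F) l e p =
  Star.gmap (true ∷_) there (adjSwap-chain G F (suc-injective l) (suc-injective e) (λ j → ≤-pred (p (suc j))))
adjSwap-chain (false ∷ G) (false ∷ F) l e p =
  Star.gmap (false ∷_) there (adjSwap-chain G F (suc-injective l) e (λ j → p (suc j)))
adjSwap-chain (true ∷ G) (false ∷ F) l e p = case p 1 of λ ()
adjSwap-chain (false ∷ G) (true ∷ F) l e p = bring-false F lt ◅◅
  Star.gmap (false ∷_) there (adjSwap-chain G (true ∷ dropFalse F) (trans (length-dropFalse F lt) (suc-injective l))
    (trans (cong suc (trues-dropFalse F)) e) dom)
  where
  lt : trues F < length F
  lt = ≤-trans (≤-reflexive e) (≤-trans (trues≤length G) (≤-reflexive (sym (suc-injective l))))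
  dom : ∀ j → prefixTrues j G ≤ prefixTrues j (true ∷ dropFalse F)
  dom zero = z≤n
  dom (suc j) = ≤-trans (ℕP.⊓-glb (prefixTrues≤ (suc j) G) (p (suc (suc j)))) (s≤s (prefixTrues-dropFalse F j))

-- The one-line notation of the minimal permutation w_λ of λ = (Λ^a, Λ^s):
-- circled rows receive the positions t, t+1, …, the others f, f+1, ….
shuffle : List Bool → ℕ → ℕ → List ℕ
shuffle []          t f = []
shuffle (true ∷ F)  t f = t ∷ shuffle F (suc t) f
shuffle (false ∷ F) t f = f ∷ shuffle F t (suc f)

length-shuffle : ∀ F t f → length (shuffle F t f) ≡ length F
length-shuffle [] t f = refl
length-shuffle (true ∷ F) t f = cong suc (length-shuffle F (suc t) f)
length-shuffle (false ∷ F) t f = cong suc (length-shuffle F t (suc f))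

data Ascent : List ℕ → List ℕ → Set where
  here  : ∀ {x y l} → x < y → Ascent (x ∷ y ∷ l) (y ∷ x ∷ l)
  there : ∀ {x l l′} → Ascent l l′ → Ascent (x ∷ l) (x ∷ l′)

-- The hypothesis t + `trues F` ≤ f says that circled rows receive smaller labels than uncircled
-- ones, so moving a circle below its neighbour creates an inversion.
shuffle-ascent : ∀ {F G} t f → t + trues F ≤ f → AdjSwap F G → Ascent (shuffle F t f) (shuffle G t f)
shuffle-ascent t f p here = here (≤-trans (≤-trans (s≤s (m≤m+n t _)) (≤-reflexive (sym (+-suc t _)))) p)
shuffle-ascent t f p (there {true} {F} s) = there (shuffle-ascent (suc t) f (≤-trans (≤-reflexive (sym (+-suc t (trues F)))) p) s)
shuffle-ascent t f p (there {false} s) = there (shuffle-ascent t (suc f) (ℕP.m≤n⇒m≤1+n p) s)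

ascent-↭ : ∀ {l l′} → Ascent l l′ → l ↭ l′
ascent-↭ (here {x} {y} {l} _) = ↭P.shift y (x ∷ []) l
ascent-↭ (there {x} s) = ↭-prep x (ascent-↭ s)

ascent-invs : ∀ {l l′} → Ascent l l′ → invs l < invs l′
ascent-invs (here {x} {y} {l} p) rewrite <ᵇ-false {y} {x} (ℕP.<-asym p) | <ᵇ-true p =
  s≤s (≤-reflexive (lem (countB (λ z → z <ᵇ x) l) (countB (λ z → z <ᵇ y) l) (invs l)))
  where
  lem : ∀ a b c → a + (b + c) ≡ b + (a + c)
  lem = ℕR.solve-∀
ascent-invs (there {x} s) rewrite countB-↭ (λ z → z <ᵇ x) (ascent-↭ s) = ℕP.+-monoʳ-< _ (ascent-invs s)

-- Permutations as lists of values

record Represents {N : ℕ} (w : Vec (Fin N) N) (L : List ℕ) : Set where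
  constructor rep
  field
    length≡  : length L ≡ N
    entries≡ : ∀ i → toℕ (lookup w i) ≡ nthD L (toℕ i)

nthD-all : ∀ {P : ℕ → Set} {L} → All P L → ∀ i → i < length L → P (nthD L i)
nthD-all (p ∷ a) zero _ = p
nthD-all (p ∷ a) (suc i) (s≤s q) = nthD-all a i q

represented : ∀ {N} L → length L ≡ N → All (λ x → x < N) L → ∃ λ (w : Vec (Fin N) N) → Represents w L
represented {N} L l b = tabulate (λ i → fromℕ< (lt i)) , rep l (λ i →
  trans (cong toℕ (VP.lookup∘tabulate (λ i → fromℕ< (lt i)) i)) (FP.toℕ-fromℕ< (lt i)))
  where
  lt : ∀ i → nthD L (toℕ i) < N
  lt i = nthD-all b (toℕ i) (subst (toℕ i <_) (sym l) (FP.toℕ<n i))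

lookup-ext : ∀ {A : Set} {N} (u v : Vec A N) → (∀ i → lookup u i ≡ lookup v i) → u ≡ v
lookup-ext u v e = trans (sym (VP.tabulate∘lookup u)) (trans (VP.tabulate-cong e) (VP.tabulate∘lookup v))

represents-unique : ∀ {N} {u v : Vec (Fin N) N} {L} → Represents u L → Represents v L → u ≡ v
represents-unique {u = u} {v} (rep _ e) (rep _ e′) = lookup-ext u v (λ i → FP.toℕ-injective (trans (e i) (sym (e′ i))))

lenP-invs : ∀ {N} {w : Vec (Fin N) N} {L} → Represents w L → lenP w ≡ invs L
lenP-invs {N} {w} {L} (rep l e) = trans
  (cong sum (LP.map-cong (λ i → countB-cong (allFin N) (λ j → cong₂ (λ x y → (toℕ i <ᵇ toℕ j) ∧ (x <ᵇ y)) (e j) (e i))) (allFin N)))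
  (go N L l)
  where
  inv : List ℕ → ∀ {N} → Fin N → Fin N → Bool
  inv L i j = (toℕ i <ᵇ toℕ j) ∧ (nthD L (toℕ j) <ᵇ nthD L (toℕ i))
  allFin-suc : ∀ N → List.tabulate Fin.suc ≡ map Fin.suc (allFin N)
  allFin-suc N = sym (LP.map-tabulate id Fin.suc)
  first : ∀ N L x → length L ≡ N → countB (λ (j : Fin N) → nthD L (toℕ j) <ᵇ x) (allFin N) ≡ countB (λ y → y <ᵇ x) L
  first zero [] x _ = refl
  first (suc N) (y ∷ L) x l rewrite allFin-suc N = cong (λ k → b2n (y <ᵇ x) + k)
    (trans (countB-map (λ j → nthD (y ∷ L) (toℕ j) <ᵇ x) Fin.suc (allFin N)) (first N L x (suc-injective l)))
  go : ∀ N L → length L ≡ N → sum (map (λ i → countB (inv L i) (allFin N)) (allFin N)) ≡ invs L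
  go zero [] _ = refl
  go (suc N) (x ∷ L) l rewrite allFin-suc N = cong₂ _+_
    (trans (countB-map (inv (x ∷ L) Fin.zero) Fin.suc (allFin N)) (first N L x (suc-injective l)))
    (trans (cong sum (sym (LP.map-∘ (allFin N))))
      (trans (cong sum (LP.map-cong (λ i → countB-map (inv (x ∷ L) (Fin.suc i)) Fin.suc (allFin N)) (allFin N)))
        (go N L (suc-injective l))))

ascent-position : ∀ {L L′} → Ascent L L′ → ∃ λ k → suc k < length L × nthD L′ k ≡ nthD L (suc k) × nthD L′ (suc k) ≡ nthD L k ×
  (∀ i → i ≢ k → i ≢ suc k → nthD L′ i ≡ nthD L i)
ascent-position (here p) = 0 , s≤s (s≤s z≤n) , refl , refl , λ { zero a b → ⊥-elim (a refl) ; (suc zero) a b → ⊥-elim (b refl) ; (suc (suc i)) a b → refl }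
ascent-position (there s) = let (k , p , q , r , o) = ascent-position s in
  suc k , s≤s p , q , r , λ { zero a b → refl ; (suc i) a b → o i (a ∘ cong suc) (b ∘ cong suc) }

ascent-BStep : ∀ {N} {u v : Vec (Fin N) N} {L L′} → Represents u L → Represents v L′ → Ascent L L′ → BStep u v
ascent-BStep {N} {u} {v} {L} {L′} ru@(rep l e) rv@(rep l′ e′) s with ascent-position s
... | k , p , q , r , o = i , j ,
  subst₂ _<_ (sym ik) (sym jk) (ℕP.n<1+n k) ,
  lookup-ext v _ (λ x → FP.toℕ-injective (trans (e′ x) (trans (pos x (x ≟F i) (x ≟F j)) (trans (sym (e _))
    (cong toℕ (sym (VP.lookup∘tabulate (λ y → lookup u (if does (y ≟F i) then j else (if does (y ≟F j) then i else y))) x))))))) ,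
  subst₂ _<_ (sym (lenP-invs {w = u} ru)) (sym (lenP-invs {w = v} rv)) (ascent-invs s)
  where
  k<N : k < N
  k<N = ℕP.<-trans (ℕP.n<1+n k) (subst (suc k <_) l p)
  sk<N : suc k < N
  sk<N = subst (suc k <_) l p
  i j : Fin N
  i = fromℕ< k<N
  j = fromℕ< sk<N
  ik : toℕ i ≡ k
  ik = FP.toℕ-fromℕ< k<N
  jk : toℕ j ≡ suc k
  jk = FP.toℕ-fromℕ< sk<N
  pos : ∀ x (d : Dec (x ≡ i)) (d′ : Dec (x ≡ j)) → nthD L′ (toℕ x) ≡ nthD L (toℕ (if does d then j else (if does d′ then i else x)))
  pos x (yes refl) _ = trans (cong (nthD L′) ik) (trans q (cong (nthD L) (sym jk)))
  pos x (no n) (yes refl) = trans (cong (nthD L′) jk) (trans r (cong (nthD L) (sym ik)))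
  pos x (no n) (no n′) = o (toℕ x) (λ z → n (FP.toℕ-injective (trans z (sym ik)))) (λ z → n′ (FP.toℕ-injective (trans z (sym jk))))

shuffle-range : ∀ F t f → All (λ x → (t ≤ x × x < t + trues F) ⊎ (f ≤ x × x < f + (length F ∸ trues F))) (shuffle F t f)
shuffle-range [] t f = []
shuffle-range (true ∷ F) t f = inj₁ (≤-refl , ≤-trans (s≤s (m≤m+n t (trues F))) (≤-reflexive (sym (+-suc t (trues F))))) ∷
  All.map (λ { (inj₁ (p , q)) → inj₁ (<⇒≤ p , ≤-trans q (≤-reflexive (sym (+-suc t (trues F))))) ; (inj₂ r) → inj₂ r }) (shuffle-range F (suc t) f)
shuffle-range (false ∷ F) t f rewrite ℕP.+-∸-assoc 1 (trues≤length F) | +-suc f (length F ∸ trues F) =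
  inj₂ (≤-refl , s≤s (m≤m+n f _)) ∷
  All.map (λ { (inj₁ r) → inj₁ r ; (inj₂ (p , q)) → inj₂ (<⇒≤ p , q) }) (shuffle-range F t (suc f))

shuffle-bounded : ∀ F → All (λ x → x < length F) (shuffle F 0 (trues F))
shuffle-bounded F = All.map (λ { (inj₁ (_ , q)) → ℕP.<-≤-trans q (trues≤length F)
                               ; (inj₂ (_ , q)) → ℕP.<-≤-trans q (≤-reflexive (ℕP.m+[n∸m]≡n (trues≤length F))) }) (shuffle-range F 0 (trues F))

shuffle-distinct : ∀ F t f → t + trues F ≤ f → AllPairs _≢_ (shuffle F t f)
shuffle-distinct [] t f p = []
shuffle-distinct (true ∷ F) t f p =
  All.map (λ { (inj₁ (q , _)) refl → ℕP.<-irrefl refl q ; (inj₂ (q , _)) refl → ℕP.<⇒≱ t<f q }) (shuffle-range F (suc t) f) ∷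
  shuffle-distinct F (suc t) f (≤-trans (≤-reflexive (sym (+-suc t (trues F)))) p)
  where
  t<f : t < f
  t<f = ≤-trans (≤-trans (s≤s (m≤m+n t (trues F))) (≤-reflexive (sym (+-suc t (trues F))))) p
shuffle-distinct (false ∷ F) t f p =
  All.map (λ { (inj₁ (_ , q)) refl → ℕP.<⇒≱ q p ; (inj₂ (q , _)) refl → ℕP.<-irrefl refl q }) (shuffle-range F t (suc f)) ∷
  shuffle-distinct F t (suc f) (ℕP.m≤n⇒m≤1+n p)

nthD-distinct : ∀ L → AllPairs _≢_ L → ∀ i j → i < length L → j < length L → nthD L i ≡ nthD L j → i ≡ j
nthD-distinct (x ∷ L) (a ∷ s) zero zero _ _ _ = refl
nthD-distinct (x ∷ L) (a ∷ s) zero (suc j) _ (s≤s q) e = ⊥-elim (nthD-all a j q e)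
nthD-distinct (x ∷ L) (a ∷ s) (suc i) zero (s≤s p) _ e = ⊥-elim (nthD-all a i p (sym e))
nthD-distinct (x ∷ L) (a ∷ s) (suc i) (suc j) (s≤s p) (s≤s q) e = cong suc (nthD-distinct L s i j p q e)

shuffle-isPerm : ∀ {N} {w : Vec (Fin N) N} {F} → Represents w (shuffle F 0 (trues F)) → IsPerm w
shuffle-isPerm {w = w} {F} (rep l e) i j q = FP.toℕ-injective (nthD-distinct _ (shuffle-distinct F 0 (trues F) ≤-refl)
  (toℕ i) (toℕ j) (subst (toℕ i <_) (sym l) (FP.toℕ<n i)) (subst (toℕ j <_) (sym l) (FP.toℕ<n j))
  (trans (sym (e i)) (trans (cong toℕ q) (e j))))

adjSwap-trues : ∀ {F G} → AdjSwap F G → trues F ≡ trues G × length F ≡ length G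
adjSwap-trues here = refl , refl
adjSwap-trues (there {b} s) = cong (λ k → b2n b + k) (proj₁ (adjSwap-trues s)) , cong suc (proj₂ (adjSwap-trues s))

adjSwap-Bruhat : ∀ {N} {u v : Vec (Fin N) N} {F G} → Star AdjSwap F G →
  Represents u (shuffle F 0 (trues F)) → Represents v (shuffle G 0 (trues G)) → BruhatLe u v
adjSwap-Bruhat {u = u} {v} ε ru rv with refl ← represents-unique {u = u} {v} ru rv = ε
adjSwap-Bruhat {N} {u} {v} (_◅_ {F} {H} s ss) ru rv with adjSwap-trues s
... | e , l with represented {N} (shuffle H 0 (trues H)) lenH (subst (λ k → All (λ x → x < k) (shuffle H 0 (trues H))) (trans (sym (length-shuffle H 0 (trues H))) lenH) (shuffle-bounded H))
  where
  lenH : length (shuffle H 0 (trues H)) ≡ N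
  lenH = trans (length-shuffle H 0 _) (trans (sym l) (trans (sym (length-shuffle F 0 (trues F))) (Represents.length≡ ru)))
...   | w , rw = ascent-BStep ru rw (subst (λ k → Ascent (shuffle F 0 (trues F)) (shuffle H 0 k)) e (shuffle-ascent 0 (trues F) ≤-refl s)) ◅
                 adjSwap-Bruhat ss rw rv

-- The minimal permutation of a composition

lookup-padV : ∀ N l (i : Fin N) → lookup (padV N l) i ≡ nthD l (toℕ i)
lookup-padV N l i = VP.lookup∘tabulate (λ i → nthD l (toℕ i)) i

nthD-exponents : ∀ d i → nthD (map proj₁ d) i ≡ proj₁ (at d i)
nthD-exponents [] i = refl
nthD-exponents (x ∷ d) zero = refl
nthD-exponents (x ∷ d) (suc i) = nthD-exponents d i

nthD-map : ∀ (g : ℕ → ℕ) L i → i < length L → nthD (map g L) i ≡ g (nthD L i)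
nthD-map g (x ∷ L) zero _ = refl
nthD-map g (x ∷ L) (suc i) (s≤s p) = nthD-map g L i p

shuffle-blanks : ∀ full k t f → (∀ i → nthD full (f + i) ≡ 0) →
  map (nthD full) (shuffle (map proj₂ (replicate k blank)) t f) ≡ map proj₁ (replicate k blank)
shuffle-blanks full zero t f e = refl
shuffle-blanks full (suc k) t f e = cong₂ _∷_ (trans (cong (nthD full) (sym (+-identityʳ f))) (e 0))
  (shuffle-blanks full k t (suc f) (λ i → trans (cong (nthD full) (sym (+-suc f i))) (e (suc i))))

-- `t` and `f` mark where the unread circled and uncircled entries begin in Λ^c, so each label leads
-- back to the entry of its row. The second hypothesis ranges over all i: reading past the end gives
-- 0, the length of the padding rows.
shuffle-rows : ∀ full k a s t f → (∀ i → i < length a → nthD full (t + i) ≡ nthD a i) → (∀ i → nthD full (f + i) ≡ nthD s i) →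
  map (nthD full) (shuffle (map proj₂ (rowsC a s ++ replicate k blank)) t f) ≡ map proj₁ (rowsC a s ++ replicate k blank)
shuffle-rows full k [] [] t f h h′ = shuffle-blanks full k t f h′
shuffle-rows full k [] (y ∷ s) t f h h′ = cong₂ _∷_ (trans (cong (nthD full) (sym (+-identityʳ f))) (h′ 0))
  (shuffle-rows full k [] s t (suc f) (λ i ()) (λ i → trans (cong (nthD full) (sym (+-suc f i))) (h′ (suc i))))
shuffle-rows full k (x ∷ a) [] t f h h′ = cong₂ _∷_ (trans (cong (nthD full) (sym (+-identityʳ t))) (h 0 (s≤s z≤n)))
  (subst (λ l → map (nthD full) (shuffle (map proj₂ (l ++ replicate k blank)) (suc t) f) ≡ map proj₁ (l ++ replicate k blank)) (rowsC-[] a)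
    (shuffle-rows full k a [] (suc t) f (λ i p → trans (cong (nthD full) (sym (+-suc t i))) (h (suc i) (s≤s p))) h′))
shuffle-rows full k (x ∷ a) (y ∷ s) t f h h′ =
  if-elim (λ l → map (nthD full) (shuffle (map proj₂ (l ++ replicate k blank)) t f) ≡ map proj₁ (l ++ replicate k blank)) (y ≤ᵇ x)
    (cong₂ _∷_ (trans (cong (nthD full) (sym (+-identityʳ t))) (h 0 (s≤s z≤n)))
      (shuffle-rows full k a (y ∷ s) (suc t) f (λ i p → trans (cong (nthD full) (sym (+-suc t i))) (h (suc i) (s≤s p))) h′))
    (cong₂ _∷_ (trans (cong (nthD full) (sym (+-identityʳ f))) (h′ 0))
      (shuffle-rows full k (x ∷ a) s t (suc f) h (λ i → trans (cong (nthD full) (sym (+-suc f i))) (h′ (suc i)))))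

nthD-++ˡ : ∀ a s i → i < length a → nthD (a ++ s) i ≡ nthD a i
nthD-++ˡ (x ∷ a) s zero _ = refl
nthD-++ˡ (x ∷ a) s (suc i) (s≤s p) = nthD-++ˡ a s i p

nthD-++ʳ : ∀ a s i → nthD (a ++ s) (length a + i) ≡ nthD s i
nthD-++ʳ [] s i = refl
nthD-++ʳ (x ∷ a) s i = nthD-++ʳ a s i

rowOrder-blank : ∀ x → RowOrder x blank
rowOrder-blank (zero , t) = inj₂ (refl , refl)
rowOrder-blank (suc v , t) = inj₁ (s≤s z≤n)

pad-rowOrder : ∀ k {d} → AllPairs RowOrder d → AllPairs RowOrder (d ++ replicate k blank)
pad-rowOrder k {d} s = APP.++⁺ s (blanks k) (All.universal (λ x → AllP.replicate⁺ k (rowOrder-blank x)) d)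
  where
  blanks : ∀ k → AllPairs RowOrder (replicate k blank)
  blanks zero = []
  blanks (suc k) = AllP.replicate⁺ k (rowOrder-blank blank) ∷ blanks k

allPairs-at : ∀ {R : Letter → Letter → Set} {d} → AllPairs R d → ∀ i j → i < j → j < length d → R (at d i) (at d j)
allPairs-at {R} {x ∷ d} (a ∷ s) zero (suc j) _ (s≤s q) = all-at d a j q
  where
  all-at : ∀ d → All (R x) d → ∀ j → j < length d → R x (at d j)
  all-at (y ∷ d) (p ∷ a) zero _ = p
  all-at (y ∷ d) (p ∷ a) (suc j) (s≤s q) = all-at d a j q
allPairs-at {R} {x ∷ d} (a ∷ s) (suc i) (suc j) (s≤s p) (s≤s q) = allPairs-at s i j p q

shuffle-false≥ : ∀ d t f j → j < length d → proj₂ (at d j) ≡ false → f ≤ nthD (shuffle (map proj₂ d) t f) j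
shuffle-false≥ ((_ , false) ∷ d) t f zero _ e = ≤-refl
shuffle-false≥ ((_ , true) ∷ d) t f (suc j) (s≤s q) e = shuffle-false≥ d (suc t) f j q e
shuffle-false≥ ((_ , false) ∷ d) t f (suc j) (s≤s q) e = <⇒≤ (shuffle-false≥ d t (suc f) j q e)

-- An uncircled row has a larger label than every row above it, circled or not. As the lower of two
-- equal rows is uncircled, equal rows will never be inverted.
shuffle-increasing : ∀ d t f → t + trues (map proj₂ d) ≤ f → ∀ i j → i < j → j < length d → proj₂ (at d j) ≡ false →
  nthD (shuffle (map proj₂ d) t f) i < nthD (shuffle (map proj₂ d) t f) j
shuffle-increasing ((_ , true) ∷ d) t f p zero (suc j) _ (s≤s q) e =
  ℕP.<-≤-trans (≤-trans (≤-trans (s≤s (m≤m+n t _)) (≤-reflexive (sym (+-suc t _)))) p) (shuffle-false≥ d (suc t) f j q e)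
shuffle-increasing ((_ , false) ∷ d) t f p zero (suc j) _ (s≤s q) e = shuffle-false≥ d t (suc f) j q e
shuffle-increasing ((_ , true) ∷ d) t f p (suc i) (suc j) (s≤s r) (s≤s q) e =
  shuffle-increasing d (suc t) f (≤-trans (≤-reflexive (sym (+-suc t _))) p) i j r q e
shuffle-increasing ((_ , false) ∷ d) t f p (suc i) (suc j) (s≤s r) (s≤s q) e =
  shuffle-increasing d t (suc f) (ℕP.m≤n⇒m≤1+n p) i j r q e

unique-↭ : ∀ {A : Set} (xs ys : List A) → Unique xs → (∀ {x} → x ∈ xs → x ∈ ys) → length ys ≡ length xs → xs ↭ ys
unique-↭ [] [] _ _ _ = ↭-refl
unique-↭ (x ∷ xs) ys (x∉ ∷ u) sub l with MP.∈-∃++ (sub (here refl))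
... | ys₁ , ys₂ , refl = ↭-trans (↭-prep x (unique-↭ xs (ys₁ ++ ys₂) u sub′ l′)) (↭-sym (↭P.shift x ys₁ ys₂))
  where
  l′ : length (ys₁ ++ ys₂) ≡ length xs
  l′ = suc-injective (trans (sym (↭P.↭-length (↭P.shift x ys₁ ys₂))) l)
  sub′ : ∀ {y} → y ∈ xs → y ∈ ys₁ ++ ys₂
  sub′ {y} y∈ with ↭P.∈-resp-↭ (↭P.shift x ys₁ ys₂) (sub (there y∈))
  ... | here refl = ⊥-elim (All.lookup x∉ y∈ refl)
  ... | there q = q

isPerm-↭ : ∀ {N} (v : Vec (Fin N) N) → IsPerm v → map (lookup v) (allFin N) ↭ allFin N
isPerm-↭ {N} v inj = unique-↭ _ _ (UP.map⁺ (λ {i} {j} → inj i j) (UP.allFin⁺ N)) (λ _ → MP.∈-allFin _)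
  (sym (LP.length-map (lookup v) (allFin N)))

countB-mono : ∀ {A : Set} {p q : A → Bool} xs → (∀ x → p x ≡ true → q x ≡ true) → countB p xs ≤ countB q xs
countB-mono [] h = z≤n
countB-mono {p = p} {q} (x ∷ xs) h with p x in e
... | false = ≤-trans (countB-mono xs h) (m≤n+m _ (b2n (q x)))
... | true rewrite h x e = s≤s (countB-mono xs h)

sum-map-mono : ∀ {A : Set} {g h : A → ℕ} xs → (∀ x → g x ≤ h x) → sum (map g xs) ≤ sum (map h xs)
sum-map-mono [] p = z≤n
sum-map-mono (x ∷ xs) p = ℕP.+-mono-≤ (p x) (sum-map-mono xs p)

∧-true : ∀ a b → a ∧ b ≡ true → a ≡ true × b ≡ true
∧-true true true _ = refl , refl

<ᵇ⇒< : ∀ {a b} → (a <ᵇ b) ≡ true → a < b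
<ᵇ⇒< {a} {b} e = ℕP.<ᵇ⇒< a b (subst T (sym e) _)

strictPairs : ∀ {N} → Vec ℕ N → Vec (Fin N) N → ℕ
strictPairs {N} μ v = sum (map (λ i → countB (λ j →
  (lookup μ j <ᵇ lookup μ i) ∧ (toℕ (lookup v j) <ᵇ toℕ (lookup v i))) (allFin N)) (allFin N))

strictPairs≤lenP : ∀ {N} {μ : Vec ℕ N} → NonIncr μ → ∀ v → strictPairs μ v ≤ lenP v
strictPairs≤lenP {N} {μ} ni v = sum-map-mono (allFin N) (λ i → countB-mono (allFin N) (λ j e →
  let (p , q) = ∧-true _ _ e in
  cong₂ _∧_ (<ᵇ-true (ℕP.≰⇒> (λ j≤i → ℕP.<⇒≱ (<ᵇ⇒< {lookup μ j} p) (ni j i j≤i)))) q))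

-- The inversions of v forced by λ = v μ are the pairs of positions at which λ increases,
-- so their number does not depend on v.
strictPairs-invariant : ∀ {N} {μ lam : Vec ℕ N} v → IsPerm v → Acts v μ lam →
  strictPairs μ v ≡ sum (map (λ p → countB (λ q → (lookup lam q <ᵇ lookup lam p) ∧ (toℕ q <ᵇ toℕ p)) (allFin N)) (allFin N))
strictPairs-invariant {N} {μ} {lam} v inj act = begin
  strictPairs μ v
    ≡⟨ cong sum (LP.map-cong (λ i → trans
         (countB-cong (allFin N) (λ j → cong₂ (λ x y → (x <ᵇ y) ∧ (toℕ (lookup v j) <ᵇ toℕ (lookup v i))) (sym (act j)) (sym (act i))))
         (trans (sym (countB-map (H (lookup v i)) (lookup v) (allFin N))) (countB-↭ (H (lookup v i)) (isPerm-↭ v inj)))) (allFin N)) ⟩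
  sum (map ((λ p → countB (H p) (allFin N)) ∘ lookup v) (allFin N))
    ≡⟨ cong sum (LP.map-∘ (allFin N)) ⟩
  sum (map (λ p → countB (H p) (allFin N)) (map (lookup v) (allFin N)))
    ≡⟨ LAP.sum-↭ (↭P.map⁺ _ (isPerm-↭ v inj)) ⟩
  sum (map (λ p → countB (H p) (allFin N)) (allFin N)) ∎
  where
  open ≡-Reasoning
  H : Fin N → Fin N → Bool
  H p q = (lookup lam q <ᵇ lookup lam p) ∧ (toℕ q <ᵇ toℕ p)

-- Every permutation with this action has the same number of inversions between unequal parts, a
-- lower bound for its length; a permutation without further inversions attains it.
isMinPerm-of : ∀ {N} {μ lam : Vec ℕ N} {w} → NonIncr μ → IsPerm w → Acts w μ lam → lenP w ≤ strictPairs μ w → IsMinPerm μ lam w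
isMinPerm-of {N} {μ} {lam} {w} ni pw aw le = pw , aw , λ v pv av → ≤-trans le (≤-trans
  (≤-reflexive (trans (strictPairs-invariant {N} {μ} {lam} w pw aw) (sym (strictPairs-invariant {N} {μ} {lam} v pv av)))) (strictPairs≤lenP {N} {μ} ni v))

trues-rowsC : ∀ a s k → trues (map proj₂ (rowsC a s ++ replicate k blank)) ≡ length a
trues-rowsC a s k = trans (LAP.sum-↭ (↭P.map⁺ b2n (↭P.map⁺ proj₂ (↭P.++⁺ʳ (replicate k blank) (rowsC-↭ a s))))) (tr a)
  where
  bl : ∀ k → trues (map proj₂ (replicate k blank)) ≡ 0
  bl zero = refl
  bl (suc k) = bl k
  un : ∀ s → trues (map proj₂ (unmarked s ++ replicate k blank)) ≡ 0
  un [] = bl k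
  un (y ∷ s) = un s
  tr : ∀ a → trues (map proj₂ ((marked a ++ unmarked s) ++ replicate k blank)) ≡ length a
  tr [] = un s
  tr (x ∷ a) = cong suc (tr a)

module PaddedRows {n m Λ} (isp : IsSPar n m Λ) (N : ℕ) (ell≤N : compLen Λ ≤ N) where

  a = proj₁ Λ
  s = proj₂ Λ
  paddedRows : Dense
  paddedRows = pad N (rows Λ)

  flags : List Bool
  flags = map proj₂ paddedRows

  composition composition⁺ : Vec ℕ N
  composition  = padV N (a ++ s)
  composition⁺ = padV N (map proj₁ (rows Λ))

  length-paddedRows : length paddedRows ≡ N
  length-paddedRows = length-pad N (rows Λ) (≤-trans (≤-reflexive (rows-length a s)) ell≤N)

  length-flags : length flags ≡ N
  length-flags = trans (LP.length-map proj₂ paddedRows) length-paddedRows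

  trues-flags : trues flags ≡ m
  trues-flags = trans (trues-rowsC a s (N ∸ length (rows Λ))) (IsSPar.antiLength isp)

  private
    L = shuffle flags 0 (trues flags)
    ex = represented {N} L (trans (length-shuffle flags 0 (trues flags)) length-flags)
           (subst (λ k → All (λ x → x < k) L) length-flags (shuffle-bounded flags))

  w : Vec (Fin N) N
  w = proj₁ ex

  w-represents : Represents w (shuffle flags 0 (trues flags))
  w-represents = proj₂ ex

  lookup⁺ : ∀ i → lookup composition⁺ i ≡ proj₁ (at paddedRows (toℕ i))
  lookup⁺ i = trans (lookup-padV N (map proj₁ (rows Λ)) i) (trans (nthD-exponents (rows Λ) (toℕ i))
    (cong proj₁ (sym (≃-pad (rows Λ) (N ∸ length (rows Λ)) (toℕ i)))))

  private
    order : ∀ (i j : Fin N) → toℕ i < toℕ j → RowOrder (at paddedRows (toℕ i)) (at paddedRows (toℕ j))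
    order i j p = allPairs-at {RowOrder} (pad-rowOrder (N ∸ length (rows Λ)) (rows-rowOrder isp)) (toℕ i) (toℕ j) p
      (subst (toℕ j <_) (sym length-paddedRows) (FP.toℕ<n j))

  nonIncr : NonIncr composition⁺
  nonIncr i j i≤j with ℕP.m≤n⇒m<n∨m≡n i≤j
  ... | inj₂ e = ≤-reflexive (cong (lookup composition⁺) (sym (FP.toℕ-injective e)))
  ... | inj₁ p = subst₂ _≤_ (sym (lookup⁺ j)) (sym (lookup⁺ i)) (rowOrder-≤ (at paddedRows (toℕ i)) (at paddedRows (toℕ j)) (order i j p))

  w-acts : Acts w composition⁺ composition
  w-acts j = begin
    lookup composition (lookup w j)               ≡⟨ lookup-padV N (a ++ s) (lookup w j) ⟩
    nthD (a ++ s) (toℕ (lookup w j))              ≡⟨ cong (nthD (a ++ s)) (Represents.entries≡ w-represents j) ⟩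
    nthD (a ++ s) (nthD L (toℕ j))                ≡⟨ nthD-map (nthD (a ++ s)) L (toℕ j) (subst (toℕ j <_) (sym (Represents.length≡ w-represents)) (FP.toℕ<n j)) ⟨
    nthD (map (nthD (a ++ s)) L) (toℕ j)          ≡⟨ cong (λ l → nthD l (toℕ j)) (shuffle-rows (a ++ s) (N ∸ length (rows Λ)) a s 0 (trues flags) (nthD-++ˡ a s)
                                                       (λ i → trans (cong (λ k → nthD (a ++ s) (k + i)) (trues-rowsC a s (N ∸ length (rows Λ)))) (nthD-++ʳ a s i))) ⟩
    nthD (map proj₁ paddedRows) (toℕ j)           ≡⟨ nthD-exponents paddedRows (toℕ j) ⟩
    proj₁ (at paddedRows (toℕ j))                 ≡⟨ lookup⁺ j ⟨
    lookup composition⁺ j                         ∎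
    where open ≡-Reasoning

  w-isPerm : IsPerm w
  w-isPerm = shuffle-isPerm w-represents

  isPlus : IsPlus composition composition⁺
  isPlus = nonIncr , w , w-isPerm , w-acts

  private
    -- An inversion of w cannot join equal rows: the lower one would be uncircled and have the
    -- larger label.
    drop-equal : ∀ i j → (toℕ i <ᵇ toℕ j) ∧ (toℕ (lookup w j) <ᵇ toℕ (lookup w i)) ≡ true → lookup composition⁺ j < lookup composition⁺ i
    drop-equal i j e with ∧-true (toℕ i <ᵇ toℕ j) _ e
    ... | p , q with order i j (<ᵇ⇒< p)
    ...   | inj₁ r = subst₂ _<_ (sym (lookup⁺ j)) (sym (lookup⁺ i)) r
    ...   | inj₂ (_ , u) = ⊥-elim (ℕP.<-asym (<ᵇ⇒< {toℕ (lookup w j)} q) (subst₂ _<_ (sym (Represents.entries≡ w-represents i)) (sym (Represents.entries≡ w-represents j))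
              (shuffle-increasing paddedRows 0 (trues flags) ≤-refl (toℕ i) (toℕ j) (<ᵇ⇒< p) (subst (toℕ j <_) (sym length-paddedRows) (FP.toℕ<n j)) u)))

  w-isMinPerm : IsMinPerm composition⁺ composition w
  w-isMinPerm = isMinPerm-of {N} {composition⁺} {composition} {w} nonIncr w-isPerm w-acts
    (sum-map-mono (allFin N) (λ i → countB-mono (allFin N) (λ j e → cong₂ _∧_ (<ᵇ-true (drop-equal i j e)) (proj₂ (∧-true (toℕ i <ᵇ toℕ j) _ e)))))

sum-take-padV : ∀ N d k → k ≤ N → sum (take k (toList (padV N (map proj₁ d)))) ≡ partialSum false k d
sum-take-padV N d zero _ = refl
sum-take-padV (suc N) [] (suc k) (s≤s p) = trans (sum-take-padV N [] k p) (empty k)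
  where
  empty : ∀ k → partialSum false k [] ≡ 0
  empty zero = refl
  empty (suc k) = refl
sum-take-padV (suc N) (x ∷ d) (suc k) (s≤s p) = cong₂ _+_ (sym (weight-false x)) (sum-take-padV N d k p)

partialSum-flags : ∀ j d → partialSum true j d ≡ partialSum false j d + prefixTrues j (map proj₂ d)
partialSum-flags zero d = refl
partialSum-flags (suc j) [] = refl
partialSum-flags (suc j) (x ∷ d) rewrite weight-false x | weight-true x | partialSum-flags j d =
  +-interchange (proj₁ x) (b2n (proj₂ x)) (partialSum false j d) _

-- The weight without circles gives dominance of the shapes. If these coincide, subtracting them
-- from the other weight compares the numbers of circles in the first rows, and the chain runs from
-- the flags of Λ to those of Ω, since the smaller composition has the larger permutation.
≼-SPLt : ∀ {n m Ω Λ} → IsSPar n m Ω → IsSPar n m Λ → Ω ≼ Λ → Ω ≢ Λ → SPLt Ω Λ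
≼-SPLt {n} {m} {Ω} {Λ} ispΩ ispΛ le ne = (L.composition⁺ , O.composition⁺ , L.isPlus , O.isPlus , compare) , ne
  where
  N = compLen Ω ⊔ compLen Λ
  module O = PaddedRows ispΩ N (ℕP.m≤m⊔n (compLen Ω) (compLen Λ))
  module L = PaddedRows ispΛ N (ℕP.m≤n⊔m (compLen Ω) (compLen Λ))
  domLe : DomLe O.composition⁺ L.composition⁺
  domLe k k≤N = subst₂ _≤_ (sym (sum-take-padV N (rows Ω) k k≤N)) (sym (sum-take-padV N (rows Λ) k k≤N)) (le false k)
  compare : DomLt O.composition⁺ L.composition⁺ ⊎ (O.composition⁺ ≡ L.composition⁺ ×
              ∃₂ λ wΛ wΩ → IsMinPerm L.composition⁺ L.composition wΛ × IsMinPerm O.composition⁺ O.composition wΩ × BruhatLe wΛ wΩ)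
  compare with VP.≡-dec ℕ._≟_ O.composition⁺ L.composition⁺
  ... | no n = inj₁ (domLe , n)
  ... | yes e = inj₂ (e , L.w , O.w , L.w-isMinPerm , O.w-isMinPerm ,
      adjSwap-Bruhat (adjSwap-chain O.flags L.flags (trans L.length-flags (sym O.length-flags)) (trans L.trues-flags (sym O.trues-flags)) prefix)
        L.w-represents O.w-represents)
    where
    equal : ∀ j → j ≤ N → partialSum false j (rows Ω) ≡ partialSum false j (rows Λ)
    equal j p = trans (sym (sum-take-padV N (rows Ω) j p)) (trans (cong (λ v → sum (take j (toList v))) e) (sum-take-padV N (rows Λ) j p))
    flagsΩ : ∀ j → partialSum true j (rows Ω) ≡ partialSum false j (rows Ω) + prefixTrues j O.flags
    flagsΩ j = trans (sym (partialSum-≃ true j O.paddedRows _ (≃-pad (rows Ω) _))) (trans (partialSum-flags j O.paddedRows)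
      (cong (λ k → k + prefixTrues j O.flags) (partialSum-≃ false j O.paddedRows _ (≃-pad (rows Ω) _))))
    flagsΛ : ∀ j → partialSum true j (rows Λ) ≡ partialSum false j (rows Λ) + prefixTrues j L.flags
    flagsΛ j = trans (sym (partialSum-≃ true j L.paddedRows _ (≃-pad (rows Λ) _))) (trans (partialSum-flags j L.paddedRows)
      (cong (λ k → k + prefixTrues j L.flags) (partialSum-≃ false j L.paddedRows _ (≃-pad (rows Λ) _))))
    prefix : ∀ j → prefixTrues j O.flags ≤ prefixTrues j L.flags
    prefix j with j ℕ.≤? N
    ... | yes p = ℕP.+-cancelˡ-≤ (partialSum false j (rows Ω)) _ _ (≤-trans (≤-reflexive (sym (flagsΩ j)))
            (≤-trans (le true j) (≤-reflexive (trans (flagsΛ j) (cong (λ k → k + prefixTrues j L.flags) (sym (equal j p)))))))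
    -- Beyond the last row both counts are the full number m of circles.
    ... | no q = ≤-reflexive (trans (whole O.flags O.length-flags) (trans O.trues-flags (sym (trans (whole L.flags L.length-flags) L.trues-flags))))
      where
      whole : ∀ F → length F ≡ N → prefixTrues j F ≡ trues F
      whole F l = cong trues (LP.take-all j F (≤-trans (≤-reflexive l) (<⇒≤ (ℕP.≰⇒> q))))

-- Unitriangularity and the basis

∑-extract : ∀ {A : Set} {P : A → Set} (P? : ∀ x → Dec (P x)) {xs : List A} {h : A → ℤ} {y} → Unique xs → y ∈ xs → ¬ P y →
  (∀ {x} → x ≢ y → ¬ P x → h x ≡ + 0) → ∑ xs h ≡ h y +ℤ ∑ (filter P? xs) h
∑-extract {P = P} P? {x ∷ xs} {h} (x∉ ∷ u) (here refl) ny z with P? x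
... | yes p = ⊥-elim (ny p)
... | no _ = cong (h x +ℤ_) (keep xs (All.map (λ n e → n (sym e)) x∉))
  where
  keep : ∀ zs → All (λ z → z ≢ x) zs → ∑ zs h ≡ ∑ (filter P? zs) h
  keep [] [] = refl
  keep (w ∷ zs) (n ∷ ns) with P? w
  ... | yes _ = cong (h w +ℤ_) (keep zs ns)
  ... | no c = trans (cong₂ _+ℤ_ (z n c) (keep zs ns)) (ℤP.+-identityˡ _)
∑-extract {P = P} P? {x ∷ xs} {h} {y} (x∉ ∷ u) (there y∈) ny z with P? x
... | yes _ = trans (cong (h x +ℤ_) (∑-extract P? u y∈ ny z)) (lem (h x) (h y) (∑ (filter P? xs) h))
  where
  lem : ∀ a b c → a +ℤ (b +ℤ c) ≡ b +ℤ (a +ℤ c)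
  lem = ℤR.solve-∀
... | no c = trans (cong₂ _+ℤ_ (z (All.lookup x∉ y∈) c) (∑-extract P? u y∈ ny z)) (ℤP.+-identityˡ _)

module _ (b : SP → SF) where

  lin-map : ∀ (c : SP → ℤ) xs μ → lin b (map (λ Ω → c Ω , Ω) xs) μ ≡ ∑ xs (λ Ω → c Ω *ℤ b Ω μ)
  lin-map c xs μ = cong sumℤ (sym (LP.map-∘ xs))

  lin-++ : ∀ L M μ → lin b (L ++ M) μ ≡ lin b L μ +ℤ lin b M μ
  lin-++ L M μ = ∑-++ L M (λ p → proj₁ p *ℤ b (proj₂ p) μ)

  scale : ℤ → LC → LC
  scale c = map (λ p → c *ℤ proj₁ p , proj₂ p)

  lin-scale : ∀ c L μ → lin b (scale c L) μ ≡ c *ℤ lin b L μ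
  lin-scale c L μ = trans (∑-map (λ p → c *ℤ proj₁ p , proj₂ p) L (λ p → proj₁ p *ℤ b (proj₂ p) μ))
    (trans (∑-cong L (λ p → ℤP.*-assoc c (proj₁ p) (b (proj₂ p) μ))) (∑-* L c (λ p → proj₁ p *ℤ b (proj₂ p) μ)))

InSpan : ℕ → ℕ → (SP → SF) → SF → Set
InSpan n m b f = ∃ λ L → AllSPar n m L × f ≈ lin b L

lin-InSpan : ∀ {n m} b b′ L → All (λ p → InSpan n m b′ (b (proj₂ p))) L → InSpan n m b′ (lin b L)
lin-InSpan b b′ [] [] = [] , [] , λ _ → refl
lin-InSpan b b′ ((c , Λ) ∷ L) ((M , aM , e) ∷ a) with lin-InSpan b b′ L a
... | M′ , aM′ , e′ = scale b′ c M ++ M′ , AllP.++⁺ (AllP.map⁺ aM) aM′ , λ μ →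
  trans (cong₂ _+ℤ_ (trans (cong (c *ℤ_) (e μ)) (sym (lin-scale b′ c M μ))) (e′ μ)) (sym (lin-++ b′ (scale b′ c M) M′ μ))

Leading : (SP → ℤ) → SP → SP → Set
Leading c Λ Ω = c Ω ≢ + 0 × Ω ≢ Λ

leading? : ∀ c Λ Ω → Dec (Leading c Λ Ω)
leading? c Λ Ω with c Ω ℤ.≟ + 0 | Ω ≟SP Λ
... | yes z | _ = no (λ p → proj₁ p z)
... | no _ | yes e = no (λ p → proj₂ p e)
... | no z | no n = yes (z , n)

lowerTerms : ℕ → ℕ → (SP → ℤ) → SP → LC
lowerTerms n m c Λ = map (λ Ω → c Ω , Ω) (filter (leading? c Λ) (superpartitions n m))

lowerTerms-all : ∀ {n m} c Λ {P : SP → Set} → (∀ {Ω} → IsSPar n m Ω → c Ω ≢ + 0 → Ω ≢ Λ → P Ω) →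
  All (λ p → P (proj₂ p)) (lowerTerms n m c Λ)
lowerTerms-all {n} {m} c Λ h = AllP.map⁺ (All.tabulate (λ {Ω} Ω∈ →
  let (q , nz , ne) = MP.∈-filter⁻ (leading? c Λ) {xs = superpartitions n m} Ω∈ in h (superpartitions-sound {n} {m} q) nz ne))

module _ {n m Λ Λ′} (isp : IsSPar n m Λ) (isp′ : IsSPar n m Λ′) (t : Transposed (rows Λ) (rows Λ′))
         {fs} (p : map toFactor (rows Λ) ↭ fs) where

  private
    c : SP → ℤ
    c Ω = prodCoeff fs (canonical Ω)

  unitriangular : ∀ μ → prodCoeff fs (toDense μ) ≡
    leadingSign (suc n + 0) fs *ℤ monoSF Λ′ μ +ℤ lin monoSF (lowerTerms n m c Λ′) μ
  unitriangular μ = begin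
    prodCoeff fs (toDense μ)
      ≡⟨ coeff-expansion isp p μ ⟩
    ∑ (superpartitions n m) (λ Ω → c Ω *ℤ monoSF Ω μ)
      ≡⟨ ∑-extract (leading? c Λ′) (superpartitions-unique n m) (superpartitions-complete isp′) (λ q → proj₂ q refl)
           (λ {Ω} → vanish Ω) ⟩
    c Λ′ *ℤ monoSF Λ′ μ +ℤ ∑ (filter (leading? c Λ′) (superpartitions n m)) (λ Ω → c Ω *ℤ monoSF Ω μ)
      ≡⟨ cong₂ _+ℤ_ (cong (_*ℤ monoSF Λ′ μ) (coeff-leading isp Λ′ t p))
           (sym (lin-map monoSF c (filter (leading? c Λ′) (superpartitions n m)) μ)) ⟩
    leadingSign (suc n + 0) fs *ℤ monoSF Λ′ μ +ℤ lin monoSF (lowerTerms n m c Λ′) μ ∎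
    where
    open ≡-Reasoning
    vanish : ∀ Ω → Ω ≢ Λ′ → ¬ Leading c Λ′ Ω → c Ω *ℤ monoSF Ω μ ≡ + 0
    vanish Ω ne nl with c Ω ℤ.≟ + 0
    ... | yes z = cong (_*ℤ monoSF Ω μ) z
    ... | no nz = ⊥-elim (nl (nz , ne))

eLam-coeff : ∀ Λ μ → eLam Λ μ ≡ prodCoeff (factors Λ) (toDense μ)
eLam-coeff (a , s) = prodSF-eFactors a s

eFactors-increasing : ∀ {a} s → AllPairs _<_ a → Increasing (eFactors a s)
eFactors-increasing {[]} [] [] = []
eFactors-increasing {[]} (x ∷ s) [] = All.universal (λ _ ()) _ ∷ eFactors-increasing s []
eFactors-increasing {x ∷ a} s (p ∷ ps) =
  AllP.++⁺ (AllP.map⁺ (All.map (λ q _ _ → q) p)) (AllP.map⁺ (All.universal (λ _ _ ()) s)) ∷ eFactors-increasing s ps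

reverse-increasing : ∀ {a} → AllPairs _>_ a → AllPairs _<_ (reverse a)
reverse-increasing [] = []
reverse-increasing {x ∷ a} (p ∷ ps) rewrite LP.unfold-reverse x a =
  APP.++⁺ (reverse-increasing ps) ([] ∷ []) (↭P.All-resp-↭ (↭-sym (↭P.↭-reverse a)) (All.map (λ q → q ∷ []) p))

eLamRev-expansion : ∀ {n m} Λ Λ′ → IsSPar n m Λ → IsSPar n m Λ′ → IsConj Λ Λ′ →
  ∃ λ (L : LC) → All (λ p → IsSPar n m (proj₂ p) × SPLt (proj₂ p) Λ′) L × (eLamRev Λ ≈ monoSF Λ′ ⊕ lin monoSF L)
eLamRev-expansion {n} {m} (a , s) Λ′ isp isp′ conjugate =
  lowerTerms n m c Λ′ ,
  lowerTerms-all c Λ′ (λ {Ω} isΩ nz ne → isΩ , ≼-SPLt isΩ isp′ (coeff-dominated isp Λ′ t p {Ω} nz) ne) ,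
  λ μ → trans (prodSF-eFactors (reverse a) s μ) (trans (unitriangular isp isp′ t p μ)
    (cong (_+ℤ lin monoSF (lowerTerms n m c Λ′) μ) (trans
      (cong (_*ℤ monoSF Λ′ μ) (leadingSign-increasing (suc n + 0) (eFactors-increasing s (reverse-increasing (>-allPairs (IsSPar.antiStrict isp))))))
      (ℤP.*-identityˡ _))))
  where
  fs = eFactors (reverse a) s
  c : SP → ℤ
  c Ω = prodCoeff fs (canonical Ω)
  p = toFactor-rows-reverse a s
  t = isConj-transposed {a , s} {Λ′} conjugate

eLam-InP : ∀ {n m} Λ → IsSPar n m Λ → InP n m (eLam Λ)
eLam-InP {n} {m} Λ isp = map (λ Ω → c Ω , Ω) (superpartitions n m) ,
  AllP.map⁺ (All.tabulate (superpartitions-sound {n} {m})) , λ μ →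
  trans (eLam-coeff Λ μ) (trans (coeff-expansion isp (toFactor-rows Λ) μ)
    (sym (lin-map monoSF c (superpartitions n m) μ)))
  where
  c : SP → ℤ
  c Ω = prodCoeff (factors Λ) (canonical Ω)

-- With Λ the conjugate of Ω and u the leading sign, e_Λ = u m_Ω + lower terms. As u u = 1, this is
-- solved for m_Ω by multiplying with u, and the lower terms have smaller rank, on which `k` is a
-- bound.
monoSF-InSpan : ∀ {n m} k Ω → IsSPar n m Ω → rank (suc (n + m)) Ω < k → InSpan n m eLam (monoSF Ω)
monoSF-InSpan {n} {m} (suc k) Ω isp (s≤s r) = (u , Λ) ∷ scale eLam (- u) M , isΛ ∷ AllP.map⁺ aM , λ μ → sym (begin
    u *ℤ eLam Λ μ +ℤ lin eLam (scale eLam (- u) M) μ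
      ≡⟨ cong₂ (λ x y → u *ℤ x +ℤ y) (trans (eLam-coeff Λ μ) (unitriangular isΛ isp t p μ))
           (trans (lin-scale eLam (- u) M μ) (cong (- u *ℤ_) (sym (eM μ)))) ⟩
    u *ℤ (u *ℤ monoSF Ω μ +ℤ lin monoSF L μ) +ℤ - u *ℤ lin monoSF L μ
      ≡⟨ lem u (monoSF Ω μ) (lin monoSF L μ) ⟩
    (u *ℤ u) *ℤ monoSF Ω μ
      ≡⟨ trans (cong (_*ℤ monoSF Ω μ) (leadingSign-sq (suc n + 0) (factors Λ))) (ℤP.*-identityˡ _) ⟩
    monoSF Ω μ ∎)
  where
  open ≡-Reasoning
  Λ = conj n Ω
  isΛ = conj-isSPar isp
  t = transposed-sym (rows Ω) (rows Λ) (conj-transposed isp)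
  p = toFactor-rows Λ
  c : SP → ℤ
  c Ξ = prodCoeff (factors Λ) (canonical Ξ)
  u = leadingSign (suc n + 0) (factors Λ)
  L = lowerTerms n m c Ω
  span : InSpan n m eLam (lin monoSF L)
  span = lin-InSpan monoSF eLam L (lowerTerms-all c Ω (λ {Ξ} isΞ nz ne → monoSF-InSpan k Ξ isΞ
    (ℕP.<-≤-trans (rank-strict isΞ isp (coeff-dominated isΛ Ω t p {Ξ} nz) ne) r)))
  M = proj₁ span
  aM = proj₁ (proj₂ span)
  eM = proj₂ (proj₂ span)
  lem : ∀ u x y → u *ℤ (u *ℤ x +ℤ y) +ℤ - u *ℤ y ≡ (u *ℤ u) *ℤ x
  lem = ℤR.solve-∀

eLam-spans : ∀ {n m} f → InP n m f → ∃ λ L → AllSPar n m L × f ≈ lin eLam L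
eLam-spans {n} {m} f (L , aL , e) = proj₁ span , proj₁ (proj₂ span) , λ μ → trans (e μ) (proj₂ (proj₂ span) μ)
  where
  span : InSpan n m eLam (lin monoSF L)
  span = lin-InSpan monoSF eLam L
    (All.map (λ {p} isp → monoSF-InSpan (suc (rank (suc (n + m)) (proj₂ p))) (proj₂ p) isp ≤-refl) aL)

-- A superpartition may occur several times in `L`; collecting its coefficients turns the
-- combination into a sum over distinct superpartitions.
lin-coeffOf : ∀ {n m} b L → AllSPar n m L → ∀ μ → lin b L μ ≡ ∑ (superpartitions n m) (λ Λ → coeffOf L Λ *ℤ b Λ μ)
lin-coeffOf {n} {m} b [] [] μ = sym (∑-zero (superpartitions n m) (λ _ → refl))
lin-coeffOf {n} {m} b ((c , Λ) ∷ L) (isp ∷ a) μ = sym (begin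
    ∑ E (λ Ω → (indicator (Λ ≟SP Ω) c +ℤ coeffOf L Ω) *ℤ b Ω μ)
      ≡⟨ ∑-cong E (λ Ω → ℤP.*-distribʳ-+ (b Ω μ) (indicator (Λ ≟SP Ω) c) (coeffOf L Ω)) ⟩
    ∑ E (λ Ω → indicator (Λ ≟SP Ω) c *ℤ b Ω μ +ℤ coeffOf L Ω *ℤ b Ω μ)
      ≡⟨ ∑-+ E (λ Ω → indicator (Λ ≟SP Ω) c *ℤ b Ω μ) (λ Ω → coeffOf L Ω *ℤ b Ω μ) ⟩
    ∑ E (λ Ω → indicator (Λ ≟SP Ω) c *ℤ b Ω μ) +ℤ ∑ E (λ Ω → coeffOf L Ω *ℤ b Ω μ)
      ≡⟨ cong₂ _+ℤ_ (trans (∑-single {y = Λ} (superpartitions-unique n m) (superpartitions-complete isp)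
             (λ {Ω} _ ne → cong (_*ℤ b Ω μ) (indicator-no (Λ ≟SP Ω) (ne ∘ sym))))
           (cong (λ d → (if d then c else + 0) *ℤ b Λ μ) (dec-true (Λ ≟SP Λ) refl)))
         (sym (lin-coeffOf b L a μ)) ⟩
    lin b ((c , Λ) ∷ L) μ ∎)
  where
  open ≡-Reasoning
  E = superpartitions n m

coeffOf-∉ : ∀ {Λ} L → All (λ p → proj₂ p ≢ Λ) L → coeffOf L Λ ≡ + 0
coeffOf-∉ [] [] = refl
coeffOf-∉ {Λ} ((c , Ω) ∷ L) (ne ∷ a) = cong₂ _+ℤ_ (indicator-no (Ω ≟SP Λ) ne) (coeffOf-∉ L a)

∈-sum : ∀ {A : Set} (g : A → ℕ) {x xs} → x ∈ xs → g x ≤ sum (map g xs)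
∈-sum g (here refl) = m≤m+n _ _
∈-sum g {xs = y ∷ xs} (there p) = ≤-trans (∈-sum g p) (m≤n+m _ (g y))

module _ {n m} (L : LC) (aL : AllSPar n m L) (vanishes : lin eLam L ≈ zeroSF) where

  private
    rk : SP → ℕ
    rk = rank (suc (n + m))
    E = superpartitions n m
    -- A crude upper bound for all ranks, where the descending induction starts.
    B = sum (map rk E)

  -- Descending induction on the rank of the conjugate. At the leading monomial of Ω = Λ', another
  -- e_Ξ can contribute only if Ω lies strictly below Ξ', so Ξ' has larger rank and the coefficient
  -- of e_Ξ is already zero. What remains is the coefficient of e_Λ times a sign.
  eLam-independent-above : ∀ k Λ → IsSPar n m Λ → B < rk (conj n Λ) + k → coeffOf L Λ ≡ + 0
  eLam-independent-above zero Λ isp B< = ⊥-elim (ℕP.<⇒≱ (ℕP.<-≤-trans B< (≤-reflexive (+-identityʳ _)))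
    (∈-sum rk (superpartitions-complete (conj-isSPar isp))))
  eLam-independent-above (suc k) Λ isp B< = begin
    x              ≡⟨ ℤP.*-identityʳ x ⟨
    x *ℤ + 1       ≡⟨ cong (x *ℤ_) (leadingSign-sq (suc n + 0) (factors Λ)) ⟨
    x *ℤ (u *ℤ u)  ≡⟨ ℤP.*-assoc x u u ⟨
    (x *ℤ u) *ℤ u  ≡⟨ cong (_*ℤ u) xu≡0 ⟩
    + 0            ∎
    where
    open ≡-Reasoning
    Ω = conj n Λ
    x = coeffOf L Λ
    u = leadingSign (suc n + 0) (factors Λ)
    μ = toMono (canonical Ω)
    eLam-at : ∀ Ξ → eLam Ξ μ ≡ prodCoeff (factors Ξ) (canonical Ω)
    eLam-at Ξ = trans (eLam-coeff Ξ μ) (stable-≃ (prodCoeff-stable (factors Ξ)) _ (canonical Ω) (toDense-toMono (canonical Ω)))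
    other : ∀ {Ξ} → Ξ ∈ E → Ξ ≢ Λ → coeffOf L Ξ *ℤ eLam Ξ μ ≡ + 0
    other {Ξ} Ξ∈ ne with prodCoeff (factors Ξ) (canonical Ω) ℤ.≟ + 0
    ... | yes z = trans (cong (coeffOf L Ξ *ℤ_) (trans (eLam-at Ξ) z)) (ℤP.*-zeroʳ (coeffOf L Ξ))
    ... | no nz = cong (_*ℤ eLam Ξ μ) (eLam-independent-above k Ξ isΞ (≤-trans B<
            (≤-trans (≤-reflexive (+-suc _ k)) (ℕP.+-monoˡ-≤ k
              (rank-strict (conj-isSPar isp) (conj-isSPar isΞ)
                (coeff-dominated isΞ (conj n Ξ) (conj-transposed isΞ) (toFactor-rows Ξ) {Ω} nz)
                (λ e → ne (trans (sym (conj-involutive isΞ)) (trans (cong (conj n) (sym e)) (conj-involutive isp)))))))))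
      where
      isΞ = superpartitions-sound {n} {m} Ξ∈
    xu≡0 : x *ℤ u ≡ + 0
    xu≡0 = begin
      x *ℤ u
        ≡⟨ cong (x *ℤ_) (trans (eLam-at Λ) (coeff-leading isp Ω (conj-transposed isp) (toFactor-rows Λ))) ⟨
      x *ℤ eLam Λ μ
        ≡⟨ ∑-single {h = λ Ξ → coeffOf L Ξ *ℤ eLam Ξ μ} (superpartitions-unique n m) (superpartitions-complete isp) other ⟨
      ∑ E (λ Ξ → coeffOf L Ξ *ℤ eLam Ξ μ)
        ≡⟨ lin-coeffOf eLam L aL μ ⟨
      lin eLam L μ
        ≡⟨ vanishes μ ⟩
      + 0 ∎

  eLam-independent : ∀ Λ → coeffOf L Λ ≡ + 0
  eLam-independent Λ with isSPar? n m Λ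
  ... | yes isp = eLam-independent-above (suc B) Λ isp (≤-trans (ℕP.n<1+n B) (m≤n+m (suc B) (rk (conj n Λ))))
  ... | no c = coeffOf-∉ L (All.map (λ { isp refl → c isp }) aL)

theorem3p1 : (n m : ℕ) →
    ((Λ Λ' : SP) → IsSPar n m Λ → IsSPar n m Λ' → IsConj Λ Λ' →
    ∃ λ (L : LC) → All (λ p → IsSPar n m (proj₂ p) × SPLt (proj₂ p) Λ') L ×
    (eLamRev Λ ≈ monoSF Λ' ⊕ lin monoSF L))
    × IsBasisE n m
theorem3p1 n m = eLamRev-expansion , eLam-InP , eLam-spans , eLam-independent
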